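{- Let $n\ge2$, let $\overrightarrow{C_n}$ be the cycle on $n$ vertices oriented cyclically with underlying undirected graph $C_n$, and let $X_{\overrightarrow{C_n}}(\mathbf{x},t)=\sum_{\lambda\vdash n}c_\lambda(t)e_\lambda$. Then for every partition $\lambda=(\lambda_1,\dots,\lambda_k)$ of $n$, $$c_\lambda(t)=\sum_{\bar a\in AO_\lambda(C_n)}t^{\mathrm{asc}_{\overrightarrow{C_n}}(\bar a)},$$ where $AO_\lambda(C_n)$ is the set of all acyclic orientations $\bar a$ of $C_n$ such that the numbers of vertices between consecutive sinks of $\bar a$ are $\lambda_1-1,\lambda_2-1,\dots,\lambda_k-1$ in any order, and $\mathrm{asc}_{\overrightarrow{C_n}}(\bar a)$ is the number of edges of $\overrightarrow{C_n}$ for which the orientations of $\overrightarrow{C_n}$ and $\bar a$ agree.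
   Context: $\overrightarrow{C_n}$ is the digraph on $[n]$ with directed edges $1\to2\to\cdots\to n\to1$ (for $n=2$: the two directed edges $1\to2$, $2\to1$, with underlying graph a single edge). For a digraph $\overrightarrow{G}=(V,E)$, a proper coloring is a map $\kappa:V\to\mathbb{P}=\{1,2,3,\dots\}$ with $\kappa(u)\ne\kappa(v)$ whenever $u,v$ are adjacent, $\mathrm{asc}(\kappa)=|\{(u,v)\in E:\kappa(u)<\kappa(v)\}|$ (where $(u,v)$ is directed from $u$ to $v$), and $$X_{\overrightarrow{G}}(\mathbf{x},t)=\sum_{\kappa}t^{\mathrm{asc}(\kappa)}\prod_{v\in V}x_{\kappa(v)},$$ summed over all proper colorings. For $\overrightarrow{C_n}$ this is a polynomial in $t$ with symmetric function coefficients; $e_\lambda=e_{\lambda_1}e_{\lambda_2}\cdots$ are the elementary symmetric functions and $c_\lambda(t)\in\mathbb{Q}[t]$. A sink of an orientation is a vertex with no outgoing edges. Consecutive sinks are taken going cyclically around the cycle: if the sinks in cyclic order are $s_1,\dots,s_k$, one counts the vertices strictly between $s_i$ and $s_{i+1}$ (with $s_{k+1}=s_1$) along the cyclic direction, giving $k$ numbers, required to equal $\lambda_1-1,\dots,\lambda_k-1$ as a multiset. If there is a single sink, the only such number is $n-1$. Example for $n=9$: sinks $2,6,8$ give the numbers $3,1,2$, corresponding to $\lambda=(4,3,2)$. -}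

module Defs where

open import Data.Bool.Base using (true; false; if_then_else_)
open import Data.Fin.Base using (Fin; toℕ)
open import Data.Fin.Properties using (all?)
open import Data.Fin.Subset using (Subset; ⁅_⁆; _∈_)
open import Data.Fin.Subset.Properties using (_∈?_)
open import Data.List.Base
  using (List; []; _∷_; _++_; map; foldr; length; filter; zipWith; upTo; allFin;
         replicate; concatMap; cartesianProduct; cartesianProductWith)
open import Data.List.Properties using (≡-dec)
open import Data.List.Membership.Propositional using () renaming (_∈_ to _∈ₗ_)
open import Data.List.Membership.Propositional.Properties using (∈-∃++; ∈-allFin)
open import Data.List.Relation.Binary.Permutation.Propositional
  using (_↭_; ↭-refl; ↭-sym; ↭-trans; prep)
open import Data.List.Relation.Binary.Permutation.Propositional.Properties
  using (¬x∷xs↭[]; ∈-resp-↭; drop-∷; shift)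
open import Data.List.Relation.Unary.All as All using (All)
open import Data.List.Relation.Unary.Any using (here; there)
open import Data.List.Relation.Unary.Linked using (Linked; linked?)
open import Data.Nat.Base using (ℕ; zero; suc; pred; _+_; _∸_; _≥_; _<_)
open import Data.Nat.ListAction using (sum)
open import Data.Nat.DivMod using (_mod_)
open import Data.Nat.Properties using (_≟_; _≤?_; _<?_; _≥?_)
open import Data.List.Membership.DecPropositional _≟_ using () renaming (_∈?_ to _∈ₗ?_)
open import Data.Product.Base using (_×_; _,_)
open import Data.Rational.Base as ℚ using (ℚ; 0ℚ; 1ℚ)
open import Data.Sum.Base using (_⊎_; inj₁; inj₂)
open import Data.Vec.Base as Vec using (Vec; lookup; tabulate; toList)
open import Relation.Binary.Construct.Closure.Transitive as TC using (TransClosure; [_])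
open import Relation.Binary.PropositionalEquality using (_≡_; _≢_; refl)
open import Relation.Nullary using (¬_; Dec; yes; no; does)
open import Relation.Nullary.Decidable using (map′; ¬?; _×-dec_; _⊎-dec_; _→-dec_)

vectors : ∀ {A : Set} → List A → ∀ n → List (Vec A n)
vectors xs zero    = Vec.[] ∷ []
vectors xs (suc n) = cartesianProductWith Vec._∷_ xs (vectors xs n)

-- Coefficients are listed constant term first. Trailing zeros are allowed,
-- so equality of polynomials is _≈_ and not _≡_.
ℚ[t] : Set
ℚ[t] = List ℚ

coeff : ℚ[t] → ℕ → ℚ
coeff []      _       = 0ℚ
coeff (a ∷ _) zero    = a
coeff (_ ∷ p) (suc j) = coeff p j

infix 4 _≈_
_≈_ : ℚ[t] → ℚ[t] → Set
p ≈ q = ∀ j → coeff p j ≡ coeff q j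

infixl 6 _+ₚ_
_+ₚ_ : ℚ[t] → ℚ[t] → ℚ[t]
[]      +ₚ q       = q
(a ∷ p) +ₚ []      = a ∷ p
(a ∷ p) +ₚ (b ∷ q) = (a ℚ.+ b) ∷ (p +ₚ q)

infixr 7 _·ₚ_
_·ₚ_ : ℚ → ℚ[t] → ℚ[t]
a ·ₚ p = map (a ℚ.*_) p

t^_ : ℕ → ℚ[t]
t^ j = replicate j 0ℚ ++ 1ℚ ∷ []

sumₚ : List ℚ[t] → ℚ[t]
sumₚ = foldr _+ₚ_ []

-- The variables are x₀, x₁, x₂, …, and the list a₀ ∷ … ∷ aₘ₋₁ ∷ [] stands
-- for the monomial x₀^a₀ ⋯ xₘ₋₁^aₘ₋₁. Lists differing by trailing zeros denote
-- the same monomial; the series below have equal coefficients at such lists.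
Monomial : Set
Monomial = List ℕ

Series : Set → Set
Series A = Monomial → A

-- All (β , γ) with β γ = α.
factorizations : Monomial → List (Monomial × Monomial)
factorizations []      = ([] , []) ∷ []
factorizations (a ∷ α) =
  cartesianProductWith (λ i (β , γ) → (i ∷ β) , ((a ∸ i) ∷ γ))
                       (upTo (suc a)) (factorizations α)

sumℚ : List ℚ → ℚ
sumℚ = foldr ℚ._+_ 0ℚ

infixl 7 _⊛_
_⊛_ : Series ℚ → Series ℚ → Series ℚ
(f ⊛ g) α = sumℚ (map (λ (β , γ) → f β ℚ.* g γ) (factorizations α))

1ₛ : Series ℚ
1ₛ α = if does (All.all? (_≟ 0) α) then 1ℚ else 0ℚ

-- The sum of all squarefree monomials of degree k.
e : ℕ → Series ℚ
e k α = if does (All.all? (_≤? 1) α ×-dec (sum α ≟ k)) then 1ℚ else 0ℚ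

e[_] : List ℕ → Series ℚ
e[ λs ] = foldr (λ k f → e k ⊛ f) 1ₛ λs

infix 4 _≈ₛ_
_≈ₛ_ : Series ℚ[t] → Series ℚ[t] → Set
F ≈ₛ G = ∀ α → F α ≈ G α

infix 4 _⊢_ _⊢?_
_⊢_ : List ℕ → ℕ → Set
λs ⊢ n = All (0 <_) λs × Linked _≥_ λs × sum λs ≡ n

_⊢?_ : ∀ λs n → Dec (λs ⊢ n)
λs ⊢? n = All.all? (0 <?_) λs ×-dec linked? _≥?_ λs ×-dec (sum λs ≟ n)

-- A partition of n has at most n parts, each at most n.
partitions : ℕ → List (List ℕ)
partitions n =
  filter (_⊢? n)
    (concatMap (λ k → map toList (vectors (upTo (suc n)) k)) (upTo (suc n)))

-- Σ_{λ ⊢ n} c_λ(t) e_λ; the values of c off the partitions of n play no role.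
e-expansion : ℕ → (List ℕ → ℚ[t]) → Series ℚ[t]
e-expansion n c α = sumₚ (map (λ λs → e[ λs ] α ·ₚ c λs) (partitions n))

-- Row u is the set of out-neighbours of u.
Digraph : ℕ → Set
Digraph n = Vec (Subset n) n

Arc : ∀ {n} → Digraph n → Fin n → Fin n → Set
Arc G u v = v ∈ lookup G u

arc? : ∀ {n} (G : Digraph n) u v → Dec (Arc G u v)
arc? G u v = v ∈? lookup G u

Adjacent : ∀ {n} → Digraph n → Fin n → Fin n → Set
Adjacent G u v = Arc G u v ⊎ Arc G v u

adjacent? : ∀ {n} (G : Digraph n) u v → Dec (Adjacent G u v)
adjacent? G u v = arc? G u v ⊎-dec arc? G v u

arcs : ∀ {n} → Digraph n → List (Fin n × Fin n)
arcs {n} G = filter (λ (u , v) → arc? G u v) (cartesianProduct (allFin n) (allFin n))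

digraphs : ∀ n → List (Digraph n)
digraphs n = vectors (vectors (false ∷ true ∷ []) n) n

-- Colours, like variables, are numbered from 0.
Coloring : ℕ → Set
Coloring n = Vec ℕ n

Proper : ∀ {n} → Digraph n → Coloring n → Set
Proper G κ = ∀ u v → Adjacent G u v → lookup κ u ≢ lookup κ v

proper? : ∀ {n} (G : Digraph n) κ → Dec (Proper G κ)
proper? G κ = all? λ u → all? λ v → adjacent? G u v →-dec ¬? (lookup κ u ≟ lookup κ v)

asc : ∀ {n} → Digraph n → Coloring n → ℕ
asc G κ = length (filter (λ (u , v) → lookup κ u <? lookup κ v) (arcs G))

-- ∏_v x_{κ(v)}, for κ with colours below m.
weight : ∀ {n} → ℕ → Coloring n → Monomial
weight m κ = map (λ i → Vec.count (_≟ i) κ) (upTo m)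

-- A coloring contributing to the coefficient of α uses only colours below
-- length α, which makes the sum over all proper colorings finite.
X : ∀ {n} → Digraph n → Series ℚ[t]
X {n} G α =
  sumₚ (map (λ κ → t^ (asc G κ))
    (filter (λ κ → proper? G κ ×-dec ≡-dec _≟_ (weight (length α) κ) α)
      (vectors (upTo (length α)) n)))

IsOrientation : ∀ {n} → Digraph n → Digraph n → Set
IsOrientation G A = ∀ u v →
  (Adjacent G u v → Adjacent A u v) ×
  (Adjacent A u v → Adjacent G u v) ×
  ¬ (Arc A u v × Arc A v u)

isOrientation? : ∀ {n} (G A : Digraph n) → Dec (IsOrientation G A)
isOrientation? G A = all? λ u → all? λ v →
  (adjacent? G u v →-dec adjacent? A u v) ×-dec
  (adjacent? A u v →-dec adjacent? G u v) ×-dec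
  ¬? (arc? A u v ×-dec arc? A v u)

Acyclic : ∀ {n} → Digraph n → Set
Acyclic A = ∀ v → ¬ TransClosure (Arc A) v v

-- Reachability through intermediate vertices from a given list only
-- (the Floyd–Warshall recursion), used to decide acyclicity.
module _ {n} (A : Digraph n) where

  Via : List (Fin n) → Fin n → Fin n → Set
  Via []       u v = Arc A u v
  Via (w ∷ ws) u v = Via ws u v ⊎ (Via ws u w × Via ws w v)

  via? : ∀ ws u v → Dec (Via ws u v)
  via? []       u v = arc? A u v
  via? (w ∷ ws) u v = via? ws u v ⊎-dec (via? ws u w ×-dec via? ws w v)

  via⇒path : ∀ ws {u v} → Via ws u v → TransClosure (Arc A) u v
  via⇒path []       p              = [ p ]
  via⇒path (w ∷ ws) (inj₁ p)       = via⇒path ws p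
  via⇒path (w ∷ ws) (inj₂ (p , q)) = via⇒path ws p TC.++ via⇒path ws q

  arc⇒via : ∀ ws {u v} → Arc A u v → Via ws u v
  arc⇒via []       p = p
  arc⇒via (w ∷ ws) p = inj₁ (arc⇒via ws p)

  via-trans : ∀ {ws u v w} → w ∈ₗ ws → Via ws u w → Via ws w v → Via ws u v
  via-trans (here refl) p q = inj₂ (toFirst p , fromFirst q)
    where
    toFirst : ∀ {ws u w} → Via (w ∷ ws) u w → Via ws u w
    toFirst (inj₁ p)       = p
    toFirst (inj₂ (p , _)) = p
    fromFirst : ∀ {ws v w} → Via (w ∷ ws) w v → Via ws w v
    fromFirst (inj₁ p)       = p
    fromFirst (inj₂ (_ , p)) = p
  via-trans (there w∈) (inj₁ p)       (inj₁ q)       = inj₁ (via-trans w∈ p q)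
  via-trans (there w∈) (inj₁ p)       (inj₂ (q , r)) = inj₂ (via-trans w∈ p q , r)
  via-trans (there w∈) (inj₂ (p , q)) (inj₁ r)       = inj₂ (p , via-trans w∈ q r)
  via-trans (there w∈) (inj₂ (p , _)) (inj₂ (_ , s)) = inj₂ (p , s)

  path⇒via : ∀ {u v} → TransClosure (Arc A) u v → Via (allFin n) u v
  path⇒via [ p ]                     = arc⇒via (allFin n) p
  path⇒via (TC._∷_ {y = y} p p⁺) =
    via-trans (∈-allFin y) (arc⇒via (allFin n) p) (path⇒via p⁺)

  path? : ∀ u v → Dec (TransClosure (Arc A) u v)
  path? u v = map′ (via⇒path (allFin n)) path⇒via (via? (allFin n) u v)

acyclic? : ∀ {n} (A : Digraph n) → Dec (Acyclic A)
acyclic? A = all? λ v → ¬? (path? A v v)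

-- The number of arcs of G on whose direction the orientation A agrees with G.
ascₒ : ∀ {n} → Digraph n → Digraph n → ℕ
ascₒ G A = length (filter (λ (u , v) → arc? A u v) (arcs G))

next : ∀ {n} → Fin n → Fin n
next {suc m} i = suc (toℕ i) mod suc m

cycle : ∀ n → Digraph n
cycle n = tabulate (λ i → ⁅ next i ⁆)

Sink : ∀ {n} → Digraph n → Fin n → Set
Sink A u = ∀ v → ¬ Arc A u v

sink? : ∀ {n} (A : Digraph n) u → Dec (Sink A u)
sink? A u = all? λ v → ¬? (arc? A u v)

-- In increasing order.
sinks : ∀ {n} → Digraph n → List ℕ
sinks {n} A = map toℕ (filter (sink? A) (allFin n))

-- For s₁ < … < sₖ below n, the numbers of vertices strictly between sᵢ and
-- sᵢ₊₁ on the n-cycle; the last gap wraps around, ending at n + s₁.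
gaps : ℕ → List ℕ → List ℕ
gaps n []       = []
gaps n (s ∷ ss) = zipWith (λ i j → j ∸ suc i) (s ∷ ss) (ss ++ (n + s) ∷ [])

_↭?_ : (xs ys : List ℕ) → Dec (xs ↭ ys)
[]       ↭? []       = yes ↭-refl
[]       ↭? (y ∷ ys) = no λ p → ¬x∷xs↭[] (↭-sym p)
(x ∷ xs) ↭? ys with x ∈ₗ? ys
... | no  x∉ys = no λ p → x∉ys (∈-resp-↭ p (here refl))
... | yes x∈ys with ∈-∃++ x∈ys
...   | as , bs , refl =
        map′ (λ p → ↭-trans (prep x p) (↭-sym (shift x as bs)))
             (λ p → drop-∷ (↭-trans p (shift x as bs)))
             (xs ↭? (as ++ bs))

InAO : ∀ n → List ℕ → Digraph n → Set
InAO n λs A =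
  IsOrientation (cycle n) A × Acyclic A × (gaps n (sinks A) ↭ map pred λs)

inAO? : ∀ n λs A → Dec (InAO n λs A)
inAO? n λs A =
  isOrientation? (cycle n) A ×-dec acyclic? A ×-dec (gaps n (sinks A) ↭? map pred λs)

AO : ∀ n → List ℕ → List (Digraph n)
AO n λs = filter (inAO? n λs) (digraphs n)

module Submission where

-- X of the directed n-cycle is tr Tⁿ for the matrix Tᵢⱼ = xᵢ · (t, 0 or 1 as i < j,
-- i = j or i > j). Put [k] = 1 + t + ⋯ + tᵏ⁻¹ and D = Σₖ t [k-1] eₖ zᵏ. Adding a new
-- smallest colour and inverting 1 - zT blockwise shows, by induction on the number of
-- colours, that C = Σₙ tr(Tⁿ) zⁿ satisfies C = D C + z D′.
--
-- The acyclic orientations of the cycle are the nonconstant cyclic words in two letters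
-- (edge directed forwards or backwards). The sinks cut such a word into segments of k
-- edges: first j backward and then k - j forward ones, where 0 < j < k, so that a segment
-- contributes t [k-1] eₖ. Reading the words from vertex 0 on, where the segment around
-- that vertex can be placed in k ways, gives Y = D Y + z D′ for the sum Y of all
-- t^asc e_λ zⁿ. The equation has only one solution, so C = Y.

open import Algebra.Bundles using (CommutativeRing)
import Algebra.Properties.CommutativeMonoid.Mult as CMult
import Algebra.Properties.CommutativeSemigroup as CSg
import Algebra.Properties.Group as GroupProps
import Algebra.Properties.Monoid.Mult as Mult
import Algebra.Properties.Semiring.Sum as Sum
import Algebra.Solver.Ring.NaturalCoefficients.Default as NatSolver
open import Data.Bool.Base using (Bool; true; false)
open import Data.Fin.Base using (Fin; zero; suc)
open import Data.List.Base using (List; []; _∷_; _++_; map; foldr; cartesianProductWith)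
open import Data.Nat.Base as ℕ using (ℕ; zero; suc; pred; _≤_; z≤n; s≤s)
open import Data.Nat.Induction using (<-rec)
import Data.Nat.Properties as ℕ
open import Data.Product.Base using (_,_; _×_)
open import Data.Vec.Base using (Vec; []; _∷_)
open import Defs using (vectors)
open import Function.Base using (_∘_)
open import Relation.Binary.PropositionalEquality as ≡ using (_≡_)
import Relation.Binary.Reasoning.Setoid as SetoidReasoning

-- The closed forms behind the induction are 1 + P = E / (1 - D), where `P` collects the nonempty
-- words without equal neighbours and `E` is Σₖ eₖ zᵏ, and C = -z d/dz log (1 - D); here 1 - D is
-- det (1 - zT). The second form cannot be carried through the induction alone: a closed walk
-- through the new colour is made of words in the old colours, so `P` has to be followed along with
-- `C`. A new smallest colour of weight x₀ multiplies E by 1 + x₀ z and 1 - D by 1 - y, where y = x₀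
-- t z P (with the old P) collects the excursions from the new colour back to itself. All of this is
-- stated with the denominators cleared.
--
-- The equality C = Y holds over any commutative ring. It is used for each monomial α separately, in
-- an iterated power series ring with one variable for each entry of α, and it yields one expansion
-- in the e_λ. That every expansion has the same coefficients is a separate matter, the linear
-- independence of the e_λ.

module PowerSeries {c ℓ} (R : CommutativeRing c ℓ) where
  open CommutativeRing R hiding (zero)
  open CSg +-commutativeSemigroup using (interchange)
  open Mult +-monoid using () renaming (_×_ to _×′_)
  open SetoidReasoning setoid

  conv : (ℕ → Carrier) → (ℕ → Carrier) → ℕ → Carrier
  conv f g zero    = f 0 * g 0
  conv f g (suc n) = f 0 * g (suc n) + conv (f ∘ suc) g n

  -- A record rather than the bare pointwise statement, so that an equation between series
  -- determines both series for unification even where the ring operations unfold.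
  record _≋_ (f g : ℕ → Carrier) : Set ℓ where
    constructor mk
    field at : ∀ n → f n ≈ g n
  open _≋_ public

  conv-cong : ∀ {f f′ g g′} → (∀ n → f n ≈ f′ n) → (∀ n → g n ≈ g′ n) →
              ∀ n → conv f g n ≈ conv f′ g′ n
  conv-cong p q zero    = *-cong (p 0) (q 0)
  conv-cong p q (suc n) = +-cong (*-cong (p 0) (q (suc n))) (conv-cong (p ∘ suc) q n)

  -- The recursion of `conv` peels off the head of `f` only. Peeling off the head of `g` as well is
  -- what makes commutativity a plain induction.
  conv-sucʳ : ∀ f g n → conv f g (suc n) ≈ conv f (g ∘ suc) n + f (suc n) * g 0
  conv-sucʳ f g zero    = refl
  conv-sucʳ f g (suc n) = trans (+-congˡ (conv-sucʳ (f ∘ suc) g n)) (sym (+-assoc _ _ _))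

  conv-comm : ∀ f g n → conv f g n ≈ conv g f n
  conv-comm f g zero    = *-comm _ _
  conv-comm f g (suc n) = begin
    f 0 * g (suc n) + conv (f ∘ suc) g n  ≈⟨ +-cong (*-comm _ _) (conv-comm (f ∘ suc) g n) ⟩
    g (suc n) * f 0 + conv g (f ∘ suc) n  ≈⟨ +-comm _ _ ⟩
    conv g (f ∘ suc) n + g (suc n) * f 0  ≈⟨ conv-sucʳ g f n ⟨
    conv g f (suc n)                      ∎

  conv-distribʳ : ∀ h f g n → conv (λ i → f i + g i) h n ≈ conv f h n + conv g h n
  conv-distribʳ h f g zero    = distribʳ _ _ _
  conv-distribʳ h f g (suc n) =
    trans (+-cong (distribʳ _ _ _) (conv-distribʳ h (f ∘ suc) (g ∘ suc) n)) (interchange _ _ _ _)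

  conv-scaleˡ : ∀ r f g n → conv (λ i → r * f i) g n ≈ r * conv f g n
  conv-scaleˡ r f g zero    = *-assoc _ _ _
  conv-scaleˡ r f g (suc n) =
    trans (+-cong (*-assoc _ _ _) (conv-scaleˡ r (f ∘ suc) g n)) (sym (distribˡ _ _ _))

  conv-zeroˡ : ∀ g n → conv (λ _ → 0#) g n ≈ 0#
  conv-zeroˡ g zero    = zeroˡ _
  conv-zeroˡ g (suc n) = trans (+-cong (zeroˡ _) (conv-zeroˡ g n)) (+-identityˡ _)

  conv-assoc : ∀ f g h n → conv (conv f g) h n ≈ conv f (conv g h) n
  conv-assoc f g h zero    = *-assoc _ _ _
  conv-assoc f g h (suc n) = begin
    f 0 * g 0 * h (suc n) + conv (λ m → f 0 * g (suc m) + conv (f ∘ suc) g m) h n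
      ≈⟨ +-cong (*-assoc _ _ _) (conv-distribʳ h (λ m → f 0 * g (suc m)) (conv (f ∘ suc) g) n) ⟩
    f 0 * (g 0 * h (suc n)) + (conv (λ m → f 0 * g (suc m)) h n + conv (conv (f ∘ suc) g) h n)
      ≈⟨ +-congˡ (+-cong (conv-scaleˡ (f 0) (g ∘ suc) h n) (conv-assoc (f ∘ suc) g h n)) ⟩
    f 0 * (g 0 * h (suc n)) + (f 0 * conv (g ∘ suc) h n + conv (f ∘ suc) (conv g h) n)
      ≈⟨ +-assoc _ _ _ ⟨
    f 0 * (g 0 * h (suc n)) + f 0 * conv (g ∘ suc) h n + conv (f ∘ suc) (conv g h) n
      ≈⟨ +-congʳ (distribˡ _ _ _) ⟨
    f 0 * conv g h (suc n) + conv (f ∘ suc) (conv g h) n ∎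

  const : Carrier → ℕ → Carrier
  const r zero    = r
  const r (suc _) = 0#

  conv-constˡ : ∀ r g n → conv (const r) g n ≈ r * g n
  conv-constˡ r g zero    = refl
  conv-constˡ r g (suc n) = trans (+-congˡ (conv-zeroˡ g n)) (+-identityʳ _)

  seriesRing : CommutativeRing c ℓ
  seriesRing = record
    { Carrier = ℕ → Carrier
    ; _≈_ = _≋_
    ; _+_ = λ f g n → f n + g n
    ; _*_ = conv
    ; -_ = λ f n → - f n
    ; 0# = λ _ → 0#
    ; 1# = const 1#
    ; isCommutativeRing = record
      { isRing = record
        { +-isAbelianGroup = record
          { isGroup = record
            { isMonoid = record
              { isSemigroup = record
                { isMagma = record
                  { isEquivalence = record
                    { refl  = mk λ _ → refl
                    ; sym   = λ p → mk λ n → sym (at p n)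
                    ; trans = λ p q → mk λ n → trans (at p n) (at q n) }
                  ; ∙-cong = λ p q → mk λ n → +-cong (at p n) (at q n) }
                ; assoc = λ f g h → mk λ n → +-assoc _ _ _ }
              ; identity = (λ f → mk λ n → +-identityˡ _) , (λ f → mk λ n → +-identityʳ _) }
            ; inverse = (λ f → mk λ n → -‿inverseˡ _) , (λ f → mk λ n → -‿inverseʳ _)
            ; ⁻¹-cong = λ p → mk λ n → -‿cong (at p n) }
          ; comm = λ f g → mk λ n → +-comm _ _ }
        ; *-cong = λ p q → mk (conv-cong (at p) (at q))
        ; *-assoc = λ f g h → mk (conv-assoc f g h)
        ; *-identity = (λ f → mk λ n → trans (conv-constˡ 1# f n) (*-identityˡ _))
                     , (λ f → mk λ n → trans (conv-comm f (const 1#) n)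
                                             (trans (conv-constˡ 1# f n) (*-identityˡ _)))
        ; distrib = (λ h f g → mk λ n →
                       trans (conv-comm h (λ i → f i + g i) n)
                      (trans (conv-distribʳ h f g n) (+-cong (conv-comm f h n) (conv-comm g h n))))
                  , (λ h f g → mk (conv-distribʳ h f g)) }
      ; *-comm = λ f g → mk (conv-comm f g) } }

  -- r z
  lin : Carrier → ℕ → Carrier
  lin r zero    = 0#
  lin r (suc n) = const r n

  lin* : Carrier → (ℕ → Carrier) → ℕ → Carrier
  lin* r f zero    = 0#
  lin* r f (suc n) = r * f n

  conv-lin : ∀ r f n → conv (lin r) f n ≈ lin* r f n
  conv-lin r f zero    = zeroˡ _
  conv-lin r f (suc n) = trans (+-congʳ (zeroˡ _)) (trans (+-identityˡ _) (conv-constˡ r f n))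

  -- z d/dz
  ∂ : (ℕ → Carrier) → ℕ → Carrier
  ∂ f n = n ×′ f n

  open CMult +-commutativeMonoid using (×-distrib-+; ×-congʳ)

  ×-*ʳ : ∀ n x y → n ×′ (x * y) ≈ x * (n ×′ y)
  ×-*ʳ zero    x y = sym (zeroʳ x)
  ×-*ʳ (suc n) x y = trans (+-congˡ (×-*ʳ n x y)) (sym (distribˡ _ _ _))

  leibniz : ∀ f g n → n ×′ conv f g n ≈ conv (∂ f) g n + conv f (∂ g) n
  leibniz f g zero    = sym (trans (+-cong (zeroˡ _) (zeroʳ _)) (+-identityˡ _))
  leibniz f g (suc n) = begin
    suc n ×′ (f 0 * g (suc n) + h)
      ≈⟨ ×-distrib-+ _ _ (suc n) ⟩
    suc n ×′ (f 0 * g (suc n)) + (h + n ×′ h)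
      ≈⟨ +-cong (×-*ʳ (suc n) _ _) (+-congˡ (leibniz (f ∘ suc) g n)) ⟩
    f 0 * ∂ g (suc n) + (h + (conv (∂ (f ∘ suc)) g n + conv (f ∘ suc) (∂ g) n))
      -- Since `suc n ×′ a` unfolds to `a + n ×′ a`, the spare summand `h` turns `∂ (f ∘ suc)` into
      -- `∂ f ∘ suc`.
      ≈⟨ +-congˡ (trans (sym (+-assoc _ _ _)) (+-congʳ (sym (conv-distribʳ g (f ∘ suc) (∂ (f ∘ suc)) n)))) ⟩
    f 0 * ∂ g (suc n) + (conv (∂ f ∘ suc) g n + conv (f ∘ suc) (∂ g) n)
      ≈⟨ x∙yz≈y∙xz _ _ _ ⟩
    conv (∂ f ∘ suc) g n + (f 0 * ∂ g (suc n) + conv (f ∘ suc) (∂ g) n)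
      ≈⟨ +-congʳ (trans (+-congʳ (zeroˡ _)) (+-identityˡ _)) ⟨
    conv (∂ f) g (suc n) + conv f (∂ g) (suc n) ∎
    where
    h = conv (f ∘ suc) g n
    open CSg +-commutativeSemigroup using (x∙yz≈y∙xz)

-- The ring identities behind adding one colour.

module StepAlgebra {c ℓ} (A : CommutativeRing c ℓ) where
  open CommutativeRing A
  open NatSolver commutativeSemiring
  open GroupProps +-group using () renaming (∙-cancelʳ to +-cancelʳ)
  open SetoidReasoning setoid

  -- In both steps D is inverted implicitly: 1 - D is never formed, and a common
  -- summand is cancelled instead, which leaves semiring identities.
  path-step : ∀ {X E D Q P u s} → E + D ≈ 1# + Q → P ≈ Q + D * P →
    s ≈ X + u * P * (1# + s) →
    s + (1# + s) * P ≈ (Q + (X * E + u * Q)) + (D + u * Q) * (s + (1# + s) * P)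
  path-step {X} {E} {D} {Q} {P} {u} {s} E+D P≈ s≈ = sym (+-cancelʳ (X * Q) _ _ (begin
    (Q + (X * E + u * Q)) + (D + u * Q) * (s + (1# + s) * P) + X * Q
      ≈⟨ solve 7 (λ X E D Q P u s →
           (Q :+ (X :* E :+ u :* Q)) :+ (D :+ u :* Q) :* (s :+ (con 1 :+ s) :* P) :+ X :* Q :=
           X :* E :+ u :* Q :* (con 1 :+ s) :+ D :* s :+ (con 1 :+ s) :* (D :* P) :+ Q
             :+ Q :* (X :+ u :* P :* (con 1 :+ s)))
           refl X E D Q P u s ⟩
    X * E + u * Q * (1# + s) + D * s + (1# + s) * (D * P) + Q + Q * (X + u * P * (1# + s))
      ≈⟨ +-cong (+-congʳ (+-congʳ (+-congˡ (*-congˡ s≈)))) (*-congˡ (sym s≈)) ⟩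
    X * E + u * Q * (1# + s) + D * (X + u * P * (1# + s)) + (1# + s) * (D * P) + Q + Q * s
      ≈⟨ solve 7 (λ X E D Q P u s →
           X :* E :+ u :* Q :* (con 1 :+ s) :+ D :* (X :+ u :* P :* (con 1 :+ s))
             :+ (con 1 :+ s) :* (D :* P) :+ Q :+ Q :* s :=
           X :* (E :+ D) :+ (u :* (con 1 :+ s) :* (Q :+ D :* P) :+ (con 1 :+ s) :* (Q :+ D :* P)))
           refl X E D Q P u s ⟩
    X * (E + D) + (u * (1# + s) * (Q + D * P) + (1# + s) * (Q + D * P))
      ≈⟨ +-cong (*-congˡ E+D) (+-cong (*-congˡ (sym P≈)) (*-congˡ (sym P≈))) ⟩
    X * (1# + Q) + (u * (1# + s) * P + (1# + s) * P)
      ≈⟨ solve 5 (λ X Q P u s →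
           X :* (con 1 :+ Q) :+ (u :* (con 1 :+ s) :* P :+ (con 1 :+ s) :* P) :=
           (X :+ u :* P :* (con 1 :+ s)) :+ (con 1 :+ s) :* P :+ X :* Q)
           refl X Q P u s ⟩
    (X + u * P * (1# + s)) + (1# + s) * P + X * Q
      ≈⟨ +-congʳ (+-congʳ (sym s≈)) ⟩
    s + (1# + s) * P + X * Q ∎))

  -- Additivity of the logarithmic derivative: C = -∂ log (1 - D) and K = -∂ log (1 - y), while (1 -
  -- D)(1 - y) = 1 - D - u Q because (1 - D) P = Q. The letters `dD`, `dq` and `dy` stand for
  -- derivatives, of which only the Leibniz rule in the last hypothesis matters.
  cycle-step : ∀ {D Q P u y C K dD dq dy} → P ≈ Q + D * P → y ≈ u * P →
    C ≈ D * C + dD → K ≈ dy + y * K → dy ≈ dq + (dD * y + D * dy) →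
    C + K ≈ (D + u * Q) * (C + K) + (dD + dq)
  cycle-step {D} {Q} {P} {u} {y} {C} {K} {dD} {dq} {dy} P≈ y≈ C≈ K≈ dy≈ = begin
    C + K
      ≈⟨ +-cong C≈ K-eq ⟩
    (D * C + dD) + (D * K + q * (C + K) + dq)
      ≈⟨ solve 6 (λ D q C K dD dq →
           (D :* C :+ dD) :+ (D :* K :+ q :* (C :+ K) :+ dq) :=
           (D :+ q) :* (C :+ K) :+ (dD :+ dq)) refl D q C K dD dq ⟩
    (D + q) * (C + K) + (dD + dq) ∎
    where
    q = u * Q
    y-eq : y ≈ q + D * y
    y-eq = begin
      y                  ≈⟨ y≈ ⟩
      u * P              ≈⟨ *-congˡ P≈ ⟩
      u * (Q + D * P)    ≈⟨ solve 4 (λ u Q D P → u :* (Q :+ D :* P) := u :* Q :+ D :* (u :* P)) refl u Q D P ⟩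
      q + D * (u * P)    ≈⟨ +-congˡ (*-congˡ (sym y≈)) ⟩
      q + D * y          ∎
    -- Both sides are q dD / (1 - D); adding D y C to both replaces the division.
    qC : q * C ≈ y * dD
    qC = +-cancelʳ (D * y * C) _ _ (begin
      q * C + D * y * C      ≈⟨ distribʳ _ _ _ ⟨
      (q + D * y) * C        ≈⟨ *-congʳ (sym y-eq) ⟩
      y * C                  ≈⟨ *-congˡ C≈ ⟩
      y * (D * C + dD)       ≈⟨ solve 4 (λ y D C dD → y :* (D :* C :+ dD) := y :* dD :+ D :* y :* C) refl y D C dD ⟩
      y * dD + D * y * C     ∎)
    K-eq : K ≈ D * K + q * (C + K) + dq
    K-eq = sym (+-cancelʳ (dD * y) _ _ (begin
      D * K + q * (C + K) + dq + dD * y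
        ≈⟨ +-congʳ (+-congʳ (+-congʳ (*-congˡ K≈))) ⟩
      D * (dy + y * K) + q * (C + K) + dq + dD * y
        ≈⟨ solve 8 (λ D dy y K q C dq dD →
             D :* (dy :+ y :* K) :+ q :* (C :+ K) :+ dq :+ dD :* y :=
             (dq :+ (dD :* y :+ D :* dy)) :+ (q :+ D :* y) :* K :+ q :* C)
             refl D dy y K q C dq dD ⟩
      (dq + (dD * y + D * dy)) + (q + D * y) * K + q * C
        ≈⟨ +-cong (+-cong (sym dy≈) (*-congʳ (sym y-eq))) (trans qC (*-comm _ _)) ⟩
      dy + y * K + dD * y
        ≈⟨ +-congʳ (sym K≈) ⟩
      K + dD * y ∎))

module ElementaryPolys {c ℓ} (R : CommutativeRing c ℓ) (t : CommutativeRing.Carrier R) where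
  open CommutativeRing R hiding (zero)

  [_]ₜ : ℕ → Carrier
  [ zero ]ₜ  = 0#
  [ suc k ]ₜ = 1# + t * [ k ]ₜ

  elem : ∀ {m} → (Fin m → Carrier) → ℕ → Carrier
  elem {zero}  x zero    = 1#
  elem {zero}  x (suc k) = 0#
  elem {suc m} x zero    = 1#
  elem {suc m} x (suc k) = elem (x ∘ suc) (suc k) + x zero * elem (x ∘ suc) k

  -- The value at k = 0 is 0, since [ 0 ]ₜ = 0.
  D-coeff : (ℕ → Carrier) → ℕ → Carrier
  D-coeff e k = t * [ pred k ]ₜ * e k

-- The transfer matrix: words and closed walks.

module ClosedWalks {c ℓ} (R : CommutativeRing c ℓ) (t : CommutativeRing.Carrier R) where
  open CommutativeRing R hiding (zero)
  open PowerSeries R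
  open ElementaryPolys R t
  private
    module A = CommutativeRing seriesRing
    module ∑ = Sum semiring
    module ∑A = Sum A.semiring
    module SA = NatSolver A.commutativeSemiring
    module S = NatSolver commutativeSemiring
  open Mult +-monoid using () renaming (_×_ to _×′_)
  open CMult +-commutativeMonoid using (×-distrib-+; ×-congʳ)

  open CSg +-commutativeSemigroup using () renaming (x∙yz≈y∙xz to +-rotate)

  Series : Set c
  Series = ℕ → Carrier

  step : ∀ {m} → Fin m → Fin m → Carrier
  step zero    zero    = 0#
  step zero    (suc _) = t
  step (suc _) zero    = 1#
  step (suc i) (suc j) = step i j

  T : ∀ {m} → (Fin m → Carrier) → Fin m → Fin m → Carrier
  T x i j = x i * step i j

  sum-at : ∀ {k} (f : Fin k → Series) n → ∑A.sum f n ≈ ∑.sum (λ i → f i n)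
  sum-at {zero}  f n = refl
  sum-at {suc k} f n = +-congˡ (sum-at (f ∘ suc) n)

  module _ {m} (M : Fin m → Fin m → Carrier) where
    apply : (Fin m → Series) → Fin m → Series
    apply f i = ∑A.sum (λ k → lin (M i k) A.* f k)

    apply-zero : ∀ f i → apply f i 0 ≈ 0#
    apply-zero f i = trans (sum-at {m} _ 0) (trans (∑.sum-cong-≋ {m} (λ k → zeroˡ _)) (∑.sum-replicate-zero m))

    apply-suc : ∀ f i n → apply f i (suc n) ≈ ∑.sum (λ k → M i k * f k n)
    apply-suc f i n = trans (sum-at {m} _ (suc n)) (∑.sum-cong-≋ {m} (λ k → conv-lin (M i k) (f k) (suc n)))

    Solves : (Fin m → Series) → (Fin m → Series) → Set ℓ
    Solves c f = ∀ i → f i A.≈ c i A.+ apply f i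

    -- This is (1 - zM)⁻¹ c. The factor z lets coefficient n determine coefficient n + 1, so neither
    -- existence nor uniqueness needs an inverse matrix.
    solution : (Fin m → Series) → Fin m → Series
    solution c i zero    = c i 0
    solution c i (suc n) = c i (suc n) + ∑.sum (λ k → M i k * solution c k n)

    solution-solves : ∀ c → Solves c (solution c)
    solution-solves c i = mk λ where
      zero    → sym (trans (+-congˡ (apply-zero (solution c) i)) (+-identityʳ _))
      (suc n) → +-congˡ (sym (apply-suc (solution c) i n))

    solves-unique : ∀ {c f g} → Solves c f → Solves c g → ∀ i → f i A.≈ g i
    solves-unique {c} {f} {g} F G i = mk (λ n → go n i)
      where
      go : ∀ n i → f i n ≈ g i n
      go zero    i = trans (at (F i) 0) (trans (+-congˡ (trans (apply-zero f i) (sym (apply-zero g i))))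
                                               (sym (at (G i) 0)))
      go (suc n) i = trans (at (F i) (suc n)) (trans (+-congˡ
        (trans (apply-suc f i n) (trans (∑.sum-cong-≋ {m} (λ k → *-congˡ (go n k))) (sym (apply-suc g i n)))))
        (sym (at (G i) (suc n))))

    apply-scale : ∀ f r i → apply f i A.* r A.≈ apply (λ k → f k A.* r) i
    apply-scale f r i = A.trans (∑A.*-distribʳ-sum {m} r _) (∑A.sum-cong-≋ {m} (λ k → A.*-assoc _ _ _))

    apply-+ : ∀ f g i → apply f i A.+ apply g i A.≈ apply (λ k → f k A.+ g k) i
    apply-+ f g i = A.trans (A.sym (∑A.∑-distrib-+ {m} _ _)) (∑A.sum-cong-≋ {m} (λ k → A.sym (A.distribˡ _ _ _)))

  δ : ∀ {m} → Fin m → Fin m → Series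
  δ zero    zero    = A.1#
  δ zero    (suc _) = A.0#
  δ (suc _) zero    = A.0#
  δ (suc i) (suc j) = δ i j

  sum-δ : ∀ {m} (f : Fin m → Series) i → ∑A.sum (λ j → f j A.* δ i j) A.≈ f i
  sum-δ {suc m} f zero    = A.trans (A.+-cong (A.*-identityʳ _)
    (A.trans (∑A.sum-cong-≋ {m} (λ j → A.zeroʳ (f (suc j)))) (∑A.sum-replicate-zero m))) (A.+-identityʳ _)
  sum-δ {suc m} f (suc i) = A.trans (A.+-cong (A.zeroʳ _) (sum-δ (f ∘ suc) i)) (A.+-identityˡ _)

  ∂-cong : ∀ {f g} → f A.≈ g → ∂ f A.≈ ∂ g
  ∂-cong p = mk λ n → ×-congʳ n (at p n)

  ∂-+ : ∀ f g → ∂ (f A.+ g) A.≈ ∂ f A.+ ∂ g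
  ∂-+ f g = mk λ n → ×-distrib-+ _ _ n

  ∂-* : ∀ f g → ∂ (f A.* g) A.≈ ∂ f A.* g A.+ f A.* ∂ g
  ∂-* f g = mk (leibniz f g)

  ×-zero : ∀ n → n ×′ 0# ≈ 0#
  ×-zero zero    = refl
  ×-zero (suc n) = trans (+-identityˡ _) (×-zero n)

  ∂-lin : ∀ r → ∂ (lin r) A.≈ lin r
  ∂-lin r = mk λ where
    zero          → refl
    (suc zero)    → +-identityʳ r
    (suc (suc n)) → ×-zero (suc (suc n))

  ∂-sum : ∀ {m} (f : Fin m → Series) → ∂ (∑A.sum f) A.≈ ∑A.sum (∂ ∘ f)
  ∂-sum {zero}  f = mk ×-zero
  ∂-sum {suc m} f = A.trans (∂-+ _ _) (A.+-congˡ (∂-sum (f ∘ suc)))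

  lin-cong : ∀ {r s} → r ≈ s → lin r A.≈ lin s
  lin-cong p = mk λ where
    zero          → refl
    (suc zero)    → p
    (suc (suc n)) → refl

  -- The series of x-weighted words starting with a given letter.
  p : ∀ {m} → (Fin m → Carrier) → Fin m → Series
  p x = solution (T x) (λ i → lin (x i))

  P : ∀ {m} → (Fin m → Carrier) → Series
  P x = ∑A.sum (p x)

  -- W x j i is the (i , j) entry of (1 - z T)⁻¹.
  W : ∀ {m} → (Fin m → Carrier) → Fin m → Fin m → Series
  W x j = solution (T x) (λ i → δ i j)

  C : ∀ {m} → (Fin m → Carrier) → Series
  C x zero    = 0#
  C x (suc n) = ∑.sum (λ i → W x i i (suc n))

  E Q D : ∀ {m} → (Fin m → Carrier) → Series
  E x k = elem x k
  Q x k = [ k ]ₜ * elem x k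
  D x = D-coeff (elem x)

  -- The operator z d/dz marks a letter j of the word. Cutting there leaves a walk from i to j and a
  -- word beginning with j. Formally, both sides solve f = p + zTf.
  ∂p≈Wp : ∀ {m} (x : Fin m → Carrier) i → ∂ (p x i) A.≈ ∑A.sum (λ j → p x j A.* W x j i)
  ∂p≈Wp {m} x = solves-unique (T x) {p x} ∂p-solves Wp-solves
    where
    open SetoidReasoning A.setoid
    M = T x
    p-eq = solution-solves M (λ i → lin (x i))
    ∂p-solves : Solves M (p x) (∂ ∘ p x)
    ∂p-solves i = begin
      ∂ (p x i)
        ≈⟨ ∂-cong (p-eq i) ⟩
      ∂ (lin (x i) A.+ apply M (p x) i)
        ≈⟨ A.trans (∂-+ _ _) (A.+-cong (∂-lin (x i)) (∂-sum {m} _)) ⟩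
      lin (x i) A.+ ∑A.sum (λ k → ∂ (lin (M i k) A.* p x k))
        ≈⟨ A.+-congˡ (∑A.sum-cong-≋ {m} (λ k → A.trans (∂-* _ _) (A.+-congʳ (A.*-congʳ (∂-lin (M i k)))))) ⟩
      lin (x i) A.+ ∑A.sum (λ k → lin (M i k) A.* p x k A.+ lin (M i k) A.* ∂ (p x k))
        ≈⟨ A.+-congˡ (∑A.∑-distrib-+ {m} _ _) ⟩
      lin (x i) A.+ (apply M (p x) i A.+ apply M (∂ ∘ p x) i)
        ≈⟨ A.+-assoc _ _ _ ⟨
      lin (x i) A.+ apply M (p x) i A.+ apply M (∂ ∘ p x) i
        ≈⟨ A.+-congʳ (A.sym (p-eq i)) ⟩
      p x i A.+ apply M (∂ ∘ p x) i ∎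
    Wp-solves : Solves M (p x) (λ i → ∑A.sum (λ j → p x j A.* W x j i))
    Wp-solves i = begin
      ∑A.sum (λ j → p x j A.* W x j i)
        ≈⟨ ∑A.sum-cong-≋ {m} (λ j → A.*-congˡ (solution-solves M (λ i → δ i j) i)) ⟩
      ∑A.sum (λ j → p x j A.* (δ i j A.+ apply M (W x j) i))
        ≈⟨ ∑A.sum-cong-≋ {m} (λ j → A.distribˡ _ _ _) ⟩
      ∑A.sum (λ j → p x j A.* δ i j A.+ p x j A.* apply M (W x j) i)
        ≈⟨ ∑A.∑-distrib-+ {m} _ _ ⟩
      ∑A.sum (λ j → p x j A.* δ i j) A.+ ∑A.sum (λ j → p x j A.* apply M (W x j) i)
        ≈⟨ A.+-cong (sum-δ (p x) i) (∑A.sum-cong-≋ {m} (λ j → ∑A.*-distribˡ-sum {m} (p x j) _)) ⟩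
      p x i A.+ ∑A.sum (λ j → ∑A.sum (λ k → p x j A.* (lin (M i k) A.* W x j k)))
        ≈⟨ A.+-congˡ (∑A.∑-comm {m} {m} _) ⟩
      p x i A.+ ∑A.sum (λ k → ∑A.sum (λ j → p x j A.* (lin (M i k) A.* W x j k)))
        ≈⟨ A.+-congˡ (∑A.sum-cong-≋ {m} (λ k → A.trans
             (∑A.sum-cong-≋ {m} (λ j → x∙yz≈y∙xz _ _ _)) (A.sym (∑A.*-distribˡ-sum {m} _ _)))) ⟩
      p x i A.+ apply M (λ k → ∑A.sum (λ j → p x j A.* W x j k)) i ∎
      where open CSg A.*-commutativeSemigroup using (x∙yz≈y∙xz)

  -- Adding a smallest letter, of weight x zero.
  module Extend {m} (x : Fin (suc m) → Carrier) where
    open SetoidReasoning A.setoid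
    private
      x₀ = x zero
      x⁺ = x ∘ suc
      M = T x⁺
      X = lin x₀
      u = lin (x₀ * t)
      s = p x zero
      g = W x zero zero
      p⁺ = p x⁺
      P⁺ = P x⁺

    loop-free : ∀ f → lin (x₀ * 0#) A.* f A.≈ A.0#
    loop-free f = mk λ where
      zero    → zeroˡ _
      (suc n) → trans (conv-lin (x₀ * 0#) f (suc n)) (trans (*-congʳ (zeroʳ _)) (zeroˡ _))

    -- The new letter has no loop and ascends to each old letter with the same weight `u`, so only
    -- the sum over the old letters enters.
    first-row : ∀ c f → Solves (T x) c f →
      f zero A.≈ c zero A.+ u A.* ∑A.sum (f ∘ suc)
    first-row c f F = A.trans (F zero) (A.+-congˡ (A.trans
      (A.+-cong (loop-free (f zero)) (A.sym (∑A.*-distribˡ-sum {m} u (f ∘ suc)))) (A.+-identityˡ _)))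

    -- A descent from the old letter i to the new one weighs xᵢ z, which is also the inhomogeneous
    -- term that defines `p⁺`. This is why multiples of `p⁺` appear in every solution.
    other-rows : ∀ c f → Solves (T x) c f →
      Solves M (λ i → c (suc i) A.+ lin (x⁺ i) A.* f zero) (f ∘ suc)
    other-rows c f F i = A.trans (F (suc i)) (A.trans (A.sym (A.+-assoc _ _ _))
      (A.+-congʳ (A.+-congˡ (A.*-congʳ (lin-cong (*-identityʳ _))))))

    p-scaled : ∀ r → Solves M (λ i → lin (x⁺ i) A.* r) (λ i → p⁺ i A.* r)
    p-scaled r i = A.trans (A.*-congʳ (solution-solves M (λ i → lin (x⁺ i)) i))
      (A.trans (A.distribʳ _ _ _) (A.+-congˡ (apply-scale M p⁺ r i)))

    Solves-cong : ∀ {c c′ f} → (∀ i → c i A.≈ c′ i) → Solves M c f → Solves M c′ f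
    Solves-cong p F i = A.trans (F i) (A.+-congʳ (p i))

    -- The word is cut before the first occurrence of the new letter; what follows is empty or
    -- begins with that letter.
    p-suc : ∀ i → p x (suc i) A.≈ p⁺ i A.* (A.1# A.+ s)
    p-suc = solves-unique M
      (Solves-cong (λ i → A.sym (A.trans (A.distribˡ _ _ _) (A.+-congʳ (A.*-identityʳ _))))
        (other-rows _ _ (solution-solves (T x) (λ i → lin (x i)))))
      (p-scaled (A.1# A.+ s))

    sum-p-suc : ∑A.sum (p x ∘ suc) A.≈ P⁺ A.* (A.1# A.+ s)
    sum-p-suc = A.trans (∑A.sum-cong-≋ {m} p-suc) (A.sym (∑A.*-distribʳ-sum {m} _ p⁺))

    s-eq : s A.≈ X A.+ u A.* P⁺ A.* (A.1# A.+ s)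
    s-eq = A.trans (first-row _ _ (solution-solves (T x) (λ i → lin (x i))))
      (A.+-congˡ (A.trans (A.*-congˡ sum-p-suc) (A.sym (A.*-assoc _ _ _))))

    P-eq : P x A.≈ s A.+ (A.1# A.+ s) A.* P⁺
    P-eq = A.+-congˡ (A.trans sum-p-suc (A.*-comm _ _))

    W₀-eq = solution-solves (T x) (λ i → δ i zero)

    W₀-suc : ∀ i → W x zero (suc i) A.≈ p⁺ i A.* g
    W₀-suc = solves-unique M
      (Solves-cong (λ i → A.+-identityˡ _) (other-rows _ _ W₀-eq)) (p-scaled g)

    g-eq : g A.≈ A.1# A.+ u A.* (P⁺ A.* g)
    g-eq = A.trans (first-row _ _ W₀-eq) (A.+-congˡ (A.*-congˡ
      (A.trans (∑A.sum-cong-≋ {m} W₀-suc) (A.sym (∑A.*-distribʳ-sum {m} g p⁺)))))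

    b : Fin m → Series
    b j = W x (suc j) zero

    Wₛ-eq : ∀ j → Solves (T x) (λ i → δ i (suc j)) (W x (suc j))
    Wₛ-eq j = solution-solves (T x) (λ i → δ i (suc j))

    -- The Schur complement form of the block inverse: a walk between old letters avoids the new
    -- letter, or it is cut at its first visit there.
    W-suc : ∀ j i → W x (suc j) (suc i) A.≈ W x⁺ j i A.+ p⁺ i A.* b j
    W-suc j = solves-unique M (other-rows _ _ (Wₛ-eq j)) λ i → begin
      W x⁺ j i A.+ p⁺ i A.* b j
        ≈⟨ A.+-cong (solution-solves M (λ i → δ i j) i) (p-scaled (b j) i) ⟩
      (δ i j A.+ apply M (W x⁺ j) i) A.+ (lin (x⁺ i) A.* b j A.+ apply M (λ k → p⁺ k A.* b j) i)
        ≈⟨ interchange _ _ _ _ ⟩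
      (δ i j A.+ lin (x⁺ i) A.* b j) A.+ (apply M (W x⁺ j) i A.+ apply M (λ k → p⁺ k A.* b j) i)
        ≈⟨ A.+-congˡ (apply-+ M (W x⁺ j) _ i) ⟩
      (δ i j A.+ lin (x⁺ i) A.* b j) A.+ apply M (λ k → W x⁺ j k A.+ p⁺ k A.* b j) i ∎
      where open CSg A.+-commutativeSemigroup using (interchange)

    q : Fin m → Series
    q j = ∑A.sum (λ i → W x⁺ j i)

    b-eq : ∀ j → b j A.≈ u A.* (q j A.+ P⁺ A.* b j)
    b-eq j = A.trans (first-row _ _ (Wₛ-eq j)) (A.trans (A.+-identityˡ _) (A.*-congˡ (A.trans
      (∑A.sum-cong-≋ {m} (W-suc j)) (A.trans (∑A.∑-distrib-+ {m} _ _)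
        (A.+-congˡ (A.sym (∑A.*-distribʳ-sum {m} (b j) p⁺)))))))

    B : Series
    B = ∑A.sum (λ j → p⁺ j A.* b j)

    -- Here the derivative enters the trace: the closed walks pair a word starting at j with all
    -- walks arriving at j, and this pairing is z d/dz of the word series.
    ∂P-eq : ∂ P⁺ A.≈ ∑A.sum (λ j → p⁺ j A.* q j)
    ∂P-eq = A.trans (∂-sum p⁺) (A.trans (∑A.sum-cong-≋ {m} (∂p≈Wp x⁺))
      (A.trans (∑A.∑-comm {m} {m} _) (∑A.sum-cong-≋ {m} (λ j → A.sym (∑A.*-distribˡ-sum {m} _ _)))))

    B-eq : B A.≈ u A.* (∂ P⁺ A.+ P⁺ A.* B)
    B-eq = begin
      B
        ≈⟨ ∑A.sum-cong-≋ {m} (λ j → A.trans (A.*-congˡ (b-eq j)) (expand (p⁺ j) u (q j) P⁺ (b j))) ⟩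
      ∑A.sum (λ j → u A.* (p⁺ j A.* q j A.+ P⁺ A.* (p⁺ j A.* b j)))
        ≈⟨ ∑A.*-distribˡ-sum {m} u _ ⟨
      u A.* ∑A.sum (λ j → p⁺ j A.* q j A.+ P⁺ A.* (p⁺ j A.* b j))
        ≈⟨ A.*-congˡ (A.trans (∑A.∑-distrib-+ {m} _ _)
             (A.+-cong (A.sym ∂P-eq) (A.sym (∑A.*-distribˡ-sum {m} P⁺ _)))) ⟩
      u A.* (∂ P⁺ A.+ P⁺ A.* B) ∎
      where
      expand : ∀ p u q P b → p A.* (u A.* (q A.+ P A.* b)) A.≈ u A.* (p A.* q A.+ P A.* (p A.* b))
      expand = let open SA in solve 5 (λ p u q P b →
        p :* (u :* (q :+ P :* b)) := u :* (p :* q :+ P :* (p :* b))) A.refl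

    -- The closed walks through the new letter.
    K : Series
    K = u A.* P⁺ A.* g A.+ B

    C-eq : C x A.≈ C x⁺ A.+ K
    C-eq = mk λ where
      zero    → sym (trans (+-identityˡ _) (trans
        (+-cong (trans (*-congʳ (zeroˡ _)) (zeroˡ _)) (trans (at B-eq 0) (zeroˡ _))) (+-identityˡ _)))
      -- In positive degree `g` agrees with u P⁺ g; its constant term 1 belongs to the identity
      -- matrix, whose trace `C` leaves out.
      (suc n) → trans
        (+-cong (trans (at g-eq (suc n)) (trans (+-identityˡ _) (sym (at (A.*-assoc u P⁺ g) (suc n)))))
                (trans (∑.sum-cong-≋ {m} (λ j → at (W-suc j j) (suc n)))
                (trans (∑.∑-distrib-+ {m} _ _)
                       (+-congˡ (sym (sum-at (λ j → p⁺ j A.* b j) (suc n)))))))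
        (+-rotate _ _ _)

    -- That is, K = ∂y / (1 - y) for y = u P⁺. A closed walk through the new letter is a cyclic
    -- sequence of excursions of weight y; ∂y selects the excursion that contains the starting
    -- point, and the others form an arbitrary sequence.
    K-eq : K A.≈ ∂ (u A.* P⁺) A.+ u A.* P⁺ A.* K
    K-eq = begin
      u A.* P⁺ A.* g A.+ B
        ≈⟨ A.+-cong (A.*-congˡ g-eq) B-eq ⟩
      u A.* P⁺ A.* (A.1# A.+ u A.* (P⁺ A.* g)) A.+ u A.* (∂ P⁺ A.+ P⁺ A.* B)
        ≈⟨ regroup u P⁺ g (∂ P⁺) B ⟩
      (u A.* P⁺ A.+ u A.* ∂ P⁺) A.+ u A.* P⁺ A.* K
        ≈⟨ A.+-congʳ (A.trans (∂-* u P⁺) (A.+-congʳ (A.*-congʳ (∂-lin _)))) ⟨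
      ∂ (u A.* P⁺) A.+ u A.* P⁺ A.* K ∎
      where
      regroup : ∀ u P g dP B → u A.* P A.* (A.1# A.+ u A.* (P A.* g)) A.+ u A.* (dP A.+ P A.* B) A.≈
                (u A.* P A.+ u A.* dP) A.+ u A.* P A.* (u A.* P A.* g A.+ B)
      regroup = let open SA in solve 5 (λ u P g dP B →
        u :* P :* (con 1 :+ u :* (P :* g)) :+ u :* (dP :+ P :* B) :=
        (u :* P :+ u :* dP) :+ u :* P :* (u :* P :* g :+ B)) A.refl

    elem-zero : ∀ {k} (y : Fin k → Carrier) → elem y 0 ≈ 1#
    elem-zero {zero}  y = refl
    elem-zero {suc k} y = refl

    E+D : E x⁺ A.+ D x⁺ A.≈ A.1# A.+ Q x⁺
    E+D = mk λ where
      zero    → +-cong (elem-zero x⁺) (trans (*-congʳ (zeroʳ t)) (trans (zeroˡ _) (sym (zeroˡ _))))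
      (suc k) → let open S in
        solve 3 (λ e t b → e :+ t :* b :* e := con 0 :+ (con 1 :+ t :* b) :* e) refl (elem x⁺ (suc k)) t [ k ]ₜ

    -- From eₖ = eₖ⁺ + x₀ eₖ₋₁⁺: the second part carries t [k-1], and [k-1] is the factor of `Q` one
    -- degree lower.
    D-eq : D x A.≈ D x⁺ A.+ u A.* Q x⁺
    D-eq = mk λ where
      zero    → trans (trans (*-congʳ (zeroʳ t)) (zeroˡ _)) (sym (trans
                  (+-cong (trans (*-congʳ (zeroʳ t)) (zeroˡ _)) (zeroˡ _)) (+-identityˡ _)))
      (suc k) → trans
        (let open S in solve 5 (λ t b e y f → t :* b :* (e :+ y :* f) := t :* b :* e :+ y :* t :* (b :* f))
           refl t [ k ]ₜ (elem x⁺ (suc k)) x₀ (elem x⁺ k))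
        (+-congˡ (sym (conv-lin (x₀ * t) (Q x⁺) (suc k))))

    Q-eq : Q x A.≈ Q x⁺ A.+ (X A.* E x⁺ A.+ u A.* Q x⁺)
    Q-eq = mk λ where
      zero    → trans (zeroˡ _) (sym (trans (+-cong (zeroˡ _) (trans (+-cong (zeroˡ _) (zeroˡ _))
                  (+-identityˡ _))) (+-identityˡ _)))
      (suc k) → trans
        (let open S in solve 5 (λ t b e y f → (con 1 :+ t :* b) :* (e :+ y :* f) :=
              (con 1 :+ t :* b) :* e :+ (y :* f :+ y :* t :* (b :* f)))
           refl t [ k ]ₜ (elem x⁺ (suc k)) x₀ (elem x⁺ k))
        (+-congˡ (sym (+-cong (conv-lin x₀ (E x⁺) (suc k)) (conv-lin (x₀ * t) (Q x⁺) (suc k)))))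

  open StepAlgebra seriesRing

  -- The classical count of words without equal neighbours by ascents. The induction rests on 1 + P
  -- = (1 + s)(1 + P⁺) and 1 + s = (1 + X) / (1 - u P⁺).
  words-equation : ∀ {m} (x : Fin m → Carrier) → P x A.≈ Q x A.+ D x A.* P x
  words-equation {zero}  x = mk λ n → sym (trans (+-cong (Q₀ n) (trans (conv-comm (D x) (P x) n) (conv-zeroˡ (D x) n))) (+-identityˡ _))
    where
    Q₀ : ∀ n → Q x n ≈ 0#
    Q₀ zero    = zeroˡ _
    Q₀ (suc n) = zeroʳ _
  words-equation {suc m} x = A.trans P-eq (A.trans
    (path-step E+D (words-equation (x ∘ suc)) s-eq)
    (A.sym (A.+-cong Q-eq (A.*-cong D-eq P-eq))))
    where open Extend x

  -- Newton's identities for the eigenvalues of T: the traces are their power sums, and up to sign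
  -- the coefficients of `D` are their elementary symmetric functions.
  newton : ∀ {m} (x : Fin m → Carrier) → C x A.≈ D x A.* C x A.+ ∂ (D x)
  newton {zero}  x = mk λ n → trans (C₀ n) (sym (trans (+-cong
      (trans (conv-comm (D x) (C x) n) (trans (conv-cong C₀ (λ _ → refl) n) (conv-zeroˡ (D x) n)))
      (trans (×-congʳ n (D₀ n)) (×-zero n))) (+-identityˡ _)))
    where
    C₀ : ∀ n → C x n ≈ 0#
    C₀ zero    = refl
    C₀ (suc n) = refl
    D₀ : ∀ n → D x n ≈ 0#
    D₀ zero    = trans (*-congʳ (zeroʳ t)) (zeroˡ _)
    D₀ (suc n) = zeroʳ _
  newton {suc m} x = A.trans C-eq (A.trans
    (cycle-step P⁺-eq A.refl (newton (x ∘ suc)) K-eq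
      (A.trans (∂-cong (A.trans (A.*-congˡ P⁺-eq) (distr u (Q (x ∘ suc)) (D (x ∘ suc)) (P (x ∘ suc)))))
        (A.trans (∂-+ _ _) (A.+-congˡ (∂-* _ _)))))
    (A.sym (A.+-cong (A.*-cong D-eq C-eq) (A.trans (∂-cong D-eq) (∂-+ _ _)))))
    where
    open Extend x
    u = lin (x zero * t)
    P⁺-eq = words-equation (x ∘ suc)
    distr : ∀ u Q D P → u A.* (Q A.+ D A.* P) A.≈ u A.* Q A.+ D A.* (u A.* P)
    distr = let open SA in solve 4 (λ u Q D P → u :* (Q :+ D :* P) := u :* Q :+ D :* (u :* P)) A.refl

module ListSums {c ℓ} (R : CommutativeRing c ℓ) where
  open CommutativeRing R hiding (zero)
  open CSg +-commutativeSemigroup using (interchange)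

  ∑ₗ : ∀ {a} {A : Set a} → List A → (A → Carrier) → Carrier
  ∑ₗ xs F = foldr (λ x s → F x + s) 0# xs

  module _ {a} {A : Set a} where
    ∑ₗ-cong : ∀ (xs : List A) {F G} → (∀ x → F x ≈ G x) → ∑ₗ xs F ≈ ∑ₗ xs G
    ∑ₗ-cong []       p = refl
    ∑ₗ-cong (x ∷ xs) p = +-cong (p x) (∑ₗ-cong xs p)

    ∑ₗ-zero : ∀ (xs : List A) → ∑ₗ xs (λ _ → 0#) ≈ 0#
    ∑ₗ-zero []       = refl
    ∑ₗ-zero (x ∷ xs) = trans (+-identityˡ _) (∑ₗ-zero xs)

    ∑ₗ-++ : ∀ (xs ys : List A) F → ∑ₗ (xs ++ ys) F ≈ ∑ₗ xs F + ∑ₗ ys F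
    ∑ₗ-++ []       ys F = sym (+-identityˡ _)
    ∑ₗ-++ (x ∷ xs) ys F = trans (+-congˡ (∑ₗ-++ xs ys F)) (sym (+-assoc _ _ _))

    ∑ₗ-+ : ∀ (xs : List A) F G → ∑ₗ xs (λ x → F x + G x) ≈ ∑ₗ xs F + ∑ₗ xs G
    ∑ₗ-+ []       F G = sym (+-identityˡ _)
    ∑ₗ-+ (x ∷ xs) F G = trans (+-congˡ (∑ₗ-+ xs F G)) (interchange _ _ _ _)

    ∑ₗ-* : ∀ (xs : List A) r F → ∑ₗ xs (λ x → r * F x) ≈ r * ∑ₗ xs F
    ∑ₗ-* []       r F = sym (zeroʳ r)
    ∑ₗ-* (x ∷ xs) r F = trans (+-congˡ (∑ₗ-* xs r F)) (sym (distribˡ _ _ _))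

    ∑ₗ-map : ∀ {b} {B : Set b} (f : B → A) xs F → ∑ₗ (map f xs) F ≈ ∑ₗ xs (F ∘ f)
    ∑ₗ-map f []       F = refl
    ∑ₗ-map f (x ∷ xs) F = +-congˡ (∑ₗ-map f xs F)

    ∑ₗ-product : ∀ {b d} {B : Set b} {E : Set d} (f : B → E → A) xs ys F →
      ∑ₗ (cartesianProductWith f xs ys) F ≈ ∑ₗ xs (λ x → ∑ₗ ys (λ y → F (f x y)))
    ∑ₗ-product f []       ys F = refl
    ∑ₗ-product f (x ∷ xs) ys F = trans (∑ₗ-++ (map (f x) ys) _ F)
      (+-cong (∑ₗ-map (f x) ys F) (∑ₗ-product f xs ys F))

bits : List Bool
bits = true ∷ false ∷ []

-- The generating series of binary cyclic words cut at their sinks.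

module CyclicWords {c ℓ} (R : CommutativeRing c ℓ) (t : CommutativeRing.Carrier R)
                   (e : ℕ → CommutativeRing.Carrier R) where
  open CommutativeRing R hiding (zero)
  open PowerSeries R
  open ElementaryPolys R t
  open ListSums R
  open Mult +-monoid using () renaming (_×_ to _×′_)
  open CSg +-commutativeSemigroup using (interchange)
  open NatSolver commutativeSemiring
  open SetoidReasoning setoid
  private
    module A = CommutativeRing seriesRing

  -- The weight e_{ℓ + s} of the segment that wraps around, with ℓ vertices at the
  -- end and s at the start, is only granted if the word does end in β.
  closing : Bool → ℕ → Bool → ℕ → Carrier
  closing true  s true  ℓ = e (ℓ ℕ.+ s)
  closing false s false ℓ = e (ℓ ℕ.+ s)
  closing _     _ _     _ = 0#

  -- Here ℓ counts the vertices from the latest sink on. A sink lies between a bit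
  -- true (edge directed forwards) and a following bit false.
  scan : ∀ {r} → Bool → ℕ → Bool → ℕ → Vec Bool r → Carrier
  scan β s prev  ℓ []          = closing β s prev ℓ
  scan β s true  ℓ (false ∷ w) = e ℓ * scan β s false 1 w
  scan β s false ℓ (false ∷ w) = scan β s false (suc ℓ) w
  scan β s prev  ℓ (true ∷ w)  = t * scan β s true (suc ℓ) w

  -- No factor `e` is paid at the first sink, since its segment wraps around and is settled by
  -- `closing`. The counter `s` ends as the number of vertices before that sink. A word in which no
  -- sink is met gets 0.
  scan₀ : ∀ {r} → Bool → ℕ → Bool → Vec Bool r → Carrier
  scan₀ β s prev  []          = 0#
  scan₀ β s true  (false ∷ w) = scan β s false 1 w
  scan₀ β s false (false ∷ w) = scan₀ β (suc s) false w
  scan₀ β s prev  (true ∷ w)  = t * scan₀ β (suc s) true w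

  ∑w : ∀ r → (Vec Bool r → Carrier) → Carrier
  ∑w r = ∑ₗ (vectors bits r)

  ∑w-suc : ∀ r F → ∑w (suc r) F ≈ ∑w r (F ∘ (true ∷_)) + ∑w r (F ∘ (false ∷_))
  ∑w-suc r F = trans (∑ₗ-product _∷_ bits (vectors bits r) F) (+-congˡ (+-identityʳ _))

  N : Bool → ℕ → Bool → ℕ → ℕ → Carrier
  N β s prev ℓ r = ∑w r (scan β s prev ℓ)

  N-true-suc : ∀ β s ℓ r → N β s true ℓ (suc r) ≈ e ℓ * N β s false 1 r + t * N β s true (suc ℓ) r
  N-true-suc β s ℓ r = trans (∑w-suc r _) (trans (+-comm _ _)
    (+-cong (∑ₗ-* (vectors bits r) (e ℓ) _) (∑ₗ-* (vectors bits r) t _)))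

  N-false-suc : ∀ β s ℓ r → N β s false ℓ (suc r) ≈ N β s false (suc ℓ) r + t * N β s true (suc ℓ) r
  N-false-suc β s ℓ r = trans (∑w-suc r _) (trans (+-comm _ _)
    (+-congˡ (∑ₗ-* (vectors bits r) t _)))

  pow : ℕ → Carrier
  pow zero    = 1#
  pow (suc k) = t * pow k

  []-suc : ∀ k → [ suc k ]ₜ ≈ [ k ]ₜ + pow k
  []-suc zero    = trans (+-congˡ (zeroʳ t)) (+-comm 1# 0#)
  []-suc (suc k) = trans (+-congˡ (*-congˡ ([]-suc k)))
    (solve 3 (λ t b p → con 1 :+ t :* (b :+ p) := (con 1 :+ t :* b) :+ t :* p) refl t [ k ]ₜ (pow k))

  []-+ : ∀ s r → [ s ℕ.+ r ]ₜ ≈ [ s ]ₜ + pow s * [ r ]ₜ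
  []-+ zero    r = sym (trans (+-identityˡ _) (*-identityˡ _))
  []-+ (suc s) r = trans (+-congˡ (*-congˡ ([]-+ s r)))
    (solve 4 (λ t b p b′ → con 1 :+ t :* (b :+ p :* b′) := (con 1 :+ t :* b) :+ t :* p :* b′)
       refl t [ s ]ₜ (pow s) [ r ]ₜ)

  -- The product z f g; the extra z is the bit `false` that follows a sink.
  shiftConv : (ℕ → Carrier) → (ℕ → Carrier) → ℕ → Carrier
  shiftConv f g zero    = 0#
  shiftConv f g (suc r) = conv f g r

  shiftConv-split : ∀ f g r → conv f g r ≈ f 0 * g r + shiftConv (f ∘ suc) g r
  shiftConv-split f g zero    = sym (+-identityʳ _)
  shiftConv-split f g (suc r) = refl

  shiftConv-cong : ∀ {f f′} g r → (∀ k → f k ≈ f′ k) → shiftConv f g r ≈ shiftConv f′ g r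
  shiftConv-cong g zero    p = refl
  shiftConv-cong g (suc r) p = conv-cong p (λ _ → refl) r

  shiftConv-scale : ∀ a f g r → shiftConv (λ k → a * f k) g r ≈ a * shiftConv f g r
  shiftConv-scale a f g zero    = sym (zeroʳ a)
  shiftConv-scale a f g (suc r) = conv-scaleˡ a f g r

  shiftConv-+ : ∀ f f′ g r → shiftConv (λ k → f k + f′ k) g r ≈ shiftConv f g r + shiftConv f′ g r
  shiftConv-+ f f′ g zero    = sym (+-identityˡ _)
  shiftConv-+ f f′ g (suc r) = conv-distribʳ g f f′ r

  e-suc : ∀ ℓ k → e (ℓ ℕ.+ suc k) ≈ e (suc ℓ ℕ.+ k)
  e-suc ℓ k = reflexive (≡.cong e (ℕ.+-suc ℓ k))

  module _ (β : Bool) (s : ℕ) where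
    private
      n : ℕ → Carrier
      n = N β s false 1

    closing-suc : ∀ prev ℓ k → closing β s prev (ℓ ℕ.+ suc k) ≈ closing β s prev (suc ℓ ℕ.+ k)
    closing-suc prev ℓ k = reflexive (≡.cong (closing β s prev) (ℕ.+-suc ℓ k))

    closing-zero : ∀ prev ℓ → closing β s prev (ℓ ℕ.+ 0) ≈ closing β s prev ℓ
    closing-zero prev ℓ = reflexive (≡.cong (closing β s prev) (ℕ.+-identityʳ ℓ))

    -- If the remaining bits are all `true`, the word closes with them. Otherwise k bits `true`
    -- precede the next sink, after which the count restarts at 1.
    N-true : ∀ ℓ r → N β s true ℓ r ≈
      pow r * closing β s true (ℓ ℕ.+ r) + shiftConv (λ k → pow k * e (ℓ ℕ.+ k)) n r
    N-true ℓ zero    = trans (+-identityʳ _) (sym (trans (+-identityʳ _)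
      (trans (*-identityˡ _) (closing-zero true ℓ))))
    N-true ℓ (suc r) = begin
      N β s true ℓ (suc r)
        ≈⟨ N-true-suc β s ℓ r ⟩
      e ℓ * n r + t * N β s true (suc ℓ) r
        ≈⟨ +-congˡ (*-congˡ (N-true (suc ℓ) r)) ⟩
      e ℓ * n r + t * (pow r * closing β s true (suc ℓ ℕ.+ r) + shiftConv (λ k → pow k * e (suc ℓ ℕ.+ k)) n r)
        ≈⟨ solve 5 (λ a t p q b → a :+ t :* (p :* q :+ b) := t :* p :* q :+ (a :+ t :* b)) refl _ t (pow r) _ _ ⟩
      pow (suc r) * closing β s true (suc ℓ ℕ.+ r) +
        (e ℓ * n r + t * shiftConv (λ k → pow k * e (suc ℓ ℕ.+ k)) n r)
        ≈⟨ +-cong (*-congˡ (sym (closing-suc true ℓ r)))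
             (+-cong (*-congʳ (sym (trans (*-identityˡ _) (reflexive (≡.cong e (ℕ.+-identityʳ ℓ))))))
               (trans (sym (shiftConv-scale t _ n r)) (shiftConv-cong n r λ k →
                 trans (sym (*-assoc _ _ _)) (*-congˡ (sym (e-suc ℓ k)))))) ⟩
      pow (suc r) * closing β s true (ℓ ℕ.+ suc r) +
        (pow 0 * e (ℓ ℕ.+ 0) * n r + shiftConv (λ k → pow (suc k) * e (ℓ ℕ.+ suc k)) n r)
        ≈⟨ +-congˡ (shiftConv-split (λ k → pow k * e (ℓ ℕ.+ k)) n r) ⟨
      pow (suc r) * closing β s true (ℓ ℕ.+ suc r) + conv (λ k → pow k * e (ℓ ℕ.+ k)) n r ∎

    -- The segment is still in its backward phase. Of the k bits before the next sink, the last j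
    -- are `true` with 1 ≤ j ≤ k, which adds up to t + ⋯ + tᵏ = t [k]. The closing terms distinguish
    -- in the same way whether a bit `true` still occurs.
    N-false : ∀ ℓ r → N β s false ℓ r ≈
      closing β s false (ℓ ℕ.+ r) + t * [ r ]ₜ * closing β s true (ℓ ℕ.+ r) +
        shiftConv (λ k → t * [ k ]ₜ * e (ℓ ℕ.+ k)) n r
    N-false ℓ zero    = trans (+-congʳ (sym (closing-zero false ℓ)))
      (solve 3 (λ a t b → a :+ con 0 := a :+ t :* con 0 :* b :+ con 0) refl _ t (closing β s true (ℓ ℕ.+ 0)))
    N-false ℓ (suc r) = begin
      N β s false ℓ (suc r)
        ≈⟨ N-false-suc β s ℓ r ⟩
      N β s false (suc ℓ) r + t * N β s true (suc ℓ) r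
        ≈⟨ +-cong (N-false (suc ℓ) r) (*-congˡ (N-true (suc ℓ) r)) ⟩
      (a + t * [ r ]ₜ * b + shiftConv F n r) + t * (pow r * b + shiftConv G n r)
        ≈⟨ solve 7 (λ a t k b f p g → (a :+ t :* k :* b :+ f) :+ t :* (p :* b :+ g) :=
             a :+ t :* (k :+ p) :* b :+ (f :+ t :* g)) refl a t [ r ]ₜ b _ (pow r) _ ⟩
      a + t * ([ r ]ₜ + pow r) * b + (shiftConv F n r + t * shiftConv G n r)
        ≈⟨ +-cong (+-cong (sym (closing-suc false ℓ r))
                          (*-cong (*-congˡ (sym ([]-suc r))) (sym (closing-suc true ℓ r))))
             (trans (+-congˡ (sym (shiftConv-scale t G n r))) (trans (sym (shiftConv-+ F _ n r))
               (shiftConv-cong n r (λ k → trans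
                 (solve 4 (λ t b e p → t :* b :* e :+ t :* (p :* e) := t :* (b :+ p) :* e)
                    refl t [ k ]ₜ (e (suc ℓ ℕ.+ k)) (pow k))
                 (*-cong (*-congˡ (sym ([]-suc k))) (sym (e-suc ℓ k))))))) ⟩
      closing β s false (ℓ ℕ.+ suc r) + t * [ suc r ]ₜ * closing β s true (ℓ ℕ.+ suc r) +
        shiftConv (λ k → t * [ suc k ]ₜ * e (ℓ ℕ.+ suc k)) n r
        ≈⟨ +-congˡ (sym (trans (shiftConv-split (λ k → t * [ k ]ₜ * e (ℓ ℕ.+ k)) n r)
             (trans (+-congʳ (trans (*-congʳ (trans (*-congʳ (zeroʳ t)) (zeroˡ _))) (zeroˡ _))) (+-identityˡ _)))) ⟩
      closing β s false (ℓ ℕ.+ suc r) + t * [ suc r ]ₜ * closing β s true (ℓ ℕ.+ suc r) +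
        conv (λ k → t * [ k ]ₜ * e (ℓ ℕ.+ k)) n r ∎
      where
      a = closing β s false (suc ℓ ℕ.+ r)
      b = closing β s true (suc ℓ ℕ.+ r)
      F = λ k → t * [ k ]ₜ * e (suc ℓ ℕ.+ k)
      G = λ k → pow k * e (suc ℓ ℕ.+ k)

  D : ℕ → Carrier
  D = D-coeff e

  D-zero : D 0 ≈ 0#
  D-zero = trans (*-congʳ (zeroʳ t)) (zeroˡ _)

  segment : Bool → ℕ → ℕ → Carrier
  segment β s r = closing β s false (suc r) + t * [ r ]ₜ * closing β s true (suc r)

  N-equation : ∀ β s → N β s false 1 A.≈ segment β s A.+ D A.* N β s false 1
  N-equation β s = mk λ r → trans (N-false β s 1 r) (+-congˡ (sym (D* r)))
    where
    D* : ∀ r → conv D (N β s false 1) r ≈ shiftConv (D ∘ suc) (N β s false 1) r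
    D* r = trans (shiftConv-split D _ r) (trans (+-congʳ (trans (*-congʳ D-zero) (zeroˡ _))) (+-identityˡ _))

  -- diag f is the series Σₛ zˢ⁺¹ fₛ.
  diag : (ℕ → ℕ → Carrier) → ℕ → Carrier
  diag f zero    = 0#
  diag f (suc n) = f 0 n + diag (f ∘ suc) n

  diag-cong : ∀ {f g} → (∀ s r → f s r ≈ g s r) → ∀ n → diag f n ≈ diag g n
  diag-cong p zero    = refl
  diag-cong p (suc n) = +-cong (p 0 n) (diag-cong (p ∘ suc) n)

  diag-+ : ∀ f g n → diag (λ s r → f s r + g s r) n ≈ diag f n + diag g n
  diag-+ f g zero    = sym (+-identityˡ _)
  diag-+ f g (suc n) = trans (+-congˡ (diag-+ (f ∘ suc) (g ∘ suc) n)) (interchange _ _ _ _)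

  diag-scale : ∀ a f n → diag (λ s r → a * f s r) n ≈ a * diag f n
  diag-scale a f zero    = sym (zeroʳ a)
  diag-scale a f (suc n) = trans (+-congˡ (diag-scale a (f ∘ suc) n)) (sym (distribˡ _ _ _))

  diag-conv : ∀ g f n → diag (λ s → conv g (f s)) n ≈ conv g (diag f) n
  diag-conv g f zero    = sym (zeroʳ _)
  diag-conv g f (suc n) = begin
    conv g (f 0) n + diag (λ s → conv g (f (suc s))) n
      ≈⟨ +-congˡ (diag-conv g (f ∘ suc) n) ⟩
    conv g (f 0) n + conv g (diag (f ∘ suc)) n
      ≈⟨ at (A.distribˡ g (f 0) (diag (f ∘ suc))) n ⟨
    conv g (diag f ∘ suc) n
      ≈⟨ +-identityʳ _ ⟨
    conv g (diag f ∘ suc) n + 0#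
      ≈⟨ +-congˡ (zeroʳ _) ⟨
    conv g (diag f ∘ suc) n + g (suc n) * diag f 0
      ≈⟨ conv-sucʳ g (diag f) n ⟨
    conv g (diag f) (suc n) ∎

  -- These pairs are the placements of the segment around vertex 0; their number turns `D` into
  -- `∂ D`.
  diag-antidiagonal : ∀ (h : ℕ → Carrier) n → diag (λ s r → h (s ℕ.+ r)) (suc n) ≈ suc n ×′ h n
  diag-antidiagonal h zero    = refl
  diag-antidiagonal h (suc n) = +-congˡ (diag-antidiagonal (h ∘ suc) n)

  N₀ : Bool → ℕ → Bool → ℕ → Carrier
  N₀ β s prev r = ∑w r (scan₀ β s prev)

  N₀-true : ∀ β s r → N₀ β s true r ≈ diag (λ k r → pow k * N β (k ℕ.+ s) false 1 r) r
  N₀-true β s zero    = +-identityʳ _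
  N₀-true β s (suc r) = begin
    N₀ β s true (suc r)
      ≈⟨ trans (∑w-suc r _) (+-comm _ _) ⟩
    N β s false 1 r + ∑w r (λ w → t * scan₀ β (suc s) true w)
      ≈⟨ +-cong (sym (*-identityˡ _)) (trans (∑ₗ-* (vectors bits r) t _) (*-congˡ (N₀-true β (suc s) r))) ⟩
    pow 0 * N β s false 1 r + t * diag (λ k r → pow k * N β (k ℕ.+ suc s) false 1 r) r
      ≈⟨ +-congˡ (trans (sym (diag-scale t _ r)) (diag-cong (λ k r → trans (sym (*-assoc _ _ _))
           (*-congˡ (reflexive (≡.cong (λ s → N β s false 1 r) (ℕ.+-suc k s))))) r)) ⟩
    diag (λ k r → pow k * N β (k ℕ.+ s) false 1 r) (suc r) ∎

  N₀-false : ∀ β s r → N₀ β s false r ≈ diag (λ k r → t * [ k ]ₜ * N β (k ℕ.+ s) false 1 r) r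
  N₀-false β s zero    = +-identityʳ _
  N₀-false β s (suc r) = begin
    N₀ β s false (suc r)
      ≈⟨ ∑w-suc r _ ⟩
    ∑w r (λ w → t * scan₀ β (suc s) true w) + N₀ β (suc s) false r
      ≈⟨ +-cong (trans (∑ₗ-* (vectors bits r) t _) (*-congˡ (N₀-true β (suc s) r))) (N₀-false β (suc s) r) ⟩
    t * diag (λ k r → pow k * N β (k ℕ.+ suc s) false 1 r) r +
      diag (λ k r → t * [ k ]ₜ * N β (k ℕ.+ suc s) false 1 r) r
      ≈⟨ trans (+-congʳ (sym (diag-scale t _ r))) (sym (diag-+ _ _ r)) ⟩
    diag (λ k r → t * (pow k * N β (k ℕ.+ suc s) false 1 r) + t * [ k ]ₜ * N β (k ℕ.+ suc s) false 1 r) r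
      ≈⟨ diag-cong (λ k r → trans
           (solve 4 (λ t p n b → t :* (p :* n) :+ t :* b :* n := t :* (b :+ p) :* n) refl t (pow k) _ [ k ]ₜ)
           (*-cong (*-congˡ (sym ([]-suc k)))
                   (reflexive (≡.cong (λ s → N β s false 1 r) (ℕ.+-suc k s))))) r ⟩
    diag (λ k r → t * [ suc k ]ₜ * N β (suc k ℕ.+ s) false 1 r) r
      ≈⟨ trans (+-congʳ (trans (*-congʳ (zeroʳ t)) (zeroˡ _))) (+-identityˡ _) ⟨
    t * 0# * N β s false 1 r + diag (λ k r → t * [ suc k ]ₜ * N β (suc k ℕ.+ s) false 1 r) r ∎

  -- The edge entering vertex 0 is recorded by the last bit, unknown when the reading starts. Both
  -- values are tried, and `closing` annihilates the wrong one.
  Y : ℕ → Carrier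
  Y n = ∑w n (λ w → scan₀ true 0 true w + scan₀ false 0 false w)

  -- The coefficients of z^(k+1) U k come from the words whose first sink is k.
  U : ℕ → ℕ → Carrier
  U k r = pow k * N true k false 1 r + t * [ k ]ₜ * N false k false 1 r

  Y≈diag : ∀ n → Y n ≈ diag U n
  Y≈diag n = trans (∑ₗ-+ (vectors bits n) _ _) (trans (+-cong (N₀-true true 0 n) (N₀-false false 0 n))
    (trans (sym (diag-+ _ _ n)) (diag-cong (λ k r → +-cong
      (*-congˡ (reflexive (≡.cong (λ s → N true s false 1 r) (ℕ.+-identityʳ k))))
      (*-congˡ (reflexive (≡.cong (λ s → N false s false 1 r) (ℕ.+-identityʳ k))))) n)))

  -- If the word has no sink besides the one at k, its segment turns from backward to forward on one
  -- side of vertex 0. A turn after vertex 0 gives t [k]; a turn before it gives t [r], and then all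
  -- k later edges are forward. Together t ([k] + tᵏ [r]) = t [k+r]. With further sinks, the first
  -- complete segment splits off as a factor `D`.
  U-equation : ∀ k r → U k r ≈ D (suc (k ℕ.+ r)) + conv D (U k) r
  U-equation k r = begin
    pow k * N true k false 1 r + t * [ k ]ₜ * N false k false 1 r
      ≈⟨ +-cong (*-congˡ (at (N-equation true k) r)) (*-congˡ (at (N-equation false k) r)) ⟩
    pow k * (0# + t * [ r ]ₜ * ε + conv D n₁ r) + t * [ k ]ₜ * (ε + t * [ r ]ₜ * 0# + conv D n₂ r)
      ≈⟨ solve 7 (λ p t b e c₁ a c₂ →
           p :* (con 0 :+ t :* b :* e :+ c₁) :+ t :* a :* (e :+ t :* b :* con 0 :+ c₂) :=
           t :* (a :+ p :* b) :* e :+ (p :* c₁ :+ t :* a :* c₂))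
           refl (pow k) t [ r ]ₜ ε (conv D n₁ r) [ k ]ₜ (conv D n₂ r) ⟩
    t * ([ k ]ₜ + pow k * [ r ]ₜ) * ε + (pow k * conv D n₁ r + t * [ k ]ₜ * conv D n₂ r)
      ≈⟨ +-cong (*-cong (*-congˡ (sym ([]-+ k r))) (reflexive (≡.cong (e ∘ suc) (ℕ.+-comm r k))))
           (+-cong (scaleʳ (pow k) n₁) (scaleʳ (t * [ k ]ₜ) n₂)) ⟩
    D (suc (k ℕ.+ r)) + (conv D (λ r → pow k * n₁ r) r + conv D (λ r → t * [ k ]ₜ * n₂ r) r)
      ≈⟨ +-congˡ (at (A.distribˡ D _ _) r) ⟨
    D (suc (k ℕ.+ r)) + conv D (U k) r ∎
    where
    ε = e (suc r ℕ.+ k)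
    n₁ = N true k false 1
    n₂ = N false k false 1
    scaleʳ : ∀ a f → a * conv D f r ≈ conv D (λ r → a * f r) r
    scaleʳ a f = trans (*-congˡ (conv-comm D f r)) (trans (sym (conv-scaleˡ a f D r)) (conv-comm _ D r))

  Y-equation : Y A.≈ D A.* Y A.+ ∂ D
  Y-equation = mk λ n → begin
    Y n
      ≈⟨ Y≈diag n ⟩
    diag U n
      ≈⟨ diag-cong U-equation n ⟩
    diag (λ k r → D (suc (k ℕ.+ r)) + conv D (U k) r) n
      ≈⟨ trans (diag-+ _ _ n) (+-comm _ _) ⟩
    diag (λ k → conv D (U k)) n + diag (λ k r → D (suc (k ℕ.+ r))) n
      ≈⟨ +-cong (trans (diag-conv D U n) (conv-cong (λ _ → refl) (λ k → sym (Y≈diag k)) n)) (∂D n) ⟩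
    conv D Y n + ∂ D n ∎
    where
    ∂D : ∀ n → diag (λ k r → D (suc (k ℕ.+ r))) n ≈ ∂ D n
    ∂D zero    = refl
    ∂D (suc n) = diag-antidiagonal (D ∘ suc) n

  conv-local : ∀ h {f g} n → (∀ k → k ≤ n → f k ≈ g k) → conv h f n ≈ conv h g n
  conv-local h zero    p = *-congˡ (p 0 z≤n)
  conv-local h (suc n) p = +-cong (*-congˡ (p (suc n) ℕ.≤-refl))
    (conv-local (h ∘ suc) n (λ k k≤n → p k (ℕ.m≤n⇒m≤1+n k≤n)))

  -- `D` has no constant term, so coefficient n of D f involves only earlier coefficients of f.
  equation-unique : ∀ {f g h} → f A.≈ D A.* f A.+ h → g A.≈ D A.* g A.+ h → f A.≈ g
  equation-unique {f} {g} {h} F G = mk (<-rec _ go)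
    where
    D*-local : ∀ n → (∀ {k} → k ℕ.< n → f k ≈ g k) → conv D f n ≈ conv D g n
    D*-local zero    p = trans (trans (*-congʳ D-zero) (zeroˡ _)) (sym (trans (*-congʳ D-zero) (zeroˡ _)))
    D*-local (suc n) p = +-cong (trans (trans (*-congʳ D-zero) (zeroˡ _)) (sym (trans (*-congʳ D-zero) (zeroˡ _))))
      (conv-local (D ∘ suc) n (λ k k≤n → p (s≤s k≤n)))
    go : ∀ n → (∀ {k} → k ℕ.< n → f k ≈ g k) → f n ≈ g n
    go n p = trans (at F n) (trans (+-congʳ (D*-local n p)) (sym (at G n)))

-- Acyclic orientations of the cycle as nonconstant binary words.

module CycleDigraph where
  open import Data.Bool.Base using (Bool; true; false; if_then_else_; _∧_; _∨_; not)
  open import Data.Bool.Properties as Bool using (∨-zeroʳ)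
  open import Data.Fin.Base using (Fin; zero; suc; toℕ; fromℕ; inject₁)
  open import Data.Fin.Induction using (<-weakInduction)
  import Data.Fin.Properties as Fin
  open import Data.Fin.Relation.Unary.Top using (view; ‵fromℕ; ‵inject₁)
  import Data.Fin.Subset as Subset
  open import Data.Fin.Subset.Properties using (x∈⁅x⁆; x∈⁅y⁆⇒x≡y)
  open import Data.Integer.Base as ℤ using (ℤ; +_)
  import Data.Integer.Properties as ℤ
  open import Data.List.Base as List using (List; []; _∷_; map; filter; length; allFin)
  open import Data.List.Membership.Propositional using (_∈_)
  open import Data.List.Membership.Propositional.Properties
    using (∈-allFin; ∈-filter⁺; ∈-filter⁻; ∈-map⁺; ∈-map⁻; ∈-cartesianProduct⁺; ∈-cartesianProductWith⁺)
  open import Data.List.Membership.Propositional.Properties.WithK using (unique∧set⇒bag)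
  import Data.List.Properties as List
  open import Data.List.Relation.Binary.BagAndSetEquality using (∼bag⇒↭)
  open import Data.List.Relation.Binary.Permutation.Propositional using (_↭_)
  open import Data.List.Relation.Binary.Permutation.Propositional.Properties using (↭-length; filter-↭)
  open import Data.List.Relation.Unary.All as All using (All; []; _∷_)
  import Data.List.Relation.Unary.All.Properties as All
  open import Data.List.Relation.Unary.Any using (here; there)
  open import Data.List.Relation.Unary.Unique.Propositional using (Unique; []; _∷_)
  import Data.List.Relation.Unary.Unique.Propositional.Properties as Unique
  open import Data.Nat.Base as ℕ using (ℕ; zero; suc; _+_; _<_; s≤s)
  open import Data.Nat.DivMod using (m<n⇒m%n≡m; n%n≡0)
  open import Data.Product.Base using (_×_; _,_; proj₁; proj₂; ∃)
  open import Data.Sum.Base using (_⊎_; inj₁; inj₂)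
  open import Data.Vec.Base as Vec using (Vec; []; _∷_; lookup; _∷ʳ_; tabulate)
  import Data.Vec.Properties as Vec
  open import Defs
  open import Function.Base using (_∘_; id)
  open import Function.Bundles using (mk⇔)
  open import Level using (0ℓ)
  open import Relation.Binary.Construct.Closure.Transitive as TC using (TransClosure; [_]; _∷_)
  open import Relation.Binary.PropositionalEquality
  open import Relation.Nullary using (Dec; yes; no; does; contradiction)
  open import Relation.Nullary.Decidable using (_×-dec_; ¬?)
  open import Relation.Unary using (Pred; Decidable)

  unique-↭ : ∀ {a} {A : Set a} {xs ys : List A} → Unique xs → Unique ys →
             (∀ {x} → x ∈ xs → x ∈ ys) → (∀ {x} → x ∈ ys → x ∈ xs) → xs ↭ ys
  unique-↭ u v f g = ∼bag⇒↭ (unique∧set⇒bag u v (mk⇔ f g))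

  next-fromℕ : ∀ k → next (fromℕ k) ≡ zero
  next-fromℕ k = Fin.toℕ-injective (trans (Fin.toℕ-fromℕ< _)
    (trans (cong (λ m → suc m ℕ.% suc k) (Fin.toℕ-fromℕ k)) (n%n≡0 (suc k))))

  next-inject₁ : ∀ {k} (x : Fin k) → next (inject₁ x) ≡ suc x
  next-inject₁ {k} x = Fin.toℕ-injective (trans (Fin.toℕ-fromℕ< _)
    (trans (cong (λ m → suc m ℕ.% suc k) (Fin.toℕ-inject₁ x)) (m<n⇒m%n≡m (s≤s (Fin.toℕ<n x)))))

  next-injective : ∀ {n} {u v : Fin n} → next u ≡ next v → u ≡ v
  next-injective {suc k} {u} {v} eq with view u | view v
  ... | ‵fromℕ     | ‵fromℕ     = refl
  ... | ‵fromℕ     | ‵inject₁ y = contradiction (trans (sym (next-fromℕ k)) (trans eq (next-inject₁ y))) λ ()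
  ... | ‵inject₁ x | ‵fromℕ     = contradiction (trans (sym (next-fromℕ k)) (trans (sym eq) (next-inject₁ x))) λ ()
  ... | ‵inject₁ x | ‵inject₁ y =
    cong inject₁ (Fin.suc-injective (trans (sym (next-inject₁ x)) (trans eq (next-inject₁ y))))

  next-surjective : ∀ {n} (v : Fin n) → ∃ λ u → next u ≡ v
  next-surjective {suc k} zero    = fromℕ k , next-fromℕ k
  next-surjective {suc k} (suc x) = inject₁ x , next-inject₁ x

  arc⇒next : ∀ {n} {u v : Fin n} → Arc (cycle n) u v → v ≡ next u
  arc⇒next {n} {u} {v} p = x∈⁅y⁆⇒x≡y (next u)
    (subst (v Subset.∈_) (Vec.lookup∘tabulate (λ i → Subset.⁅ next i ⁆) u) p)

  next⇒arc : ∀ {n} (u : Fin n) → Arc (cycle n) u (next u)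
  next⇒arc u = subst (next u Subset.∈_) (sym (Vec.lookup∘tabulate (λ i → Subset.⁅ next i ⁆) u)) (x∈⁅x⁆ (next u))

  arcs-cycle : ∀ n → arcs (cycle n) ↭ map (λ u → u , next u) (allFin n)
  arcs-cycle n = unique-↭
    (Unique.filter⁺ arc?′ (Unique.cartesianProduct⁺ (Unique.allFin⁺ n) (Unique.allFin⁺ n)))
    (Unique.map⁺ (cong proj₁) (Unique.allFin⁺ n))
    to from
    where
    arc?′ : Decidable (λ (uv : Fin n × Fin n) → Arc (cycle n) (proj₁ uv) (proj₂ uv))
    arc?′ (u , v) = arc? (cycle n) u v
    to : ∀ {x} → x ∈ arcs (cycle n) → x ∈ map (λ u → u , next u) (allFin n)
    to {u , v} p = subst (λ v → (u , v) ∈ _)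
      (sym (arc⇒next (proj₂ (∈-filter⁻ arc?′ {xs = List.cartesianProduct (allFin n) (allFin n)} p))))
      (∈-map⁺ (λ u → u , next u) (∈-allFin u))
    from : ∀ {x} → x ∈ map (λ u → u , next u) (allFin n) → x ∈ arcs (cycle n)
    from p with ∈-map⁻ (λ u → u , next u) p
    ... | u , _ , refl = ∈-filter⁺ arc?′ (∈-cartesianProduct⁺ (∈-allFin u) (∈-allFin (next u))) (next⇒arc u)

  length-filter-map : ∀ {a b p} {A : Set a} {B : Set b} {P : Pred B p} (P? : Decidable P) (f : A → B) xs →
    length (filter P? (map f xs)) ≡ length (filter (P? ∘ f) xs)
  length-filter-map P? f []       = refl
  length-filter-map P? f (x ∷ xs) with P? (f x)
  ... | yes _ = cong suc (length-filter-map P? f xs)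
  ... | no  _ = length-filter-map P? f xs

  module _ {A : Set} where

    edgePairs : ∀ {n} → Vec A n → List (A × A)
    edgePairs {n} κ = map (λ u → lookup κ u , lookup κ (next u)) (allFin n)

    stepPairs : ∀ {n} → A → Vec A n → A → List (A × A)
    stepPairs a []      z = (a , z) ∷ []
    stepPairs a (b ∷ v) z = (a , b) ∷ stepPairs b v z

    lookup-∷ʳ-inject₁ : ∀ {n} (v : Vec A n) z u → lookup (v ∷ʳ z) (inject₁ u) ≡ lookup v u
    lookup-∷ʳ-inject₁ (a ∷ v) z zero    = refl
    lookup-∷ʳ-inject₁ (a ∷ v) z (suc u) = lookup-∷ʳ-inject₁ v z u

    lookup-∷ʳ-fromℕ : ∀ {n} (v : Vec A n) z → lookup (v ∷ʳ z) (fromℕ n) ≡ z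
    lookup-∷ʳ-fromℕ []      z = refl
    lookup-∷ʳ-fromℕ (a ∷ v) z = lookup-∷ʳ-fromℕ v z

    lookup-next : ∀ {n} a (v : Vec A n) u → lookup (a ∷ v) (next u) ≡ lookup (v ∷ʳ a) u
    lookup-next a v u with view u
    ... | ‵fromℕ     = trans (cong (lookup (a ∷ v)) (next-fromℕ _)) (sym (lookup-∷ʳ-fromℕ v a))
    ... | ‵inject₁ x = trans (cong (lookup (a ∷ v)) (next-inject₁ x)) (sym (lookup-∷ʳ-inject₁ v a x))

    stepPairs-tabulate : ∀ {n} a (v : Vec A n) z →
      List.tabulate (λ u → lookup (a ∷ v) u , lookup (v ∷ʳ z) u) ≡ stepPairs a v z
    stepPairs-tabulate a []      z = refl
    stepPairs-tabulate a (b ∷ v) z = cong ((a , b) ∷_) (stepPairs-tabulate b v z)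

    edgePairs-∷ : ∀ {n} a (v : Vec A n) → edgePairs (a ∷ v) ≡ stepPairs a v a
    edgePairs-∷ a v = trans (List.map-tabulate id _)
      (trans (List.tabulate-cong (λ u → cong (lookup (a ∷ v) u ,_) (lookup-next a v u)))
             (stepPairs-tabulate a v a))

    arcs-count : ∀ {p n} {P : Pred (A × A) p} (P? : Decidable P) (κ : Vec A n) →
      length (filter (λ (u , v) → P? (lookup κ u , lookup κ v)) (arcs (cycle n))) ≡
      length (filter P? (edgePairs κ))
    arcs-count {n = n} P? κ = trans
      (↭-length (filter-↭ (λ (u , v) → P? (lookup κ u , lookup κ v)) (arcs-cycle n)))
      (trans (length-filter-map (λ (u , v) → P? (lookup κ u , lookup κ v)) (λ u → u , next u) (allFin n))
             (sym (length-filter-map P? (λ u → lookup κ u , lookup κ (next u)) (allFin n))))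

  proper⇒edges : ∀ {n} (κ : Coloring n) → Proper (cycle n) κ →
    All (λ (a , b) → a ≢ b) (edgePairs κ)
  proper⇒edges κ p = All.tabulate λ x∈ → case (∈-map⁻ _ x∈)
    where
    case : ∀ {x} → (∃ λ u → u ∈ allFin _ × x ≡ (lookup κ u , lookup κ (next u))) → proj₁ x ≢ proj₂ x
    case (u , _ , refl) = p u (next u) (inj₁ (next⇒arc u))

  edges⇒proper : ∀ {n} (κ : Coloring n) → All (λ (a , b) → a ≢ b) (edgePairs κ) →
    Proper (cycle n) κ
  edges⇒proper κ ps u v adj = go adj
    where
    edge : ∀ u → lookup κ u ≢ lookup κ (next u)
    edge u = All.lookup ps (∈-map⁺ (λ u → lookup κ u , lookup κ (next u)) (∈-allFin u))
    go : Adjacent (cycle _) u v → lookup κ u ≢ lookup κ v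
    go (inj₁ a) rewrite arc⇒next a = edge u
    go (inj₂ a) rewrite arc⇒next a = edge v ∘ sym

  lastBit : ∀ {r} → Bool → Vec Bool r → Bool
  lastBit b []      = b
  lastBit b (a ∷ w) = lastBit a w

  ones : ∀ {r} → Vec Bool r → ℕ
  ones []          = 0
  ones (true ∷ w)  = suc (ones w)
  ones (false ∷ w) = ones w

  sinkPositions : ∀ {r} → ℕ → Bool → Vec Bool r → List ℕ
  sinkPositions p prev  []          = []
  sinkPositions p true  (false ∷ w) = p ∷ sinkPositions (suc p) false w
  sinkPositions p false (false ∷ w) = sinkPositions (suc p) false w
  sinkPositions p prev  (true ∷ w)  = sinkPositions (suc p) true w

  -- The bit preceding vertex 0 is the last one; the default `true` is returned only for the empty
  -- word.
  wordSinks : ∀ {n} → Vec Bool n → List ℕ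
  wordSinks w = sinkPositions 0 (lastBit true w) w

  lastBit-∷ : ∀ {r} b (a : Bool) (w : Vec Bool r) → lastBit b (a ∷ w) ≡ lookup (a ∷ w) (fromℕ r)
  lastBit-∷ b a []      = refl
  lastBit-∷ b a (c ∷ w) = lastBit-∷ a c w

  -- Prepending the last bit is a cyclic shift: each vertex finds the bit of the edge entering it at
  -- its own index.
  previous-bit : ∀ {n} (w : Vec Bool n) u →
    lookup (lastBit true w ∷ w) (inject₁ (next u)) ≡ lookup w u
  previous-bit (a ∷ w) u with view u
  ... | ‵fromℕ     = trans (cong (lookup (lastBit a w ∷ a ∷ w) ∘ inject₁) (next-fromℕ _)) (lastBit-∷ true a w)
  ... | ‵inject₁ x = cong (lookup (lastBit a w ∷ a ∷ w) ∘ inject₁) (next-inject₁ x)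

  filter-∷ : ∀ {a p} {A : Set a} {P : Pred A p} (P? : Decidable P) x xs →
    filter P? (x ∷ xs) ≡ (if does (P? x) then x ∷ filter P? xs else filter P? xs)
  filter-∷ P? x xs with does (P? x)
  ... | true  = refl
  ... | false = refl

  filter-allFin-suc : ∀ {n} {P : Pred (Fin (suc n)) 0ℓ} (P? : Decidable P) (h : Fin (suc n) → ℕ) →
    map h (filter P? (List.tabulate suc)) ≡ map (h ∘ suc) (filter (P? ∘ suc) (allFin n))
  filter-allFin-suc {n} P? h = trans (cong (map h ∘ filter P?) (sym (List.map-tabulate id suc)))
    (go (allFin n))
    where
    go : ∀ xs → map h (filter P? (map suc xs)) ≡ map (h ∘ suc) (filter (P? ∘ suc) xs)
    go []       = refl
    go (x ∷ xs) with P? (suc x)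
    ... | yes _ = cong (h (suc x) ∷_) (go xs)
    ... | no  _ = go xs

  -- An arbitrary predicate takes the place of being a sink, because the induction removes the first
  -- vertex and the rest is no longer a cycle. For the same reason positions are read through `h`
  -- with an offset `p`.
  sinkPositions-filter : ∀ {n} p prev (w : Vec Bool n) {P : Pred (Fin n) 0ℓ} (P? : Decidable P) →
    (∀ v → P v → lookup (prev ∷ w) (inject₁ v) ≡ true × lookup w v ≡ false) →
    (∀ v → lookup (prev ∷ w) (inject₁ v) ≡ true → lookup w v ≡ false → P v) →
    ∀ (h : Fin n → ℕ) → (∀ v → h v ≡ p + toℕ v) →
    map h (filter P? (allFin n)) ≡ sinkPositions p prev w
  sinkPositions-filter p prev []      P? f g h eq = refl
  sinkPositions-filter {suc n} p prev (b ∷ w) {P} P? f g h eq =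
    trans (cong (map h) (filter-∷ P? zero (List.tabulate suc))) (by-cases prev b (P? zero) refl f g)
    where
    tail = trans (filter-allFin-suc P? h) (sinkPositions-filter (suc p) b w (P? ∘ suc) (f ∘ suc) (g ∘ suc)
             (h ∘ suc) (λ v → trans (eq (suc v)) (ℕ.+-suc p (toℕ v))))
    first : ∀ {xs ys : List ℕ} → xs ≡ ys → h zero ∷ xs ≡ p ∷ ys
    first = cong₂ _∷_ (trans (eq zero) (ℕ.+-identityʳ p))
    by-cases : ∀ prev b′ (d : Dec (P zero)) → b′ ≡ b →
      (∀ v → P v → lookup (prev ∷ b ∷ w) (inject₁ v) ≡ true × lookup (b ∷ w) v ≡ false) →
      (∀ v → lookup (prev ∷ b ∷ w) (inject₁ v) ≡ true → lookup (b ∷ w) v ≡ false → P v) →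
      map h (if does d then zero ∷ filter P? (List.tabulate suc) else filter P? (List.tabulate suc)) ≡
        sinkPositions p prev (b′ ∷ w)
    by-cases true  false (yes _)  refl f g = first tail
    by-cases true  false (no ¬q)  refl f g = contradiction (g zero refl refl) ¬q
    by-cases false false (yes q)  refl f g = contradiction (proj₁ (f zero q)) λ ()
    by-cases false false (no _)   refl f g = tail
    by-cases true  true  (yes q)  refl f g = contradiction (proj₂ (f zero q)) λ ()
    by-cases true  true  (no _)   refl f g = tail
    by-cases false true  (yes q)  refl f g = contradiction (proj₁ (f zero q)) λ ()
    by-cases false true  (no _)   refl f g = tail

  no-sinks-true : ∀ {r} p (w : Vec Bool r) → sinkPositions p true w ≡ [] → ∀ v → lookup w v ≡ true
  no-sinks-true p (true ∷ w) eq zero    = refl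
  no-sinks-true p (true ∷ w) eq (suc v) = no-sinks-true (suc p) w eq v

  lastBit-const : ∀ {r} b (w : Vec Bool r) → (∀ v → lookup w v ≡ b) → lastBit b w ≡ b
  lastBit-const b []      all = refl
  lastBit-const b (a ∷ w) all rewrite all zero = lastBit-const b w (all ∘ suc)

  -- Without a sink a bit `true` would persist to the end, against the last bit.
  no-sinks-false : ∀ {r} p (w : Vec Bool r) → sinkPositions p false w ≡ [] → lastBit false w ≡ false →
    ∀ v → lookup w v ≡ false
  no-sinks-false p (false ∷ w) eq l zero    = refl
  no-sinks-false p (false ∷ w) eq l (suc v) = no-sinks-false (suc p) w eq l v
  no-sinks-false p (true ∷ w)  eq l v       =
    contradiction (trans (sym (lastBit-const true w (no-sinks-true (suc p) w eq))) l) λ ()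

  no-sinks⇒constant : ∀ {n} (w : Vec Bool n) → wordSinks w ≡ [] → ∃ λ b → ∀ v → lookup w v ≡ b
  no-sinks⇒constant []      eq = true , λ ()
  no-sinks⇒constant (a ∷ w) eq = go (lastBit a w) refl eq
    where
    go : ∀ l → lastBit a w ≡ l → sinkPositions 0 l (a ∷ w) ≡ [] → ∃ λ b → ∀ v → lookup (a ∷ w) v ≡ b
    go true  l eq = true , no-sinks-true 0 (a ∷ w) eq
    go false l eq = false , no-sinks-false 0 (a ∷ w) eq l

  constant-no-sinks : ∀ {r} p b (w : Vec Bool r) → (∀ v → lookup w v ≡ b) → sinkPositions p b w ≡ []
  constant-no-sinks p b     []          all = refl
  constant-no-sinks p true  (true ∷ w)  all = constant-no-sinks (suc p) true w (all ∘ suc)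
  constant-no-sinks p false (false ∷ w) all = constant-no-sinks (suc p) false w (all ∘ suc)
  constant-no-sinks p true  (false ∷ w) all = contradiction (all zero) λ ()
  constant-no-sinks p false (true ∷ w)  all = contradiction (all zero) λ ()

  constant⇒no-sinks : ∀ {n} b (w : Vec Bool n) → (∀ v → lookup w v ≡ b) → wordSinks w ≡ []
  constant⇒no-sinks b []      all = refl
  constant⇒no-sinks b (a ∷ w) all rewrite all zero | lastBit-const b w (all ∘ suc) =
    constant-no-sinks 0 b (b ∷ w) λ where
      zero    → refl
      (suc v) → all (suc v)

  vectors-unique : ∀ {A : Set} {xs : List A} → Unique xs → ∀ n → Unique (vectors xs n)
  vectors-unique u zero    = [] ∷ []
  vectors-unique u (suc n) = Unique.cartesianProductWith⁺ Vec._∷_ Vec.∷-injective u (vectors-unique u n)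

  vectors-complete : ∀ {A : Set} {xs : List A} {n} (v : Vec A n) → (∀ i → lookup v i ∈ xs) → v ∈ vectors xs n
  vectors-complete []      p = here refl
  vectors-complete (a ∷ v) p = ∈-cartesianProductWith⁺ Vec._∷_ (p zero) (vectors-complete v (p ∘ suc))

  unique-map : ∀ {A B : Set} (f : A → B) {xs} → (∀ {x y} → x ∈ xs → y ∈ xs → f x ≡ f y → x ≡ y) →
    Unique xs → Unique (map f xs)
  unique-map f inj []       = []
  unique-map f inj (p ∷ ps) =
    All.map⁺ (All.tabulate λ y∈ eq → All.lookup p y∈ (inj (here refl) (there y∈) eq)) ∷
    unique-map f (λ x∈ y∈ → inj (there x∈) (there y∈)) ps

  bool-ext : ∀ {a b : Bool} → (a ≡ true → b ≡ true) → (b ≡ true → a ≡ true) → a ≡ b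
  bool-ext {false} {false} f g = refl
  bool-ext {false} {true}  f g = g refl
  bool-ext {true}  {false} f g = sym (f refl)
  bool-ext {true}  {true}  f g = refl

  lookup-ext : ∀ {A : Set} {n} {v w : Vec A n} → (∀ i → lookup v i ≡ lookup w i) → v ≡ w
  lookup-ext {v = v} {w} p = trans (sym (Vec.tabulate∘lookup v)) (trans (Vec.tabulate-cong p) (Vec.tabulate∘lookup w))

  digraph-ext : ∀ {n} {A B : Digraph n} → (∀ u v → Arc A u v → Arc B u v) →
    (∀ u v → Arc B u v → Arc A u v) → A ≡ B
  digraph-ext f g = lookup-ext λ u → lookup-ext λ v → bool-ext
    (λ p → Vec.[]=⇒lookup (f u v (Vec.lookup⇒[]= v _ p)))
    (λ p → Vec.[]=⇒lookup (g u v (Vec.lookup⇒[]= v _ p)))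

  -- A word orients the edge between u and next u forwards if its bit at u is true.

  WordArc : ∀ {n} → Vec Bool n → Fin n → Fin n → Set
  WordArc w u v = (v ≡ next u × lookup w u ≡ true) ⊎ (u ≡ next v × lookup w v ≡ false)

  word : ∀ {n} → Digraph n → Vec Bool n
  word A = tabulate (λ u → does (arc? A u (next u)))

  module _ {n} (A : Digraph n) where
    word-true : ∀ {u} → lookup (word A) u ≡ true → Arc A u (next u)
    word-true {u} eq with arc? A u (next u) | trans (sym (Vec.lookup∘tabulate (λ u → does (arc? A u (next u))) u)) eq
    ... | yes p | _  = p
    ... | no _  | ()

    arc⇒true : ∀ {u} → Arc A u (next u) → lookup (word A) u ≡ true
    arc⇒true {u} p = trans (Vec.lookup∘tabulate (λ u → does (arc? A u (next u))) u) (go (arc? A u (next u)))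
      where
      go : (d : Dec (Arc A u (next u))) → does d ≡ true
      go (yes _) = refl
      go (no ¬p) = contradiction p ¬p

    module _ (or : IsOrientation (cycle n) A) where
      word-false : ∀ {u} → lookup (word A) u ≡ false → Arc A (next u) u
      word-false {u} eq with proj₁ (or u (next u)) (inj₁ (next⇒arc u))
      ... | inj₁ p = contradiction (trans (sym (arc⇒true p)) eq) λ ()
      ... | inj₂ p = p

      arc⇒false : ∀ {u} → Arc A (next u) u → lookup (word A) u ≡ false
      arc⇒false {u} p with lookup (word A) u in eq
      ... | false = refl
      ... | true  = contradiction (word-true eq , p) (proj₂ (proj₂ (or u (next u))))

      arc⇒wordArc : ∀ u v → Arc A u v → WordArc (word A) u v
      arc⇒wordArc u v p with proj₁ (proj₂ (or u v)) (inj₁ p)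
      ... | inj₁ q rewrite arc⇒next q = inj₁ (refl , arc⇒true p)
      ... | inj₂ q rewrite arc⇒next q = inj₂ (refl , arc⇒false p)

      wordArc⇒arc : ∀ u v → WordArc (word A) u v → Arc A u v
      wordArc⇒arc u v (inj₁ (refl , q)) = word-true q
      wordArc⇒arc u v (inj₂ (refl , q)) = word-false q

      -- A vertex of the cycle has two edges; it is a sink when the one behind it points forwards
      -- and the one ahead points backwards.
      sinks-word : sinks A ≡ wordSinks (word A)
      sinks-word = sinkPositions-filter 0 (lastBit true (word A)) (word A) (sink? A) to from toℕ (λ _ → refl)
        where
        to : ∀ v → Sink A v →
          lookup (lastBit true (word A) ∷ word A) (inject₁ v) ≡ true × lookup (word A) v ≡ false
        to v s with next-surjective v
        ... | u , refl = trans (previous-bit (word A) u) in-bit , out-bit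
          where
          in-bit : lookup (word A) u ≡ true
          in-bit with lookup (word A) u in eq
          ... | true  = refl
          ... | false = contradiction (word-false eq) (s u)
          out-bit : lookup (word A) (next u) ≡ false
          out-bit with lookup (word A) (next u) in eq
          ... | true  = contradiction (word-true eq) (s _)
          ... | false = refl
        from : ∀ v → lookup (lastBit true (word A) ∷ word A) (inject₁ v) ≡ true →
          lookup (word A) v ≡ false → Sink A v
        from v p q x a with next-surjective v
        from v p q x a | u , refl with arc⇒wordArc (next u) x a
        ... | inj₁ (_ , r)  = contradiction (trans (sym r) q) λ ()
        ... | inj₂ (eq , r) = contradiction
                (trans (sym (trans (sym (previous-bit (word A) u)) p)) (trans (cong (lookup (word A)) (next-injective eq)) r))
                λ ()

  length-filter-tabulate : ∀ {a p n} {A : Set a} {P : Pred A p} (P? : Decidable P) (f : Fin n → A) →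
    length (filter P? (List.tabulate f)) ≡ ones (tabulate (λ i → does (P? (f i))))
  length-filter-tabulate {n = zero}  P? f = refl
  length-filter-tabulate {n = suc n} P? f with does (P? (f zero))
  ... | true  = cong suc (length-filter-tabulate P? (f ∘ suc))
  ... | false = length-filter-tabulate P? (f ∘ suc)

  ascₒ-word : ∀ {n} (A : Digraph n) → ascₒ (cycle n) A ≡ ones (word A)
  ascₒ-word {n} A = trans (↭-length (filter-↭ (λ (u , v) → arc? A u v) (arcs-cycle n)))
    (trans (length-filter-map (λ (u , v) → arc? A u v) (λ u → u , next u) (allFin n))
           (length-filter-tabulate (λ u → arc? A u (next u)) id))

  orient : ∀ {n} → Vec Bool n → Digraph n
  orient w = tabulate λ u → tabulate λ v →
    (does (v Fin.≟ next u) ∧ lookup w u) ∨ (does (u Fin.≟ next v) ∧ not (lookup w v))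

  module _ {n} (w : Vec Bool n) where
    private
      bit : Fin n → Fin n → Bool
      bit u v = (does (v Fin.≟ next u) ∧ lookup w u) ∨ (does (u Fin.≟ next v) ∧ not (lookup w v))

      lookup-orient : ∀ u v → lookup (lookup (orient w) u) v ≡ bit u v
      lookup-orient u v = trans (cong (λ r → lookup r v) (Vec.lookup∘tabulate (λ u → tabulate (bit u)) u))
        (Vec.lookup∘tabulate (bit u) v)

      bit⇒wordArc : ∀ u v → bit u v ≡ true → WordArc w u v
      bit⇒wordArc u v eq with v Fin.≟ next u | u Fin.≟ next v | lookup w u in p | lookup w v in q
      ... | yes a | _     | true  | _     = inj₁ (a , refl)
      ... | yes a | yes b | false | false = inj₂ (b , refl)
      ... | no a  | yes b | _     | false = inj₂ (b , refl)

      wordArc⇒bit : ∀ u v → WordArc w u v → bit u v ≡ true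
      wordArc⇒bit u v (inj₁ (a , p)) with v Fin.≟ next u
      ... | yes _ rewrite p = refl
      ... | no ¬a = contradiction a ¬a
      wordArc⇒bit u v (inj₂ (b , q)) with u Fin.≟ next v
      ... | yes _ rewrite q = ∨-zeroʳ _
      ... | no ¬b = contradiction b ¬b

    orient⇒wordArc : ∀ u v → Arc (orient w) u v → WordArc w u v
    orient⇒wordArc u v p = bit⇒wordArc u v (trans (sym (lookup-orient u v)) (Vec.[]=⇒lookup p))

    wordArc⇒orient : ∀ u v → WordArc w u v → Arc (orient w) u v
    wordArc⇒orient u v p = Vec.lookup⇒[]= v _ (trans (lookup-orient u v) (wordArc⇒bit u v p))

  -- Forward edges rise by #false and backward edges, traversed against their
  -- direction, fall by #true, so heights close up around the cycle.

  zeros : ∀ {r} → Vec Bool r → ℕ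
  zeros []          = 0
  zeros (true ∷ w)  = zeros w
  zeros (false ∷ w) = suc (zeros w)

  module Heights (up down : ℕ) where
    slope : Bool → ℤ
    slope true  = + up
    slope false = ℤ.- (+ down)

    partials : ∀ {r} → ℤ → Vec Bool r → Vec ℤ (suc r)
    partials a []      = a ∷ []
    partials a (c ∷ w) = a ∷ partials (a ℤ.+ slope c) w

    partials-zero : ∀ {r} a (w : Vec Bool r) → lookup (partials a w) zero ≡ a
    partials-zero a []      = refl
    partials-zero a (_ ∷ _) = refl

    partials-suc : ∀ {r} a (w : Vec Bool r) u →
      lookup (partials a w) (suc u) ≡ lookup (partials a w) (inject₁ u) ℤ.+ slope (lookup w u)
    partials-suc a (c ∷ w) zero    = partials-zero _ w
    partials-suc a (c ∷ w) (suc u) = partials-suc (a ℤ.+ slope c) w u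

    partials-last : ∀ {r} a (w : Vec Bool r) →
      lookup (partials a w) (fromℕ r) ≡ a ℤ.+ (+ (ones w ℕ.* up) ℤ.+ ℤ.- (+ (zeros w ℕ.* down)))
    partials-last a []          = sym (ℤ.+-identityʳ a)
    partials-last a (true ∷ w)  = trans (partials-last _ w) (trans (ℤ.+-assoc a _ _) (cong (λ b → a ℤ.+ b)
      (trans (sym (ℤ.+-assoc (+ up) (+ (ones w ℕ.* up)) (ℤ.- (+ (zeros w ℕ.* down)))))
        (cong (λ b → b ℤ.+ ℤ.- (+ (zeros w ℕ.* down))) (sym (ℤ.pos-+ up (ones w ℕ.* up)))))))
    partials-last a (false ∷ w) = trans (partials-last _ w) (trans (ℤ.+-assoc a _ _) (cong (λ b → a ℤ.+ b)
      (trans (x∙yz≈y∙xz (ℤ.- (+ down)) (+ (ones w ℕ.* up)) (ℤ.- (+ (zeros w ℕ.* down))))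
        (cong (λ b → + (ones w ℕ.* up) ℤ.+ b) (trans (sym (ℤ.neg-distrib-+ (+ down) (+ (zeros w ℕ.* down))))
          (cong ℤ.-_ (sym (ℤ.pos-+ down (zeros w ℕ.* down)))))))))
      where open import Algebra.Properties.CommutativeSemigroup ℤ.+-commutativeSemigroup using (x∙yz≈y∙xz)

  module _ {n} (w : Vec Bool n) where
    open Heights (zeros w) (ones w)

    height : Fin n → ℤ
    height v = lookup (partials (+ 0) w) (inject₁ v)

    height-next : ∀ u → height (next u) ≡ height u ℤ.+ slope (lookup w u)
    height-next u = trans (go u) (partials-suc (+ 0) w u)
      where
      closed : lookup (partials (+ 0) w) (fromℕ n) ≡ + 0
      closed = trans (partials-last (+ 0) w) (trans (ℤ.+-identityˡ _)
        (trans (cong (λ m → + m ℤ.+ ℤ.- (+ (zeros w ℕ.* ones w))) (ℕ.*-comm (ones w) (zeros w)))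
               (ℤ.+-inverseʳ (+ (zeros w ℕ.* ones w)))))
      go : ∀ u → height (next u) ≡ lookup (partials (+ 0) w) (suc u)
      go u with view u
      ... | ‵fromℕ     = trans (cong height (next-fromℕ _)) (trans (partials-zero (+ 0) w) (sym closed))
      ... | ‵inject₁ x = cong height (next-inject₁ x)

  ones-positive : ∀ {n} (w : Vec Bool n) u → lookup w u ≡ true → 0 ℕ.< ones w
  ones-positive (true ∷ w)  u       eq = ℕ.z<s
  ones-positive (false ∷ w) (suc u) eq = ones-positive w u eq

  zeros-positive : ∀ {n} (w : Vec Bool n) u → lookup w u ≡ false → 0 ℕ.< zeros w
  zeros-positive (false ∷ w) u       eq = ℕ.z<s
  zeros-positive (true ∷ w)  (suc u) eq = zeros-positive w u eq

  module _ {n} {A : Digraph n} (w : Vec Bool n) (arcs⇒ : ∀ u v → Arc A u v → WordArc w u v)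
           (0<ones : 0 ℕ.< ones w) (0<zeros : 0 ℕ.< zeros w) where
    height-increases : ∀ u v → Arc A u v → height w u ℤ.< height w v
    height-increases u v a with arcs⇒ u v a
    ... | inj₁ (refl , p) = subst (height w u ℤ.<_)
          (sym (trans (height-next w u) (cong (λ b → height w u ℤ.+ Heights.slope (zeros w) (ones w) b) p)))
          (subst (ℤ._< height w u ℤ.+ + zeros w) (ℤ.+-identityʳ (height w u))
            (ℤ.+-monoʳ-< (height w u) (ℤ.+<+ 0<zeros)))
    ... | inj₂ (refl , p) = subst (ℤ._< height w v)
          (sym (trans (height-next w v) (cong (λ b → height w v ℤ.+ Heights.slope (zeros w) (ones w) b) p)))
          (subst (height w v ℤ.+ ℤ.- (+ ones w) ℤ.<_) (ℤ.+-identityʳ (height w v))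
            (ℤ.+-monoʳ-< (height w v) (ℤ.neg-mono-< (ℤ.+<+ 0<ones))))

    path-increases : ∀ {u v} → TransClosure (Arc A) u v → height w u ℤ.< height w v
    path-increases [ a ]   = height-increases _ _ a
    path-increases (a ∷ p) = ℤ.<-trans (height-increases _ _ a) (path-increases p)

    heights⇒acyclic : Acyclic A
    heights⇒acyclic v p = ℤ.<-irrefl refl (path-increases p)

  NonConstant : ∀ {n} → Vec Bool n → Set
  NonConstant w = wordSinks w ≢ []

  nonConstant? : ∀ {n} (w : Vec Bool n) → Dec (NonConstant w)
  nonConstant? w = ¬? (List.≡-dec ℕ._≟_ (wordSinks w) [])

  nonConstant⇒bit : ∀ {n} (w : Vec Bool n) b → NonConstant w → ∃ λ u → lookup w u ≡ b
  nonConstant⇒bit w b nc with Fin.any? (λ u → lookup w u Bool.≟ b)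
  ... | yes p = p
  ... | no ¬p = contradiction (constant⇒no-sinks (not b) w λ v → ≢⇒not (λ eq → ¬p (v , eq))) nc
    where
    ≢⇒not : ∀ {a b : Bool} → a ≢ b → a ≡ not b
    ≢⇒not {true}  {true}  p = contradiction refl p
    ≢⇒not {true}  {false} p = refl
    ≢⇒not {false} {true}  p = refl
    ≢⇒not {false} {false} p = contradiction refl p

  module _ {k} {R : Fin (suc k) → Fin (suc k) → Set} where
    -- The induction carries a pending last arc from v to an arbitrary y. The path is thus never
    -- empty, and the arc from the last vertex back to `zero` is just one more instance.
    forward-cycle : (∀ u → R u (next u)) → TransClosure R zero zero
    forward-cycle r = <-weakInduction (λ v → ∀ {y} → R v y → TransClosure R zero y) [_]
      (λ i p q → p (subst (R (inject₁ i)) (next-inject₁ i) (r (inject₁ i))) TC.∷ʳ q)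
      (fromℕ k) (subst (R (fromℕ k)) (next-fromℕ k) (r (fromℕ k)))

    backward-cycle : (∀ u → R (next u) u) → TransClosure R zero zero
    backward-cycle r = <-weakInduction (λ v → ∀ {y} → R y v → TransClosure R y zero) [_]
      (λ i p q → q ∷ p (subst (λ v → R v (inject₁ i)) (next-inject₁ i) (r (inject₁ i))))
      (fromℕ k) (subst (λ v → R v (fromℕ k)) (next-fromℕ k) (r (fromℕ k)))

  IsAcyclicOrientation : ∀ {n} → Digraph n → Set
  IsAcyclicOrientation {n} A = IsOrientation (cycle n) A × Acyclic A

  isAcyclicOrientation? : ∀ {n} (A : Digraph n) → Dec (IsAcyclicOrientation A)
  isAcyclicOrientation? {n} A = isOrientation? (cycle n) A ×-dec acyclic? A

  acyclic⇒nonConstant : ∀ {k} {A : Digraph (suc k)} → IsAcyclicOrientation A → NonConstant (word A)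
  acyclic⇒nonConstant {A = A} (or , ac) eq with no-sinks⇒constant (word A) eq
  ... | true  , all = ac zero (forward-cycle (λ u → word-true A (all u)))
  ... | false , all = ac zero (backward-cycle (λ u → word-false A or (all u)))

  module _ {n} (w : Vec Bool n) (nc : NonConstant w) where
    orient-acyclic : Acyclic (orient w)
    orient-acyclic with nonConstant⇒bit w true nc | nonConstant⇒bit w false nc
    ... | u , p | v , q = heights⇒acyclic {A = orient w} w (orient⇒wordArc w) (ones-positive w u p) (zeros-positive w v q)

    orient-isOrientation : IsOrientation (cycle n) (orient w)
    -- Two opposite arcs would form a directed cycle. For n = 2 both bits describe the same edge,
    -- and it is the nonconstancy of `w`, through acyclicity, that excludes opposite arcs.
    orient-isOrientation u v = from , to , λ (p , q) → orient-acyclic u (p ∷ [ q ])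
      where
      edge : ∀ u → Adjacent (orient w) u (next u)
      edge u with lookup w u in eq
      ... | true  = inj₁ (wordArc⇒orient w _ _ (inj₁ (refl , eq)))
      ... | false = inj₂ (wordArc⇒orient w _ _ (inj₂ (refl , eq)))
      swap : ∀ {u v} → Adjacent (orient w) u v → Adjacent (orient w) v u
      swap (inj₁ p) = inj₂ p
      swap (inj₂ p) = inj₁ p
      from : Adjacent (cycle n) u v → Adjacent (orient w) u v
      from (inj₁ a) rewrite arc⇒next a = edge u
      from (inj₂ a) rewrite arc⇒next a = swap (edge v)
      arc : ∀ u v → Arc (orient w) u v → Adjacent (cycle n) u v
      arc u v a with orient⇒wordArc w u v a
      ... | inj₁ (refl , _) = inj₁ (next⇒arc u)
      ... | inj₂ (refl , _) = inj₂ (next⇒arc v)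
      to : Adjacent (orient w) u v → Adjacent (cycle n) u v
      to (inj₁ a) = arc u v a
      to (inj₂ a) with arc v u a
      ... | inj₁ b = inj₂ b
      ... | inj₂ b = inj₁ b

    word-orient : word (orient w) ≡ w
    word-orient = lookup-ext λ u → go u
      where
      go : ∀ u → lookup (word (orient w)) u ≡ lookup w u
      go u with lookup w u in eq
      ... | true  = arc⇒true (orient w) (wordArc⇒orient w u (next u) (inj₁ (refl , eq)))
      ... | false = arc⇒false (orient w) orient-isOrientation (wordArc⇒orient w (next u) u (inj₂ (refl , eq)))

  word-injective : ∀ {n} {A B : Digraph n} → IsOrientation (cycle n) A → IsOrientation (cycle n) B →
    word A ≡ word B → A ≡ B
  word-injective {A = A} {B} oA oB eq = digraph-ext
    (λ u v → wordArc⇒arc B oB u v ∘ subst (λ w → WordArc w u v) eq ∘ arc⇒wordArc A oA u v)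
    (λ u v → wordArc⇒arc A oA u v ∘ subst (λ w → WordArc w u v) (sym eq) ∘ arc⇒wordArc B oB u v)

  acyclicOrientations : ∀ n → List (Digraph n)
  acyclicOrientations n = filter isAcyclicOrientation? (digraphs n)

  bits-unique : Unique bits
  bits-unique = ((λ ()) ∷ []) ∷ [] ∷ []

  ∈-bits : ∀ b → b ∈ bits
  ∈-bits true  = here refl
  ∈-bits false = there (here refl)

  digraphs-unique : ∀ n → Unique (digraphs n)
  digraphs-unique n = vectors-unique (vectors-unique (((λ ()) ∷ []) ∷ [] ∷ []) n) n

  ∈-digraphs : ∀ {n} (A : Digraph n) → A ∈ digraphs n
  ∈-digraphs A = vectors-complete A λ u → vectors-complete (lookup A u) λ v → ∈-bool (lookup (lookup A u) v)
    where
    ∈-bool : ∀ b → b ∈ (false ∷ true ∷ [])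
    ∈-bool false = here refl
    ∈-bool true  = there (here refl)

  acyclicOrientations-words : ∀ k →
    map word (acyclicOrientations (suc k)) ↭ filter nonConstant? (vectors bits (suc k))
  acyclicOrientations-words k = unique-↭
    (unique-map word (λ A∈ B∈ → word-injective (proj₁ (ac A∈)) (proj₁ (ac B∈)))
       (Unique.filter⁺ isAcyclicOrientation? (digraphs-unique (suc k))))
    (Unique.filter⁺ nonConstant? (vectors-unique bits-unique (suc k)))
    to from
    where
    ac : ∀ {A} → A ∈ acyclicOrientations (suc k) → IsAcyclicOrientation A
    ac A∈ = proj₂ (∈-filter⁻ isAcyclicOrientation? {xs = digraphs (suc k)} A∈)
    to : ∀ {w} → w ∈ map word (acyclicOrientations (suc k)) → w ∈ filter nonConstant? (vectors bits (suc k))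
    to w∈ with ∈-map⁻ word w∈
    ... | A , A∈ , refl = ∈-filter⁺ nonConstant? (vectors-complete (word A) (λ i → ∈-bits _))
                            (acyclic⇒nonConstant {A = A} (ac A∈))
    from : ∀ {w} → w ∈ filter nonConstant? (vectors bits (suc k)) → w ∈ map word (acyclicOrientations (suc k))
    from {w} w∈ = subst (_∈ map word (acyclicOrientations (suc k))) (word-orient w nc)
      (∈-map⁺ word (∈-filter⁺ isAcyclicOrientation? (∈-digraphs (orient w))
        (orient-isOrientation w nc , orient-acyclic w nc)))
      where nc = proj₂ (∈-filter⁻ nonConstant? {xs = vectors bits (suc k)} w∈)

-- The two series as sums over orientations and over colourings.

module Weights where
  open import Data.Bool.Base using (Bool; true; false; if_then_else_)
  open import Data.Fin.Base using (Fin; zero; suc; toℕ)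
  open import Data.List.Base as List
    using (List; []; _∷_; _++_; map; foldr; zipWith; filter; allFin; length)
  open import Data.List.Relation.Binary.Permutation.Propositional as ↭ using (_↭_)
  open import Data.List.Relation.Unary.All using (All; []; _∷_)
  open import Data.List.Relation.Unary.Any using (Any; here; there)
  open import Data.Nat.Base as ℕ using (ℕ; zero; suc; _∸_)
  open import Data.Product.Base using (_×_; _,_; proj₁)
  open import Defs using (vectors; gaps)
  open import Function.Base using (_∘_; id)
  open import Relation.Binary.PropositionalEquality as ≡ using (_≡_; _≢_)
  open import Relation.Nullary using (does; contradiction)
  open import Relation.Unary using (Pred; Decidable)
  open CycleDigraph

  -- The first sink `s₁` is kept apart from the current sink `s`, so that a recursion along the word
  -- can still produce the gap that wraps around.
  gapsFrom : ℕ → ℕ → ℕ → List ℕ → List ℕ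
  gapsFrom n s₁ s ss = zipWith (λ i j → j ∸ suc i) (s ∷ ss) (ss ++ (n ℕ.+ s₁) ∷ [])

  segments : ℕ → List ℕ → List ℕ
  segments n ss = map suc (gaps n ss)

  module ListSumProperties {c ℓ} (R : CommutativeRing c ℓ) where
    open CommutativeRing R hiding (zero)
    open ListSums R
    open CSg +-commutativeSemigroup using (x∙yz≈y∙xz)
    private module ∑ = Sum semiring

    ∑ₗ-↭ : ∀ {a} {A : Set a} {xs ys : List A} F → xs ↭ ys → ∑ₗ xs F ≈ ∑ₗ ys F
    ∑ₗ-↭ F ↭.refl       = refl
    ∑ₗ-↭ F (↭.prep x p)   = +-congˡ (∑ₗ-↭ F p)
    ∑ₗ-↭ F (↭.swap x y p) = trans (x∙yz≈y∙xz _ _ _) (+-congˡ (+-congˡ (∑ₗ-↭ F p)))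
    ∑ₗ-↭ F (↭.trans p q)  = trans (∑ₗ-↭ F p) (∑ₗ-↭ F q)

    ∑ₗ-filter : ∀ {a p} {A : Set a} {P : Pred A p} (P? : Decidable P) xs F →
      ∑ₗ (filter P? xs) F ≈ ∑ₗ xs (λ x → if does (P? x) then F x else 0#)
    ∑ₗ-filter P? []       F = refl
    ∑ₗ-filter P? (x ∷ xs) F with does (P? x)
    ... | true  = +-congˡ (∑ₗ-filter P? xs F)
    ... | false = trans (∑ₗ-filter P? xs F) (sym (+-identityˡ _))

    ∑ₗ-allFin : ∀ m F → ∑.sum F ≈ ∑ₗ (allFin m) F
    ∑ₗ-allFin m F = go id
      where
      go : ∀ {k} (f : Fin k → Fin m) → ∑.sum (F ∘ f) ≈ ∑ₗ (List.tabulate f) F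
      go {zero}  f = refl
      go {suc k} f = +-congˡ (go (f ∘ suc))

    ∑ₗ-swap : ∀ {a b} {A : Set a} {B : Set b} (xs : List A) (ys : List B) (F : A → B → Carrier) →
      ∑ₗ xs (λ x → ∑ₗ ys (λ y → F x y)) ≈ ∑ₗ ys (λ y → ∑ₗ xs (λ x → F x y))
    ∑ₗ-swap []       ys F = sym (∑ₗ-zero ys)
    ∑ₗ-swap (x ∷ xs) ys F = trans (+-congˡ (∑ₗ-swap xs ys F)) (sym (∑ₗ-+ ys _ _))

  module WordWeights {c ℓ} (R : CommutativeRing c ℓ) (t : CommutativeRing.Carrier R)
                     (e : ℕ → CommutativeRing.Carrier R) where
    open CommutativeRing R hiding (zero)
    open CyclicWords R t e
    open ListSums R
    open ListSumProperties R
    open NatSolver commutativeSemiring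
    open SetoidReasoning setoid

    eProduct : List ℕ → Carrier
    eProduct = foldr (λ k s → e k * s) 1#

    -- The invariants: `p` is the current vertex, `s` the latest sink, and the running count `suc l`
    -- is p - s. At the end the count together with `s₁` is the length of the wrapping segment, and
    -- `lastBit` is the guess that `closing` accepts.
    scan-hit : ∀ {r} (w : Vec Bool r) s₁ s l prev {n p} → p ≡ suc (s ℕ.+ l) → n ≡ p ℕ.+ r →
      scan (lastBit prev w) s₁ prev (suc l) w ≈
      pow (ones w) * eProduct (map suc (gapsFrom n s₁ s (sinkPositions p prev w)))
    scan-hit [] s₁ s l prev ≡.refl ≡.refl = trans (closes prev)
      (sym (trans (*-identityˡ _) (trans (*-identityʳ _) (reflexive (≡.cong (e ∘ suc) last-gap)))))
      where
      closes : ∀ b → closing b s₁ b (suc l) ≈ e (suc l ℕ.+ s₁)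
      closes true  = refl
      closes false = refl
      last-gap : suc (s ℕ.+ l) ℕ.+ 0 ℕ.+ s₁ ∸ suc s ≡ l ℕ.+ s₁
      last-gap = ≡.trans (≡.cong (λ m → m ℕ.+ s₁ ∸ s) (ℕ.+-identityʳ (s ℕ.+ l)))
        (≡.trans (≡.cong (_∸ s) (ℕ.+-assoc s l s₁)) (ℕ.m+n∸m≡n s (l ℕ.+ s₁)))
    scan-hit (true ∷ w) s₁ s l true {p = p} p≡ n≡ = trans
      (*-congˡ (scan-hit w s₁ s (suc l) true (≡.cong suc (≡.trans p≡ (≡.sym (ℕ.+-suc s l))))
        (≡.trans n≡ (ℕ.+-suc p _)))) (sym (*-assoc _ _ _))
    scan-hit (true ∷ w) s₁ s l false {p = p} p≡ n≡ = trans
      (*-congˡ (scan-hit w s₁ s (suc l) true (≡.cong suc (≡.trans p≡ (≡.sym (ℕ.+-suc s l))))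
        (≡.trans n≡ (ℕ.+-suc p _)))) (sym (*-assoc _ _ _))
    scan-hit (false ∷ w) s₁ s l false {p = p} p≡ n≡ =
      scan-hit w s₁ s (suc l) false (≡.cong suc (≡.trans p≡ (≡.sym (ℕ.+-suc s l))))
        (≡.trans n≡ (ℕ.+-suc p _))
    scan-hit (false ∷ w) s₁ s l true {p = p} p≡ n≡ = trans
      (*-cong (reflexive (≡.cong (e ∘ suc) (≡.sym
          (≡.trans (≡.cong (_∸ suc s) p≡) (ℕ.m+n∸m≡n s l)))))
        (scan-hit w s₁ p 0 false (≡.cong suc (≡.sym (ℕ.+-identityʳ p))) (≡.trans n≡ (ℕ.+-suc p _))))
      (solve 3 (λ a b c → a :* (b :* c) := b :* (a :* c)) refl _ _ _)

    scan-miss : ∀ {r} (w : Vec Bool r) β s₁ prev ℓ → lastBit prev w ≢ β → scan β s₁ prev ℓ w ≈ 0#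
    scan-miss []          true  s₁ true  ℓ p = contradiction ≡.refl p
    scan-miss []          true  s₁ false ℓ p = refl
    scan-miss []          false s₁ true  ℓ p = refl
    scan-miss []          false s₁ false ℓ p = contradiction ≡.refl p
    scan-miss (true ∷ w)  β     s₁ true  ℓ p = trans (*-congˡ (scan-miss w β s₁ true (suc ℓ) p)) (zeroʳ t)
    scan-miss (true ∷ w)  β     s₁ false ℓ p = trans (*-congˡ (scan-miss w β s₁ true (suc ℓ) p)) (zeroʳ t)
    scan-miss (false ∷ w) β     s₁ true  ℓ p = trans (*-congˡ (scan-miss w β s₁ false 1 p)) (zeroʳ _)
    scan-miss (false ∷ w) β     s₁ false ℓ p = scan-miss w β s₁ false (suc ℓ) p

    -- Without sinks the empty product would give 1; constant words must contribute 0.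
    sinksWeight : ℕ → List ℕ → Carrier
    sinksWeight n []       = 0#
    sinksWeight n (s ∷ ss) = eProduct (segments n (s ∷ ss))

    scan₀-hit : ∀ {r} (w : Vec Bool r) p prev {n} → n ≡ p ℕ.+ r →
      scan₀ (lastBit prev w) p prev w ≈ pow (ones w) * sinksWeight n (sinkPositions p prev w)
    scan₀-hit []          p prev  n≡ = sym (zeroʳ _)
    scan₀-hit (true ∷ w)  p true  n≡ = trans (*-congˡ (scan₀-hit w (suc p) true (≡.trans n≡ (ℕ.+-suc p _)))) (sym (*-assoc _ _ _))
    scan₀-hit (true ∷ w)  p false n≡ = trans (*-congˡ (scan₀-hit w (suc p) true (≡.trans n≡ (ℕ.+-suc p _)))) (sym (*-assoc _ _ _))
    scan₀-hit (false ∷ w) p false n≡ = scan₀-hit w (suc p) false (≡.trans n≡ (ℕ.+-suc p _))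
    scan₀-hit (false ∷ w) p true  n≡ =
      scan-hit w p p 0 false (≡.cong suc (≡.sym (ℕ.+-identityʳ p))) (≡.trans n≡ (ℕ.+-suc p _))

    scan₀-miss : ∀ {r} (w : Vec Bool r) β p prev → lastBit prev w ≢ β → scan₀ β p prev w ≈ 0#
    scan₀-miss []          β p prev  q = refl
    scan₀-miss (true ∷ w)  β p true  q = trans (*-congˡ (scan₀-miss w β (suc p) true q)) (zeroʳ t)
    scan₀-miss (true ∷ w)  β p false q = trans (*-congˡ (scan₀-miss w β (suc p) true q)) (zeroʳ t)
    scan₀-miss (false ∷ w) β p true  q = scan-miss w β p false 1 q
    scan₀-miss (false ∷ w) β p false q = scan₀-miss w β (suc p) false q

    wordWeight : ∀ {n} → Vec Bool n → Carrier
    wordWeight {n} w = pow (ones w) * eProduct (segments n (wordSinks w))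

    Y-term : ∀ {k} (w : Vec Bool (suc k)) →
      scan₀ true 0 true w + scan₀ false 0 false w ≈
      (if does (nonConstant? w) then wordWeight w else 0#)
    Y-term {k} w@(a ∷ v) = trans (go (lastBit a v) ≡.refl) guarded
      where
      go : ∀ b → lastBit a v ≡ b →
        scan₀ true 0 true w + scan₀ false 0 false w ≈ pow (ones w) * sinksWeight (suc k) (wordSinks w)
      go true  eq = trans (+-cong
        (≡.subst (λ b → scan₀ b 0 b w ≈ pow (ones w) * sinksWeight (suc k) (sinkPositions 0 b w)) eq (hit (lastBit a v)))
        (scan₀-miss w false 0 false (λ q → contradiction (≡.trans (≡.sym eq) q) λ ())))
        (trans (+-identityʳ _) (reflexive (≡.cong (λ b → pow (ones w) * sinksWeight (suc k) (sinkPositions 0 b w)) (≡.sym eq))))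
        where
        hit : ∀ b → scan₀ (lastBit a v) 0 b w ≈ pow (ones w) * sinksWeight (suc k) (sinkPositions 0 b w)
        hit b = scan₀-hit w 0 b ≡.refl
      go false eq = trans (+-cong
        (scan₀-miss w true 0 true (λ q → contradiction (≡.trans (≡.sym eq) q) λ ()))
        (≡.subst (λ b → scan₀ b 0 b w ≈ pow (ones w) * sinksWeight (suc k) (sinkPositions 0 b w)) eq (hit (lastBit a v))))
        (trans (+-identityˡ _) (reflexive (≡.cong (λ b → pow (ones w) * sinksWeight (suc k) (sinkPositions 0 b w)) (≡.sym eq))))
        where
        hit : ∀ b → scan₀ (lastBit a v) 0 b w ≈ pow (ones w) * sinksWeight (suc k) (sinkPositions 0 b w)
        hit b = scan₀-hit w 0 b ≡.refl
      guarded : pow (ones w) * sinksWeight (suc k) (wordSinks w) ≈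
        (if does (nonConstant? w) then wordWeight w else 0#)
      guarded with wordSinks w
      ... | []     = zeroʳ _
      ... | _ ∷ _  = refl

    Y≈orientations : ∀ k → Y (suc k) ≈
      ∑ₗ (acyclicOrientations (suc k)) (λ A → wordWeight (word A))
    Y≈orientations k = begin
      Y (suc k)
        ≈⟨ ∑ₗ-cong (vectors bits (suc k)) Y-term ⟩
      ∑ₗ (vectors bits (suc k)) (λ w → if does (nonConstant? w) then wordWeight w else 0#)
        ≈⟨ ∑ₗ-filter nonConstant? (vectors bits (suc k)) wordWeight ⟨
      ∑ₗ (filter nonConstant? (vectors bits (suc k))) wordWeight
        ≈⟨ ∑ₗ-↭ wordWeight (acyclicOrientations-words k) ⟨
      ∑ₗ (map word (acyclicOrientations (suc k))) wordWeight
        ≈⟨ ∑ₗ-map word (acyclicOrientations (suc k)) wordWeight ⟩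
      ∑ₗ (acyclicOrientations (suc k)) (λ A → wordWeight (word A)) ∎

  module WalkSums {c ℓ} (R : CommutativeRing c ℓ) (t : CommutativeRing.Carrier R) {m}
                  (x : Fin m → CommutativeRing.Carrier R) where
    open CommutativeRing R hiding (zero)
    open PowerSeries R
    open ClosedWalks R t
    open ListSums R
    open ListSumProperties R
    open ElementaryPolys R t using (elem)
    open CyclicWords R t (elem x) using (pow)
    private module ∑ = Sum semiring
    open NatSolver commutativeSemiring
    open SetoidReasoning setoid

    pairsWeight : List (Fin m × Fin m) → Carrier
    pairsWeight = foldr (λ (i , j) s → T x i j * s) 1#

    δ-suc : ∀ {m} (i j : Fin m) {n} → δ i j (suc n) ≈ 0#
    δ-suc zero    zero    = refl
    δ-suc zero    (suc j) = refl
    δ-suc (suc i) zero    = refl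
    δ-suc (suc i) (suc j) = δ-suc i j

    walks : ∀ n i j → W x j i (suc n) ≈
      ∑ₗ (vectors (allFin m) n) (λ v → pairsWeight (stepPairs i v j))
    walks zero    i j = trans (+-congʳ (δ-suc i j)) (trans (+-identityˡ _) (trans (sum-δ₀ (T x i) j)
      (sym (trans (+-identityʳ _) (*-identityʳ _)))))
      where
      sum-δ₀ : ∀ {m} (f : Fin m → Carrier) j → ∑.sum (λ k → f k * δ k j 0) ≈ f j
      sum-δ₀ {suc m} f zero    = trans (+-cong (*-identityʳ _)
        (trans (∑.sum-cong-≋ {m} (λ k → zeroʳ (f (suc k)))) (∑.sum-replicate-zero m))) (+-identityʳ _)
      sum-δ₀ {suc m} f (suc j) = trans (+-cong (zeroʳ _) (sum-δ₀ (f ∘ suc) j)) (+-identityˡ _)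
    walks (suc n) i j = begin
      δ i j (suc (suc n)) + ∑.sum (λ k → T x i k * W x j k (suc n))
        ≈⟨ trans (+-congʳ (δ-suc i j)) (+-identityˡ _) ⟩
      ∑.sum (λ k → T x i k * W x j k (suc n))
        ≈⟨ ∑.sum-cong-≋ {m} (λ k → trans (*-congˡ (walks n k j)) (sym (∑ₗ-* (vectors (allFin m) n) _ _))) ⟩
      ∑.sum (λ k → ∑ₗ (vectors (allFin m) n) (λ v → T x i k * pairsWeight (stepPairs k v j)))
        ≈⟨ ∑ₗ-allFin m _ ⟩
      ∑ₗ (allFin m) (λ k → ∑ₗ (vectors (allFin m) n) (λ v → T x i k * pairsWeight (stepPairs k v j)))
        ≈⟨ ∑ₗ-product _∷_ (allFin m) (vectors (allFin m) n) _ ⟨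
      ∑ₗ (vectors (allFin m) (suc n)) (λ v → pairsWeight (stepPairs i v j)) ∎

    C≈colorings : ∀ k → C x (suc k) ≈
      ∑ₗ (vectors (allFin m) (suc k)) (λ κ → pairsWeight (edgePairs κ))
    C≈colorings k = begin
      ∑.sum (λ i → W x i i (suc k))
        ≈⟨ trans (∑.sum-cong-≋ {m} (λ i → walks k i i)) (∑ₗ-allFin m _) ⟩
      ∑ₗ (allFin m) (λ i → ∑ₗ (vectors (allFin m) k) (λ v → pairsWeight (stepPairs i v i)))
        ≈⟨ ∑ₗ-cong (allFin m) (λ i → ∑ₗ-cong (vectors (allFin m) k) (λ v →
             reflexive (≡.cong pairsWeight (≡.sym (edgePairs-∷ i v))))) ⟩
      ∑ₗ (allFin m) (λ i → ∑ₗ (vectors (allFin m) k) (λ v → pairsWeight (edgePairs (i ∷ v))))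
        ≈⟨ ∑ₗ-product _∷_ (allFin m) (vectors (allFin m) k) _ ⟨
      ∑ₗ (vectors (allFin m) (suc k)) (λ κ → pairsWeight (edgePairs κ)) ∎

    step-ascent : ∀ {m} (i j : Fin m) → toℕ i ≢ toℕ j → step i j ≈
      (if does (toℕ i ℕ.<? toℕ j) then t else 1#)
    step-ascent zero    zero    p = contradiction ≡.refl p
    step-ascent zero    (suc j) p = refl
    step-ascent (suc i) zero    p = refl
    step-ascent (suc i) (suc j) p = step-ascent i j (p ∘ ≡.cong suc)

    step-equal : ∀ {m} (i : Fin m) → step i i ≈ 0#
    step-equal zero    = refl
    step-equal (suc i) = step-equal i

    ascents : List (Fin m × Fin m) → ℕ
    ascents ps = length (filter (λ (i , j) → toℕ i ℕ.<? toℕ j) ps)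

    xProduct : List (Fin m) → Carrier
    xProduct = foldr (λ i s → x i * s) 1#

    pairsWeight-proper : ∀ ps → All (λ (i , j) → toℕ i ≢ toℕ j) ps →
      pairsWeight ps ≈ pow (ascents ps) * xProduct (map proj₁ ps)
    pairsWeight-proper []             []       = sym (*-identityˡ _)
    pairsWeight-proper ((i , j) ∷ ps) (q ∷ qs) = trans
      (*-cong (*-congˡ (step-ascent i j q)) (pairsWeight-proper ps qs)) cases
      where
      cases : x i * (if does (toℕ i ℕ.<? toℕ j) then t else 1#) * (pow (ascents ps) * xProduct (map proj₁ ps)) ≈
        pow (ascents ((i , j) ∷ ps)) * (x i * xProduct (map proj₁ ps))
      cases with does (toℕ i ℕ.<? toℕ j)
      ... | true  = solve 4 (λ x t p q → x :* t :* (p :* q) := t :* p :* (x :* q)) refl _ t _ _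
      ... | false = solve 3 (λ x p q → x :* con 1 :* (p :* q) := p :* (x :* q)) refl _ _ _

    pairsWeight-improper : ∀ ps → Any (λ (i , j) → i ≡ j) ps → pairsWeight ps ≈ 0#
    pairsWeight-improper ((i , i) ∷ ps) (here ≡.refl) = trans (*-congʳ (trans (*-congˡ (step-equal i)) (zeroʳ _))) (zeroˡ _)
    pairsWeight-improper (_ ∷ ps)       (there q)     = trans (*-congˡ (pairsWeight-improper ps q)) (zeroʳ _)

-- Coefficients in t and in the variables.

module Coefficients where
  open import Data.Bool.Base using (if_then_else_)
  open import Data.Bool.Properties using (∧-zeroʳ)
  open import Data.Fin.Base as Fin using (Fin; zero; suc; toℕ)
  import Data.Fin.Properties as Fin
  open import Data.List.Base as List
    using (List; []; _∷_; map; foldr; filter; allFin; length; upTo; applyUpTo)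
  open import Data.List.Membership.Propositional using (_∈_; lose; find)
  open import Data.List.Membership.Propositional.Properties using (∈-map⁺)
  import Data.List.Properties as List
  open import Data.List.Relation.Binary.Permutation.Propositional using (_↭_; refl; prep; swap; trans)
  open import Data.List.Relation.Unary.All as All using (All; []; _∷_)
  import Data.List.Relation.Unary.All.Properties as All
  open import Data.List.Relation.Unary.Any as Any using (Any)
  open import Data.Nat.Base as ℕ using (ℕ; zero; suc; _∸_)
  open import Data.Product.Base as Prod using (_×_; _,_; proj₁; proj₂)
  open import Data.Rational.Base as ℚ using (ℚ; 0ℚ; 1ℚ)
  import Data.Rational.Properties as ℚ
  open import Data.Vec.Base as Vec using (Vec; []; _∷_; lookup; toList; fromList)
  import Data.Vec.Properties as Vec
  open import Defs hiding (e; t^_)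
  open import Function.Base using (_∘_; id)
  open import Relation.Binary.PropositionalEquality as ≡ using (_≡_; _≢_)
  open import Relation.Nullary using (¬_; Dec; yes; no; does; contradiction)
  open import Relation.Nullary.Decidable using (_×-dec_; ¬?; dec-true; dec-false; decidable-stable)
  open CycleDigraph
  open Weights

  ℚ-ring : CommutativeRing _ _
  ℚ-ring = ℚ.+-*-commutativeRing

  ℚ[[t]] : CommutativeRing _ _
  ℚ[[t]] = PowerSeries.seriesRing ℚ-ring

  -- tower m = ℚ[[t]][[x_{m-1}]]⋯[[x₀]]: the outermost variable x₀ carries the head
  -- of an exponent list.
  tower : ℕ → CommutativeRing _ _
  tower zero    = ℚ[[t]]
  tower (suc m) = PowerSeries.seriesRing (tower m)

  private
    module Q = CommutativeRing ℚ-ring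
    module B = CommutativeRing ℚ[[t]]
    module QS = PowerSeries ℚ-ring
    module T m = CommutativeRing (tower m)
    module TS m = PowerSeries (tower m)
    module ∑Q = ListSums ℚ-ring
    module ∑B = ListSums ℚ[[t]]
    module ∑T m = ListSums (tower m)

  coef : ∀ m → T.Carrier m → Vec ℕ m → B.Carrier
  coef zero    f []      = f
  coef (suc m) f (a ∷ α) = coef m (f a) α

  coef-cong : ∀ m {f g} → T._≈_ m f g → ∀ α → coef m f α B.≈ coef m g α
  coef-cong zero    p []      = p
  coef-cong (suc m) p (a ∷ α) = coef-cong m (PowerSeries.at p a) α

  coef-+ : ∀ m f g α → coef m (T._+_ m f g) α B.≈ coef m f α B.+ coef m g α
  coef-+ zero    f g []      = B.refl
  coef-+ (suc m) f g (a ∷ α) = coef-+ m (f a) (g a) α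

  coef-0 : ∀ m α → coef m (T.0# m) α B.≈ B.0#
  coef-0 zero    []      = B.refl
  coef-0 (suc m) (a ∷ α) = coef-0 m α

  coef-∑ : ∀ m {A : Set} (xs : List A) F α →
    coef m (∑T.∑ₗ m xs F) α B.≈ ∑B.∑ₗ xs (λ x → coef m (F x) α)
  coef-∑ m []       F α = coef-0 m α
  coef-∑ m (x ∷ xs) F α = B.trans (coef-+ m (F x) (∑T.∑ₗ m xs F) α) (B.+-congˡ {coef m (F x) α} (coef-∑ m xs F α))

  at-∑ : ∀ {A : Set} (xs : List A) F j → ∑B.∑ₗ xs F j ≡ ∑Q.∑ₗ xs (λ x → F x j)
  at-∑ []       F j = ≡.refl
  at-∑ (x ∷ xs) F j = ≡.cong (F x j ℚ.+_) (at-∑ xs F j)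

  scalar : ∀ m → B.Carrier → T.Carrier m
  scalar zero    b = b
  scalar (suc m) b = TS.const m (scalar m b)

  coef-scalar : ∀ m b f α → coef m (T._*_ m (scalar m b) f) α B.≈ b B.* coef m f α
  coef-scalar zero    b f []      = B.refl
  coef-scalar (suc m) b f (a ∷ α) =
    B.trans (coef-cong m (TS.conv-constˡ m (scalar m b) f a) α) (coef-scalar m b (f a) α)

  var : ∀ m → Fin m → T.Carrier m
  var (suc m) zero    = TS.lin m (T.1# m)
  var (suc m) (suc i) = TS.const m (var m i)

  coef-var-zero : ∀ m i f α → lookup α i ≡ 0 → coef m (T._*_ m (var m i) f) α B.≈ B.0#
  coef-var-zero (suc m) zero    f (.0 ∷ α) ≡.refl = B.trans (coef-cong m (T.zeroˡ m _) α) (coef-0 m α)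
  coef-var-zero (suc m) (suc i) f (a ∷ α)  eq     =
    B.trans (coef-cong m (TS.conv-constˡ m (var m i) f a) α) (coef-var-zero m i (f a) α eq)

  decrement : ∀ {m} → Vec ℕ m → Fin m → Vec ℕ m
  decrement (a ∷ α) zero    = ℕ.pred a ∷ α
  decrement (a ∷ α) (suc i) = a ∷ decrement α i

  coef-var-suc : ∀ m i f α {b} → lookup α i ≡ suc b →
    coef m (T._*_ m (var m i) f) α B.≈ coef m f (decrement α i)
  coef-var-suc (suc m) zero    f (suc b ∷ α) ≡.refl = coef-cong m
    (T.trans m (TS.conv-lin m (T.1# m) f (suc b)) (T.*-identityˡ m _)) α
  coef-var-suc (suc m) (suc i) f (a ∷ α)     eq     =
    B.trans (coef-cong m (TS.conv-constˡ m (var m i) f a) α) (coef-var-suc m i (f a) α eq)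

  occurrences : ∀ {m} → List (Fin m) → Fin m → ℕ
  occurrences is i = length (filter (Fin._≟ i) is)

  monomial : ∀ m → List (Fin m) → T.Carrier m
  monomial m = foldr (λ i s → T._*_ m (var m i) s) (T.1# m)

  coef-1 : ∀ m α → (∀ i → lookup α i ≡ 0) → coef m (T.1# m) α B.≈ B.1#
  coef-1 zero    []      p = B.refl
  coef-1 (suc m) (a ∷ α) p with a | p zero
  ... | .0 | ≡.refl = coef-1 m α (p ∘ suc)

  coef-1-≢ : ∀ m α i → lookup α i ≢ 0 → coef m (T.1# m) α B.≈ B.0#
  coef-1-≢ (suc m) (zero ∷ α)  zero    p = contradiction ≡.refl p
  coef-1-≢ (suc m) (zero ∷ α)  (suc i) p = coef-1-≢ m α i p
  coef-1-≢ (suc m) (suc a ∷ α) i       p = coef-0 m α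

  lookup-decrement : ∀ {m} (α : Vec ℕ m) i → lookup (decrement α i) i ≡ ℕ.pred (lookup α i)
  lookup-decrement (a ∷ α) zero    = ≡.refl
  lookup-decrement (a ∷ α) (suc i) = lookup-decrement α i

  lookup-decrement-≢ : ∀ {m} (α : Vec ℕ m) i j → i ≢ j → lookup (decrement α i) j ≡ lookup α j
  lookup-decrement-≢ (a ∷ α) zero    zero    p = contradiction ≡.refl p
  lookup-decrement-≢ (a ∷ α) zero    (suc j) p = ≡.refl
  lookup-decrement-≢ (a ∷ α) (suc i) zero    p = ≡.refl
  lookup-decrement-≢ (a ∷ α) (suc i) (suc j) p = lookup-decrement-≢ α i j (p ∘ ≡.cong suc)

  occurrences-same : ∀ {m} (i : Fin m) is → occurrences (i ∷ is) i ≡ suc (occurrences is i)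
  occurrences-same i is with i Fin.≟ i
  ... | yes _ = ≡.refl
  ... | no ¬p = contradiction ≡.refl ¬p

  occurrences-other : ∀ {m} {i j : Fin m} is → i ≢ j → occurrences (i ∷ is) j ≡ occurrences is j
  occurrences-other {i = i} {j} is p with i Fin.≟ j
  ... | yes q = contradiction q p
  ... | no _  = ≡.refl

  coef-monomial : ∀ m is α → (∀ i → lookup α i ≡ occurrences is i) → coef m (monomial m is) α B.≈ B.1#
  coef-monomial m []       α p = coef-1 m α p
  coef-monomial m (i ∷ is) α p = B.trans
    (coef-var-suc m i (monomial m is) α (≡.trans (p i) (occurrences-same i is)))
    (coef-monomial m is (decrement α i) λ j → go j (i Fin.≟ j))
    where
    go : ∀ j → Dec (i ≡ j) → lookup (decrement α i) j ≡ occurrences is j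
    go j (yes ≡.refl) = ≡.trans (lookup-decrement α i)
      (≡.cong ℕ.pred (≡.trans (p i) (occurrences-same i is)))
    go j (no q) = ≡.trans (lookup-decrement-≢ α i j q) (≡.trans (p j) (occurrences-other is q))

  coef-monomial-≢ : ∀ m is α j → lookup α j ≢ occurrences is j → coef m (monomial m is) α B.≈ B.0#
  coef-monomial-≢ m []       α j p = coef-1-≢ m α j p
  coef-monomial-≢ m (i ∷ is) α j p with lookup α i in eq
  ... | zero  = coef-var-zero m i (monomial m is) α eq
  ... | suc b = B.trans (coef-var-suc m i (monomial m is) α eq)
    (coef-monomial-≢ m is (decrement α i) j (go (i Fin.≟ j)))
    where
    go : Dec (i ≡ j) → lookup (decrement α i) j ≢ occurrences is j
    go (yes ≡.refl) q = p (≡.trans eq (≡.trans (≡.cong suc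
      (≡.trans (≡.sym (≡.trans (lookup-decrement α i) (≡.cong ℕ.pred eq))) q)) (≡.sym (occurrences-same i is))))
    go (no i≢j)     q = p (≡.trans (≡.sym (lookup-decrement-≢ α i j i≢j))
      (≡.trans q (≡.sym (occurrences-other is i≢j))))

  -- The products e_λ do not involve t, so their coefficients are constants of ℚ[[t]]. The exponent
  -- vectors have exactly m entries, which suffices because m is later chosen as the length of the
  -- monomial.
  Represents : ∀ m → T.Carrier m → Series ℚ → Set
  Represents m F f = ∀ α → coef m F α B.≈ QS.const (f (toList α))

  const-+ : ∀ a b → QS.const (a ℚ.+ b) B.≈ QS.const a B.+ QS.const b
  const-+ a b = QS.mk λ where
    zero    → ≡.refl
    (suc n) → ≡.refl

  const-* : ∀ a b → QS.const (a ℚ.* b) B.≈ QS.const a B.* QS.const b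
  const-* a b = QS.mk λ n → ≡.sym (≡.trans (QS.conv-constˡ a (QS.const b) n) (go n))
    where
    go : ∀ n → a ℚ.* QS.const b n ≡ QS.const (a ℚ.* b) n
    go zero    = ≡.refl
    go (suc n) = ℚ.*-zeroʳ a

  const-0 : QS.const 0ℚ B.≈ B.0#
  const-0 = QS.mk λ where
    zero    → ≡.refl
    (suc n) → ≡.refl

  const-∑ : ∀ {A : Set} (xs : List A) F → QS.const (∑Q.∑ₗ xs F) B.≈ ∑B.∑ₗ xs (QS.const ∘ F)
  const-∑ []       F = const-0
  const-∑ (x ∷ xs) F = B.trans (const-+ (F x) (∑Q.∑ₗ xs F)) (B.+-congˡ {QS.const (F x)} (const-∑ xs F))

  sumℚ-map : ∀ {A : Set} (xs : List A) F → sumℚ (map F xs) ≡ ∑Q.∑ₗ xs F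
  sumℚ-map []       F = ≡.refl
  sumℚ-map (x ∷ xs) F = ≡.cong (F x ℚ.+_) (sumℚ-map xs F)

  ⊛-∷ : ∀ f g a α → (f ⊛ g) (a ∷ α) ≡
    ∑Q.∑ₗ (upTo (suc a)) (λ i → ((f ∘ (i ∷_)) ⊛ (g ∘ ((a ∸ i) ∷_))) α)
  ⊛-∷ f g a α = ≡.trans
    (sumℚ-map (factorizations (a ∷ α)) (λ (β , γ) → f β ℚ.* g γ))
    (≡.trans (∑Q.∑ₗ-product (λ i (β , γ) → (i ∷ β) , ((a ∸ i) ∷ γ)) (upTo (suc a)) (factorizations α)
                            (λ (β , γ) → f β ℚ.* g γ))
      (∑Q.∑ₗ-cong (upTo (suc a)) (λ i → ≡.sym (sumℚ-map (factorizations α) (λ (β , γ) → f (i ∷ β) ℚ.* g ((a ∸ i) ∷ γ))))))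

  -- Brings the recursive product into the form used by `factorizations`, where the head exponent a
  -- splits as i and a - i.
  conv-∑ : ∀ m f g a → T._≈_ m (TS.conv m f g a) (∑T.∑ₗ m (upTo (suc a)) (λ i → T._*_ m (f i) (g (a ∸ i))))
  conv-∑ m f g zero    = T.sym m (T.+-identityʳ m _)
  conv-∑ m f g (suc a) = T.+-congˡ m (T.trans m (conv-∑ m (f ∘ suc) g a) (T.trans m
    (T.sym m (∑T.∑ₗ-map m suc (upTo (suc a)) (λ i → T._*_ m (f i) (g (suc a ∸ i)))))
    (T.reflexive m (≡.cong (λ is → ∑T.∑ₗ m is (λ i → T._*_ m (f i) (g (suc a ∸ i)))) (List.map-upTo suc (suc a))))))

  represents-* : ∀ m F G f g → Represents m F f → Represents m G g → Represents m (T._*_ m F G) (f ⊛ g)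
  represents-* zero    F G f g p q [] = B.trans (B.*-cong (p []) (q []))
    (B.trans (B.sym (const-* (f []) (g []))) (B.reflexive (≡.cong QS.const (≡.sym (ℚ.+-identityʳ _)))))
  represents-* (suc m) F G f g p q (a ∷ α) = B.trans (coef-cong m (conv-∑ m F G a) α)
    (B.trans (coef-∑ m (upTo (suc a)) (λ i → T._*_ m (F i) (G (a ∸ i))) α)
    (B.trans (∑B.∑ₗ-cong (upTo (suc a)) (λ i → represents-* m (F i) (G (a ∸ i)) (f ∘ (i ∷_)) (g ∘ ((a ∸ i) ∷_))
               (λ β → p (i ∷ β)) (λ γ → q ((a ∸ i) ∷ γ)) α))
    (B.trans (B.sym (const-∑ (upTo (suc a)) _)) (B.reflexive (≡.cong QS.const (≡.sym (⊛-∷ f g a (toList α))))))))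

  represents-1 : ∀ m → Represents m (T.1# m) 1ₛ
  represents-1 zero    []          = B.refl
  represents-1 (suc m) (zero ∷ α)  = represents-1 m α
  represents-1 (suc m) (suc a ∷ α) = B.trans (coef-0 m α) (B.sym const-0)

  module EP m = ElementaryPolys (tower m) (scalar m (QS.lin 1ℚ))

  const-+ₛ : ∀ m a b → T._≈_ (suc m) (TS.const m (T._+_ m a b)) (T._+_ (suc m) (TS.const m a) (TS.const m b))
  const-+ₛ m a b = PowerSeries.mk λ where
    zero    → T.refl m
    (suc n) → T.sym m (T.+-identityˡ m _)

  const-*ₛ : ∀ m a b → T._≈_ (suc m) (TS.const m (T._*_ m a b)) (T._*_ (suc m) (TS.const m a) (TS.const m b))
  const-*ₛ m a b = PowerSeries.mk λ n → T.sym m (T.trans m (TS.conv-constˡ m a (TS.const m b) n) (go n))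
    where
    go : ∀ n → T._≈_ m (T._*_ m a (TS.const m b n)) (TS.const m (T._*_ m a b) n)
    go zero    = T.refl m
    go (suc n) = T.zeroʳ m a

  -- One more variable makes the old variables constants of a larger ring, while the recursion of
  -- `elem` refers to polynomials in the old variables; this carries them over.
  elem-const : ∀ m {k} (x : Fin k → T.Carrier m) i →
    T._≈_ (suc m) (EP.elem (suc m) (TS.const m ∘ x) i) (TS.const m (EP.elem m x i))
  elem-const m {zero}  x zero    = T.refl (suc m)
  elem-const m {zero}  x (suc i) = PowerSeries.mk λ where
    zero    → T.refl m
    (suc n) → T.refl m
  elem-const m {suc k} x zero    = T.refl (suc m)
  elem-const m {suc k} x (suc i) = T.trans (suc m)
    (T.+-cong (suc m) (elem-const m (x ∘ suc) (suc i))
      (T.trans (suc m) (T.*-congˡ (suc m) (elem-const m (x ∘ suc) i)) (T.sym (suc m) (const-*ₛ m _ _))))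
    (T.sym (suc m) (const-+ₛ m _ _))

  represents-0 : ∀ m α {q} → q ≡ 0ℚ → coef m (T.0# m) α B.≈ QS.const q
  represents-0 m α ≡.refl = B.trans (coef-0 m α) (B.sym const-0)

  represents-elem : ∀ m k → Represents m (EP.elem m (var m) k) (Defs.e k)
  represents-elem zero    zero    []      = B.refl
  represents-elem zero    (suc k) []      = B.sym const-0
  represents-elem (suc m) zero    (zero ∷ α)  = B.trans (coef-cong m (T.sym m (elem-zero m)) α) (represents-elem m zero α)
    where
    elem-zero : ∀ m → T._≈_ m (EP.elem m (var m) 0) (T.1# m)
    elem-zero zero    = T.refl zero
    elem-zero (suc m) = T.refl (suc m)
  represents-elem (suc m) zero    (suc a ∷ α) = represents-0 m α (≡.cong (if_then 1ℚ else 0ℚ) (∧-zeroʳ _))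
  represents-elem (suc m) (suc k) (a ∷ α) = B.trans (coef-cong m (expand a) α) (go a)
    where
    eₖ = EP.elem m (var m)
    expand : ∀ a → T._≈_ m (EP.elem (suc m) (var (suc m)) (suc k) a)
      (T._+_ m (TS.const m (eₖ (suc k)) a) (TS.lin* m (T.1# m) (TS.const m (eₖ k)) a))
    expand a = T.+-cong m (PowerSeries.at (elem-const m (var m) (suc k)) a)
      (T.trans m (PowerSeries.at (T.*-congˡ (suc m) (elem-const m (var m) k)) a)
                 (TS.conv-lin m (T.1# m) (TS.const m (eₖ k)) a))
    go : ∀ a → coef m (T._+_ m (TS.const m (eₖ (suc k)) a) (TS.lin* m (T.1# m) (TS.const m (eₖ k)) a)) α B.≈
      QS.const (Defs.e (suc k) (a ∷ toList α))
    -- Head exponent 0 selects the monomials without the first variable and exponent 1 those with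
    -- it; a larger exponent is not squarefree.
    go zero          = B.trans (coef-cong m (T.+-identityʳ m _) α) (represents-elem m (suc k) α)
    go (suc zero)    = B.trans (coef-cong m (T.trans m (T.+-identityˡ m _) (T.*-identityˡ m _)) α)
      (represents-elem m k α)
    go (suc (suc a)) = B.trans (coef-cong m (T.trans m (T.+-identityˡ m _) (T.zeroʳ m _)) α) (represents-0 m α ≡.refl)

  module WW m = WordWeights (tower m) (scalar m (QS.lin 1ℚ)) (EP.elem m (var m))

  represents-eProduct : ∀ m λs → Represents m (WW.eProduct m λs) e[ λs ]
  represents-eProduct m []       = represents-1 m
  represents-eProduct m (k ∷ λs) = represents-* m _ _ (Defs.e k) e[ λs ]
    (represents-elem m k) (represents-eProduct m λs)

  private
    module CW m = CyclicWords (tower m) (scalar m (QS.lin 1ℚ)) (EP.elem m (var m))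
    module Walk m = ClosedWalks (tower m) (scalar m (QS.lin 1ℚ))
    module WS m = WalkSums (tower m) (scalar m (QS.lin 1ℚ)) (var m)
  open ListSums ℚ-ring
  open ListSumProperties ℚ-ring

  coeff-+ₚ : ∀ p q j → coeff (p +ₚ q) j ≡ coeff p j ℚ.+ coeff q j
  coeff-+ₚ []      q       j       = ≡.sym (ℚ.+-identityˡ _)
  coeff-+ₚ (a ∷ p) []      j       = ≡.sym (ℚ.+-identityʳ _)
  coeff-+ₚ (a ∷ p) (b ∷ q) zero    = ≡.refl
  coeff-+ₚ (a ∷ p) (b ∷ q) (suc j) = coeff-+ₚ p q j

  coeff-·ₚ : ∀ a p j → coeff (a ·ₚ p) j ≡ a ℚ.* coeff p j
  coeff-·ₚ a []      j       = ≡.sym (ℚ.*-zeroʳ a)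
  coeff-·ₚ a (b ∷ p) zero    = ≡.refl
  coeff-·ₚ a (b ∷ p) (suc j) = coeff-·ₚ a p j

  coeff-sumₚ : ∀ {A : Set} (xs : List A) F j → coeff (sumₚ (map F xs)) j ≡ ∑ₗ xs (λ x → coeff (F x) j)
  coeff-sumₚ []       F j = ≡.refl
  coeff-sumₚ (x ∷ xs) F j = ≡.trans (coeff-+ₚ (F x) _ j) (≡.cong (coeff (F x) j ℚ.+_) (coeff-sumₚ xs F j))

  coef-pow : ∀ m k F α q → coef m F α B.≈ QS.const q →
    ∀ j → coef m (T._*_ m (CW.pow m k) F) α j ≡ coeff (Defs.t^ k) j ℚ.* q
  coef-pow m zero F α q p j = ≡.trans (QS.at (coef-cong m (T.*-identityˡ m F) α) j) (≡.trans (QS.at p j) (go j))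
    where
    go : ∀ j → QS.const q j ≡ coeff (1ℚ ∷ []) j ℚ.* q
    go zero    = ≡.sym (ℚ.*-identityˡ q)
    go (suc j) = ≡.sym (ℚ.*-zeroˡ q)
  coef-pow m (suc k) F α q p j = ≡.trans (QS.at (coef-cong m (T.*-assoc m _ _ F) α) j)
    (≡.trans (QS.at (coef-scalar m (QS.lin 1ℚ) (T._*_ m (CW.pow m k) F) α) j)
    (≡.trans (QS.conv-lin 1ℚ (coef m (T._*_ m (CW.pow m k) F) α) j) (go j)))
    where
    go : ∀ j → QS.lin* 1ℚ (coef m (T._*_ m (CW.pow m k) F) α) j ≡ coeff (Defs.t^ suc k) j ℚ.* q
    go zero    = ≡.sym (ℚ.*-zeroˡ q)
    go (suc j) = ≡.trans (ℚ.*-identityˡ _) (coef-pow m k F α q p j)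

  edgePairs-map : ∀ {A B : Set} {n} (f : A → B) (κ : Vec A n) →
    edgePairs (Vec.map f κ) ≡ map (Prod.map f f) (edgePairs κ)
  edgePairs-map f κ = ≡.trans
    (List.map-cong (λ u → ≡.cong₂ _,_ (Vec.lookup-map u f κ) (Vec.lookup-map (next u) f κ)) (allFin _))
    (List.map-∘ (allFin _))

  edgePairs-sources : ∀ {A : Set} {n} (κ : Vec A n) → map proj₁ (edgePairs κ) ≡ toList κ
  edgePairs-sources κ = ≡.trans (≡.sym (List.map-∘ (allFin _)))
    (≡.trans (List.map-tabulate id (lookup κ)) (go κ))
    where
    go : ∀ {A : Set} {n} (κ : Vec A n) → List.tabulate (lookup κ) ≡ toList κ
    go []      = ≡.refl
    go (a ∷ κ) = ≡.cong (a ∷_) (go κ)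

  upTo-toℕ : ∀ m → upTo m ≡ map toℕ (allFin m)
  upTo-toℕ m = ≡.trans (go id m) (≡.sym (List.map-tabulate id toℕ))
    where
    go : ∀ (f : ℕ → ℕ) m → applyUpTo f m ≡ List.tabulate {n = m} (f ∘ toℕ)
    go f zero    = ≡.refl
    go f (suc m) = ≡.cong (f 0 ∷_) (go (f ∘ suc) m)

  ∑ₗ-vectors-map : ∀ {A C : Set} (f : A → C) xs n F →
    ∑ₗ (vectors (map f xs) n) F ≡ ∑ₗ (vectors xs n) (F ∘ Vec.map f)
  ∑ₗ-vectors-map f xs zero    F = ≡.refl
  ∑ₗ-vectors-map f xs (suc n) F = ≡.trans (∑ₗ-product _∷_ (map f xs) (vectors (map f xs) n) F)
    (≡.trans (∑ₗ-map f xs (λ x → ∑ₗ (vectors (map f xs) n) (λ v → F (x ∷ v))))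
    (≡.trans (∑ₗ-cong xs (λ x → ∑ₗ-vectors-map f xs n (F ∘ (f x ∷_))))
             (≡.sym (∑ₗ-product _∷_ xs (vectors xs n) (F ∘ Vec.map f)))))

  module _ {n} (α : Monomial) (κ : Vec (Fin (length α)) n) where
    private
      m  = length α
      vα = fromList α
      κ′ = Vec.map toℕ κ

    asc-ascents : asc (cycle n) κ′ ≡ WS.ascents m (edgePairs κ)
    asc-ascents = ≡.trans (arcs-count (λ (a , b) → a ℕ.<? b) κ′)
      (≡.trans (≡.cong (λ ps → length (filter (λ (a , b) → a ℕ.<? b) ps)) (edgePairs-map toℕ κ))
               (length-filter-map (λ (a , b) → a ℕ.<? b) (Prod.map toℕ toℕ) (edgePairs κ)))

    weight-tabulate : weight m κ′ ≡ List.tabulate (λ i → occurrences (toList κ) i)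
    weight-tabulate = ≡.trans (≡.cong (map (λ i → Vec.count (ℕ._≟ i) κ′)) (upTo-toℕ m))
      (≡.trans (≡.sym (List.map-∘ (allFin m)))
      (≡.trans (List.map-tabulate id _) (List.tabulate-cong (go κ))))
      where
      go : ∀ {n} (κ : Vec (Fin m) n) i → Vec.count (ℕ._≟ toℕ i) (Vec.map toℕ κ) ≡ occurrences (toList κ) i
      go []      i = ≡.refl
      go (a ∷ κ) i with a Fin.≟ i
      ... | yes ≡.refl rewrite dec-true (toℕ i ℕ.≟ toℕ i) ≡.refl = ≡.cong suc (go κ i)
      ... | no a≢i     rewrite dec-false (toℕ a ℕ.≟ toℕ i) (a≢i ∘ Fin.toℕ-injective) = go κ i

  tabulate⇒lookup : ∀ (α : List ℕ) (f : Fin (length α) → ℕ) → List.tabulate f ≡ α →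
    ∀ i → lookup (fromList α) i ≡ f i
  tabulate⇒lookup (a ∷ α) f eq zero    = ≡.sym (List.∷-injectiveˡ eq)
  tabulate⇒lookup (a ∷ α) f eq (suc i) = tabulate⇒lookup α (f ∘ suc) (List.∷-injectiveʳ eq) i

  lookup⇒tabulate : ∀ (α : List ℕ) (f : Fin (length α) → ℕ) →
    (∀ i → lookup (fromList α) i ≡ f i) → List.tabulate f ≡ α
  lookup⇒tabulate []      f p = ≡.refl
  lookup⇒tabulate (a ∷ α) f p = ≡.cong₂ _∷_ (≡.sym (p zero)) (lookup⇒tabulate α (f ∘ suc) (p ∘ suc))

  contributes? : ∀ {n} (α : Monomial) (κ : Coloring n) → Dec (Proper (cycle n) κ × weight (length α) κ ≡ α)
  contributes? {n} α κ = proper? (cycle n) κ ×-dec List.≡-dec ℕ._≟_ (weight (length α) κ) α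

  if-true : ∀ {p} {P : Set p} (d : Dec P) {x y : ℚ} → P → (if does d then x else y) ≡ x
  if-true d p rewrite dec-true d p = ≡.refl

  if-false : ∀ {p} {P : Set p} (d : Dec P) {x y : ℚ} → ¬ P → (if does d then x else y) ≡ y
  if-false d p rewrite dec-false d p = ≡.refl

  -- An improper colouring has an edge on the zero diagonal of the matrix. A proper one gives t to
  -- its ascents times a monomial, which is then compared with α.
  coef-coloring : ∀ {n} α (κ : Vec (Fin (length α)) n) j →
    coef (length α) (WS.pairsWeight (length α) (edgePairs κ)) (fromList α) j ≡
    (if does (contributes? α (Vec.map toℕ κ)) then coeff (Defs.t^ asc (cycle n) (Vec.map toℕ κ)) j else 0ℚ)
  coef-coloring {n} α κ j = go (Any.any? (λ (a , b) → a Fin.≟ b) (edgePairs κ))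
    where
    m  = length α
    vα = fromList α
    κ′ = Vec.map toℕ κ
    RHS = if does (contributes? α κ′) then coeff (Defs.t^ asc (cycle n) κ′) j else 0ℚ
    go : Dec (Any (λ (a , b) → a ≡ b) (edgePairs κ)) →
      coef m (WS.pairsWeight m (edgePairs κ)) vα j ≡ RHS
    go (yes p) = ≡.trans
      (QS.at (B.trans (coef-cong m (WS.pairsWeight-improper m (edgePairs κ) p) vα) (coef-0 m vα)) j)
      (≡.sym (if-false (contributes? α κ′) (λ (pr , _) → improper pr)))
      where
      improper : ¬ Proper (cycle n) κ′
      improper pr with find p
      ... | x , x∈ , eq = All.lookup (proper⇒edges κ′ pr)
            (≡.subst (Prod.map toℕ toℕ x ∈_) (≡.sym (edgePairs-map toℕ κ)) (∈-map⁺ (Prod.map toℕ toℕ) x∈))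
            (≡.cong toℕ eq)
    go (no ¬p) = ≡.trans (QS.at (coef-cong m weight-eq vα) j) (by-weight (List.≡-dec ℕ._≟_ (weight m κ′) α))
      where
      edges : All (λ (a , b) → toℕ a ≢ toℕ b) (edgePairs κ)
      edges = All.tabulate λ x∈ eq → ¬p (lose x∈ (Fin.toℕ-injective eq))
      proper : Proper (cycle n) κ′
      proper = edges⇒proper κ′ (≡.subst (All (λ (a , b) → a ≢ b)) (≡.sym (edgePairs-map toℕ κ)) (All.map⁺ edges))
      weight-eq : T._≈_ m (WS.pairsWeight m (edgePairs κ))
        (T._*_ m (CW.pow m (asc (cycle n) κ′)) (monomial m (toList κ)))
      weight-eq = T.trans m (WS.pairsWeight-proper m (edgePairs κ) edges) (T.reflexive m
        (≡.cong₂ (λ k is → T._*_ m (CW.pow m k) (monomial m is)) (≡.sym (asc-ascents α κ)) (edgePairs-sources κ)))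
      by-weight : Dec (weight m κ′ ≡ α) →
        coef m (T._*_ m (CW.pow m (asc (cycle n) κ′)) (monomial m (toList κ))) vα j ≡ RHS
      by-weight (yes w) = ≡.trans
        (coef-pow m (asc (cycle n) κ′) (monomial m (toList κ)) vα 1ℚ
          (coef-monomial m (toList κ) vα
            (tabulate⇒lookup α _ (≡.trans (≡.sym (weight-tabulate α κ)) w))) j)
        (≡.trans (ℚ.*-identityʳ (coeff (Defs.t^ asc (cycle n) κ′) j)) (≡.sym (if-true (contributes? α κ′) (proper , w))))
      by-weight (no w) = ≡.trans
        (coef-pow m (asc (cycle n) κ′) (monomial m (toList κ)) vα 0ℚ
          (B.trans mismatch (B.sym const-0)) j)
        (≡.trans (ℚ.*-zeroʳ (coeff (Defs.t^ asc (cycle n) κ′) j)) (≡.sym (if-false (contributes? α κ′) (w ∘ proj₂))))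
        where
        mismatch : coef m (monomial m (toList κ)) vα B.≈ B.0#
        mismatch with Fin.any? (λ i → ¬? (lookup vα i ℕ.≟ occurrences (toList κ) i))
        ... | yes (i , p) = coef-monomial-≢ m (toList κ) vα i p
        ... | no q        = contradiction (≡.trans (weight-tabulate α κ) (lookup⇒tabulate α _ λ i →
                  decidable-stable (lookup vα i ℕ.≟ occurrences (toList κ) i) (λ ¬e → q (i , ¬e)))) w

  -- A colouring that contributes to α uses only the colours below `length α`, so this coefficient
  -- is visible in a matrix of that size.
  X-coeff : ∀ k α j → coeff (X (cycle (suc k)) α) j ≡
    coef (length α) (Walk.C (length α) (var (length α)) (suc k)) (fromList α) j
  X-coeff k α j = begin
    coeff (X (cycle n) α) j
      ≡⟨ coeff-sumₚ (filter (contributes? α) (vectors (upTo m) n)) (λ κ → Defs.t^ asc (cycle n) κ) j ⟩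
    ∑ₗ (filter (contributes? α) (vectors (upTo m) n)) (λ κ → coeff (Defs.t^ asc (cycle n) κ) j)
      ≡⟨ ∑ₗ-filter (contributes? α) (vectors (upTo m) n) _ ⟩
    ∑ₗ (vectors (upTo m) n) F
      ≡⟨ ≡.cong (λ xs → ∑ₗ (vectors xs n) F) (upTo-toℕ m) ⟩
    ∑ₗ (vectors (map toℕ (allFin m)) n) F
      ≡⟨ ∑ₗ-vectors-map toℕ (allFin m) n F ⟩
    ∑ₗ (vectors (allFin m) n) (F ∘ Vec.map toℕ)
      ≡⟨ ∑ₗ-cong (vectors (allFin m) n) (λ κ → ≡.sym (coef-coloring α κ j)) ⟩
    ∑ₗ (vectors (allFin m) n) (λ κ → coef m (WS.pairsWeight m (edgePairs κ)) (fromList α) j)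
      ≡⟨ at-∑ (vectors (allFin m) n) (λ κ → coef m (WS.pairsWeight m (edgePairs κ)) (fromList α)) j ⟨
    ListSums.∑ₗ ℚ[[t]] (vectors (allFin m) n) (λ κ → coef m (WS.pairsWeight m (edgePairs κ)) (fromList α)) j
      ≡⟨ QS.at (coef-∑ m (vectors (allFin m) n) (λ κ → WS.pairsWeight m (edgePairs κ)) (fromList α)) j ⟨
    coef m (ListSums.∑ₗ (tower m) (vectors (allFin m) n) (λ κ → WS.pairsWeight m (edgePairs κ))) (fromList α) j
      ≡⟨ QS.at (coef-cong m (WS.C≈colorings m k) (fromList α)) j ⟨
    coef m (Walk.C m (var m) n) (fromList α) j ∎
    where
    open ≡.≡-Reasoning
    n = suc k
    m = length α
    F : Coloring n → ℚ
    F κ = if does (contributes? α κ) then coeff (Defs.t^ asc (cycle n) κ) j else 0ℚ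

  orientation-sum : ∀ k α j → coeff (X (cycle (suc k)) α) j ≡
    ∑ₗ (acyclicOrientations (suc k))
       (λ A → coeff (Defs.t^ ones (word A)) j ℚ.* e[ segments (suc k) (wordSinks (word A)) ] α)
  orientation-sum k α j = begin
    coeff (X (cycle n) α) j
      ≡⟨ X-coeff k α j ⟩
    coef m (Walk.C m (var m) n) vα j
      ≡⟨ QS.at (coef-cong m (PowerSeries.at (CW.equation-unique m (Walk.newton m (var m)) (CW.Y-equation m)) n) vα) j ⟩
    coef m (CW.Y m n) vα j
      ≡⟨ QS.at (coef-cong m (WW.Y≈orientations m k) vα) j ⟩
    coef m (ListSums.∑ₗ (tower m) (acyclicOrientations n) (λ A → WW.wordWeight m (word A))) vα j
      ≡⟨ QS.at (coef-∑ m (acyclicOrientations n) (λ A → WW.wordWeight m (word A)) vα) j ⟩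
    ListSums.∑ₗ ℚ[[t]] (acyclicOrientations n) (λ A → coef m (WW.wordWeight m (word A)) vα) j
      ≡⟨ at-∑ (acyclicOrientations n) (λ A → coef m (WW.wordWeight m (word A)) vα) j ⟩
    ∑ₗ (acyclicOrientations n) (λ A → coef m (WW.wordWeight m (word A)) vα j)
      ≡⟨ ∑ₗ-cong (acyclicOrientations n) (λ A → coef-pow m (ones (word A)) _ vα
           (e[ segments n (wordSinks (word A)) ] α)
           (B.trans (represents-eProduct m (segments n (wordSinks (word A))) vα)
             (B.reflexive (≡.cong (λ β → QS.const (e[ segments n (wordSinks (word A)) ] β)) (Vec.toList∘fromList α)))) j) ⟩
    ∑ₗ (acyclicOrientations n) (λ A → coeff (Defs.t^ ones (word A)) j ℚ.* e[ segments n (wordSinks (word A)) ] α) ∎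
    where
    open ≡.≡-Reasoning
    n = suc k
    m = length α
    vα = fromList α

  -- Factors are exchanged in the tower, whose multiplication is commutative, and the rational value
  -- is read off as the coefficient of t⁰.
  e-↭ : ∀ {λs μs} α → λs ↭ μs → e[ λs ] α ≡ e[ μs ] α
  e-↭ {λs} {μs} α p = ≡.subst (λ β → e[ λs ] β ≡ e[ μs ] β) (Vec.toList∘fromList α)
    (QS.at (B.trans (B.sym (represents-eProduct m λs (fromList α)))
      (B.trans (coef-cong m (product-↭ p) (fromList α)) (represents-eProduct m μs (fromList α)))) 0)
    where
    m = length α
    product-↭ : ∀ {λs μs} → λs ↭ μs → T._≈_ m (WW.eProduct m λs) (WW.eProduct m μs)
    product-↭ refl         = T.refl m
    product-↭ (prep x p)   = T.*-congˡ m (product-↭ p)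
    product-↭ (swap x y p) = T.trans m (x∙yz≈y∙xz _ _ _) (T.*-congˡ m (T.*-congˡ m (product-↭ p)))
      where open import Algebra.Properties.CommutativeSemigroup (T.*-commutativeSemigroup m) using (x∙yz≈y∙xz)
    product-↭ (trans p q)  = T.trans m (product-↭ p) (product-↭ q)

-- Existence and uniqueness of the expansion in the e_λ.

module ElementaryExpansion where
  open import Data.Bool.Base using (Bool; true; false; if_then_else_; _∧_)
  import Data.Fin.Base as Fin
  open import Data.List.Base as List using (List; []; _∷_; map; length; upTo; zipWith; concatMap)
  open import Data.List.Membership.Propositional using (_∈_; lose)
  open import Data.List.Membership.Propositional.Properties
    using (∈-filter⁺; ∈-filter⁻; ∈-map⁺; ∈-map⁻; ∈-concatMap⁺; ∈-upTo⁺; ∈-cartesianProductWith⁺; ∈-cartesianProductWith⁻; ∈-upTo⁻)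
  import Data.List.Properties as List
  open import Data.List.Relation.Binary.Permutation.Propositional using (_↭_; ↭-sym; ↭-trans; ↭⇒↭ₛ)
  import Data.List.Relation.Binary.Permutation.Propositional.Properties as Perm
  open import Data.List.Relation.Binary.Pointwise using (Pointwise-≡⇒≡)
  open import Data.List.Relation.Unary.All as All using (All; []; _∷_)
  import Data.List.Relation.Unary.All.Properties as All
  import Data.List.Relation.Unary.AllPairs as AllPairs
  import Data.List.Relation.Unary.AllPairs.Properties as AllPairs
  open import Data.List.Relation.Unary.Any using (here; there)
  open import Data.List.Relation.Unary.Linked as Linked using (Linked)
  open import Data.List.Relation.Unary.Linked.Properties using (Linked⇒AllPairs)
  open import Data.List.Relation.Unary.Sorted.TotalOrder.Properties using (↗↭↗⇒≋)
  open import Data.List.Relation.Unary.Unique.Propositional using (Unique; []; _∷_)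
  import Data.List.Relation.Unary.Unique.Propositional.Properties as Unique
  import Data.List.Sort as Sort
  open import Data.Nat.Base as ℕ using (ℕ; zero; suc; pred; _∸_; _≤_; _<_; _≥_; z≤n; s≤s; s≤s⁻¹)
  open import Data.Nat.ListAction using (sum)
  open import Data.Nat.ListAction.Properties using (sum-↭)
  open import Data.Product.Base using (_×_; _,_; proj₂; ∃)
  open import Data.Rational.Base as ℚ using (ℚ; 0ℚ; 1ℚ)
  import Data.Rational.Properties as ℚ
  open import Data.Sum.Base using (inj₁; inj₂)
  open import Data.Unit.Base using (⊤; tt)
  open import Data.Vec.Base as Vec using (Vec; []; _∷_; lookup; toList; fromList)
  import Data.Vec.Properties as Vec
  open import Defs hiding (e; t^_)
  open import Relation.Binary.Bundles using (DecTotalOrder)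
  import Relation.Binary.Construct.Flip.EqAndOrd as Flip
  open import Relation.Binary.PropositionalEquality
  open import Relation.Nullary using (¬_; Dec; yes; no; does; contradiction)
  open import Relation.Nullary.Decidable using (_×-dec_)
  open CycleDigraph
  open Weights
  open Coefficients

  open ListSums ℚ-ring
  open ListSumProperties ℚ-ring

  ∑ₗ-cong-∈ : ∀ {A : Set} (xs : List A) {F G : A → ℚ} → (∀ {x} → x ∈ xs → F x ≡ G x) → ∑ₗ xs F ≡ ∑ₗ xs G
  ∑ₗ-cong-∈ []       p = refl
  ∑ₗ-cong-∈ (x ∷ xs) p = cong₂ ℚ._+_ (p (here refl)) (∑ₗ-cong-∈ xs (p ∘ there))

  ∑ₗ-single : ∀ {A : Set} {xs : List A} {x} (F : A → ℚ) → Unique xs → x ∈ xs →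
    (∀ {y} → y ∈ xs → y ≢ x → F y ≡ 0ℚ) → ∑ₗ xs F ≡ F x
  ∑ₗ-single {xs = x ∷ xs} F (u ∷ us) (here refl) z = trans
    (cong (F x ℚ.+_) (trans (∑ₗ-cong-∈ xs (λ y∈ → z (there y∈) (≢-sym (All.lookup u y∈)))) (∑ₗ-zero xs)))
    (ℚ.+-identityʳ _)
  ∑ₗ-single {xs = y ∷ xs} F (u ∷ us) (there x∈) z = trans
    (cong₂ ℚ._+_ (z (here refl) (All.lookup u x∈)) (∑ₗ-single F us x∈ (z ∘ there))) (ℚ.+-identityˡ _)

  toList-injective : ∀ {A : Set} {n} {v w : Vec A n} → toList v ≡ toList w → v ≡ w
  toList-injective {v = v} {w} eq =
    trans (sym (Vec.cast-is-id refl v)) (Vec.toList-injective refl v w eq)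

  -- The candidates are grouped by length, so different groups are disjoint.
  partitions-unique : ∀ n → Unique (partitions n)
  partitions-unique n = Unique.filter⁺ (_⊢? n) (Unique.concat⁺ {xss = map block (upTo (suc n))}
    (All.map⁺ {xs = upTo (suc n)} (All.tabulate λ {k} _ →
      Unique.map⁺ toList-injective (vectors-unique (Unique.upTo⁺ (suc n)) k)))
    (AllPairs.map⁺ (AllPairs.map disjoint (Unique.upTo⁺ (suc n)))))
    where
    block : ℕ → List (List ℕ)
    block k = map toList (vectors (upTo (suc n)) k)
    length-of : ∀ {k v} → v ∈ map toList (vectors (upTo (suc n)) k) → length v ≡ k
    length-of v∈ with ∈-map⁻ toList v∈
    ... | w , _ , refl = Vec.length-toList w
    disjoint : ∀ {k l} → k ≢ l → ∀ {v} →
      ¬ (v ∈ map toList (vectors (upTo (suc n)) k) × v ∈ map toList (vectors (upTo (suc n)) l))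
    disjoint k≢l (p , q) = k≢l (trans (sym (length-of p)) (length-of q))

  ∈-partitions⁻ : ∀ n {λs} → λs ∈ partitions n → λs ⊢ n
  ∈-partitions⁻ n {λs} p =
    proj₂ (∈-filter⁻ (_⊢? n) {xs = concatMap (λ k → map toList (vectors (upTo (suc n)) k)) (upTo (suc n))} p)

  length≤sum : ∀ {λs} → All (0 <_) λs → length λs ≤ sum λs
  length≤sum []       = z≤n
  length≤sum (p ∷ ps) = ℕ.+-mono-≤ p (length≤sum ps)

  part≤sum : ∀ λs → All (_≤ sum λs) λs
  part≤sum []       = []
  part≤sum (k ∷ λs) = ℕ.m≤m+n k (sum λs) ∷ All.map (λ p → ℕ.≤-trans p (ℕ.m≤n+m (sum λs) k)) (part≤sum λs)

  ∈-partitions⁺ : ∀ n {λs} → λs ⊢ n → λs ∈ partitions n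
  ∈-partitions⁺ n {λs} λ⊢n@(pos , _ , refl) = ∈-filter⁺ (_⊢? n)
    (∈-concatMap⁺ (λ k → map toList (vectors (upTo (suc n)) k)) (lose {x = length λs} (∈-upTo⁺ (s≤s (length≤sum pos)))
      (subst (_∈ map toList (vectors (upTo (suc n)) (length λs))) (Vec.toList∘fromList λs) (∈-map⁺ toList (vectors-complete (fromList λs) (in-range (part≤sum λs)))))))
    λ⊢n
    where
    in-range : ∀ {μs} → All (_≤ n) μs → ∀ i → lookup (fromList μs) i ∈ upTo (suc n)
    in-range (p ∷ ps) Fin.zero    = ∈-upTo⁺ (s≤s p)
    in-range (p ∷ ps) (Fin.suc i) = in-range ps i

  ≥-decTotalOrder : DecTotalOrder _ _ _
  ≥-decTotalOrder = Flip.decTotalOrder ℕ.≤-decTotalOrder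

  open Sort ≥-decTotalOrder using (sort; sort-↭; sort-↗)

  partition-↭ : ∀ {m n λs μs} → λs ⊢ m → μs ⊢ n → λs ↭ μs → λs ≡ μs
  partition-↭ (_ , p , _) (_ , q , _) r =
    Pointwise-≡⇒≡ (↗↭↗⇒≋ (DecTotalOrder.totalOrder ≥-decTotalOrder) p q (↭⇒↭ₛ r))

  sort-⊢ : ∀ {n λs} → All (0 <_) λs → sum λs ≡ n → sort λs ⊢ n
  sort-⊢ {n} {λs} p q = Perm.All-resp-↭ (↭-sym (sort-↭ λs)) p , sort-↗ λs , trans (sum-↭ (sort-↭ λs)) q

  -- A telescoping sum of the distances between successive sinks, from `s` to the copy n + s₁ of the
  -- first sink.
  segmentsFrom-sum : ∀ {r} (w : Vec Bool r) n s₁ s p prev → s < p → n ≡ p ℕ.+ r →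
    sum (map suc (gapsFrom n s₁ s (sinkPositions p prev w))) ≡ n ℕ.+ s₁ ∸ s
  segmentsFrom-sum []          n s₁ s p prev  s<p eq = trans (ℕ.+-identityʳ _)
    (sym (ℕ.+-∸-assoc 1 (ℕ.≤-trans s<p (ℕ.≤-trans (ℕ.≤-reflexive (trans (sym (ℕ.+-identityʳ p)) (sym eq))) (ℕ.m≤m+n n s₁)))))
  segmentsFrom-sum (true ∷ w)  n s₁ s p true  s<p eq = segmentsFrom-sum w n s₁ s (suc p) true (ℕ.m<n⇒m<1+n s<p) (trans eq (ℕ.+-suc p _))
  segmentsFrom-sum (true ∷ w)  n s₁ s p false s<p eq = segmentsFrom-sum w n s₁ s (suc p) true (ℕ.m<n⇒m<1+n s<p) (trans eq (ℕ.+-suc p _))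
  segmentsFrom-sum (false ∷ w) n s₁ s p false s<p eq = segmentsFrom-sum w n s₁ s (suc p) false (ℕ.m<n⇒m<1+n s<p) (trans eq (ℕ.+-suc p _))
  segmentsFrom-sum {suc r} (false ∷ w) n s₁ s p true s<p eq = begin
    suc (p ∸ suc s) ℕ.+ sum (map suc (gapsFrom n s₁ p (sinkPositions (suc p) false w)))
      ≡⟨ cong₂ ℕ._+_ (sym (ℕ.+-∸-assoc 1 s<p)) (segmentsFrom-sum w n s₁ p (suc p) false ℕ.≤-refl (trans eq (ℕ.+-suc p _))) ⟩
    (p ∸ s) ℕ.+ (n ℕ.+ s₁ ∸ p)
      ≡⟨ ℕ.+-comm (p ∸ s) _ ⟩
    (n ℕ.+ s₁ ∸ p) ℕ.+ (p ∸ s)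
      ≡⟨ ℕ.+-∸-assoc (n ℕ.+ s₁ ∸ p) (ℕ.<⇒≤ s<p) ⟨
    (n ℕ.+ s₁ ∸ p) ℕ.+ p ∸ s
      ≡⟨ cong (_∸ s) (ℕ.m∸n+n≡m p≤) ⟩
    n ℕ.+ s₁ ∸ s ∎
    where
    open ≡-Reasoning
    p≤ : p ≤ n ℕ.+ s₁
    p≤ = ℕ.≤-trans (ℕ.m≤m+n p (suc r)) (ℕ.≤-trans (ℕ.≤-reflexive (sym eq)) (ℕ.m≤m+n n s₁))

  segments-sum : ∀ {r} (w : Vec Bool r) n p prev → n ≡ p ℕ.+ r → sinkPositions p prev w ≢ [] →
    sum (segments n (sinkPositions p prev w)) ≡ n
  segments-sum []          n p prev  eq ne = contradiction refl ne
  segments-sum (true ∷ w)  n p true  eq ne = segments-sum w n (suc p) true (trans eq (ℕ.+-suc p _)) ne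
  segments-sum (true ∷ w)  n p false eq ne = segments-sum w n (suc p) true (trans eq (ℕ.+-suc p _)) ne
  segments-sum (false ∷ w) n p false eq ne = segments-sum w n (suc p) false (trans eq (ℕ.+-suc p _)) ne
  segments-sum (false ∷ w) n p true  eq ne = trans
    (segmentsFrom-sum w n p p (suc p) false ℕ.≤-refl (trans eq (ℕ.+-suc p _))) (ℕ.m+n∸n≡m n p)

  map-suc-positive : ∀ xs → All (0 <_) (map suc xs)
  map-suc-positive xs = All.map⁺ (All.tabulate (λ _ → ℕ.z<s))

  map-suc-pred : ∀ {xs} → All (0 <_) xs → map suc (map pred xs) ≡ xs
  map-suc-pred []               = refl
  map-suc-pred {suc _ ∷ _} (_ ∷ ps) = cong (_ ∷_) (map-suc-pred ps)

  orientationCoefficient : ∀ n → List ℕ → ℚ[t]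
  orientationCoefficient n λs = sumₚ (map (λ A → Defs.t^ ascₒ (cycle n) A) (AO n λs))

  expansion-coeff : ∀ n c α j → coeff (e-expansion n c α) j ≡
    ∑ₗ (partitions n) (λ λs → e[ λs ] α ℚ.* coeff (c λs) j)
  expansion-coeff n c α j = trans (coeff-sumₚ (partitions n) (λ λs → e[ λs ] α ·ₚ c λs) j)
    (∑ₗ-cong (partitions n) (λ λs → coeff-·ₚ (e[ λs ] α) (c λs) j))

  -- Splitting off the condition on the gaps leaves a range of summation independent of `λs`, so
  -- that the sums over orientations and over partitions can be exchanged.
  orientationCoefficient-coeff : ∀ n λs j → coeff (orientationCoefficient n λs) j ≡
    ∑ₗ (acyclicOrientations n)
       (λ A → if does (gaps n (sinks A) ↭? map pred λs) then coeff (Defs.t^ ascₒ (cycle n) A) j else 0ℚ)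
  orientationCoefficient-coeff n λs j = begin
    coeff (orientationCoefficient n λs) j
      ≡⟨ coeff-sumₚ (AO n λs) (λ A → Defs.t^ ascₒ (cycle n) A) j ⟩
    ∑ₗ (AO n λs) τ
      ≡⟨ ∑ₗ-filter (inAO? n λs) (digraphs n) τ ⟩
    ∑ₗ (digraphs n) (λ A → if does (inAO? n λs A) then τ A else 0ℚ)
      ≡⟨ ∑ₗ-cong (digraphs n) (λ A → split (does (isOrientation? (cycle n) A)) (does (acyclic? A)) (does (g? A)) (τ A)) ⟩
    ∑ₗ (digraphs n) (λ A → if does (isAcyclicOrientation? A) then (if does (g? A) then τ A else 0ℚ) else 0ℚ)
      ≡⟨ ∑ₗ-filter isAcyclicOrientation? (digraphs n) (λ A → if does (g? A) then τ A else 0ℚ) ⟨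
    ∑ₗ (acyclicOrientations n) (λ A → if does (g? A) then τ A else 0ℚ) ∎
    where
    open ≡-Reasoning
    τ : Digraph n → ℚ
    τ A = coeff (Defs.t^ ascₒ (cycle n) A) j
    g? : ∀ A → Dec (gaps n (sinks A) ↭ map pred λs)
    g? A = gaps n (sinks A) ↭? map pred λs
    split : ∀ a b c (x : ℚ) → (if a ∧ (b ∧ c) then x else 0ℚ) ≡ (if a ∧ b then (if c then x else 0ℚ) else 0ℚ)
    split false b     c x = refl
    split true  false c x = refl
    split true  true  c x = refl

  module _ (k : ℕ) where
    private n = suc k

    partitionOf : Digraph n → List ℕ
    partitionOf A = sort (segments n (sinks A))

    partitionOf-⊢ : ∀ {A} → IsAcyclicOrientation A → partitionOf A ⊢ n
    partitionOf-⊢ {A} ac@(or , _) = sort-⊢ (map-suc-positive _)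
      (subst (λ ss → sum (segments n ss) ≡ n) (sym (sinks-word A or))
        (segments-sum (word A) n 0 (lastBit true (word A)) refl (acyclic⇒nonConstant {A = A} ac)))

    partitionOf-gaps : ∀ A → gaps n (sinks A) ↭ map pred (partitionOf A)
    partitionOf-gaps A = ↭-sym (subst (map pred (partitionOf A) ↭_) pred-suc (Perm.map⁺ pred (sort-↭ _)))
      where
      pred-suc : map pred (segments n (sinks A)) ≡ gaps n (sinks A)
      pred-suc = trans (sym (List.map-∘ (gaps n (sinks A)))) (List.map-id _)

    gaps⇒partitionOf : ∀ {A λs} → IsAcyclicOrientation A → λs ⊢ n → gaps n (sinks A) ↭ map pred λs →
      λs ≡ partitionOf A
    gaps⇒partitionOf {A} {λs} ac λ⊢n@(pos , _) p = partition-↭ λ⊢n (partitionOf-⊢ {A} ac)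
      (↭-sym (↭-trans (sort-↭ _) (subst (segments n (sinks A) ↭_) (map-suc-pred pos) (Perm.map⁺ suc p))))

    -- Each acyclic orientation belongs to exactly one partition, its sorted list of segment
    -- lengths, so the sum over orientations can be grouped by partitions.
    existence : X (cycle n) ≈ₛ e-expansion n (orientationCoefficient n)
    existence α j = begin
      coeff (X (cycle n) α) j
        ≡⟨ orientation-sum k α j ⟩
      ∑ₗ (acyclicOrientations n) (λ A → coeff (Defs.t^ ones (word A)) j ℚ.* e[ segments n (wordSinks (word A)) ] α)
        ≡⟨ ∑ₗ-cong-∈ (acyclicOrientations n) (λ {A} A∈ → select {A} (proj₂ (∈-filter⁻ isAcyclicOrientation? {xs = digraphs n} A∈))) ⟩
      ∑ₗ (acyclicOrientations n) (λ A → ∑ₗ (partitions n) (λ λs → e[ λs ] α ℚ.* F λs A))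
        ≡⟨ ∑ₗ-swap (acyclicOrientations n) (partitions n) (λ A λs → e[ λs ] α ℚ.* F λs A) ⟩
      ∑ₗ (partitions n) (λ λs → ∑ₗ (acyclicOrientations n) (λ A → e[ λs ] α ℚ.* F λs A))
        ≡⟨ ∑ₗ-cong (partitions n) (λ λs → trans (∑ₗ-* (acyclicOrientations n) (e[ λs ] α) (F λs))
             (cong (e[ λs ] α ℚ.*_) (sym (orientationCoefficient-coeff n λs j)))) ⟩
      ∑ₗ (partitions n) (λ λs → e[ λs ] α ℚ.* coeff (orientationCoefficient n λs) j)
        ≡⟨ expansion-coeff n (orientationCoefficient n) α j ⟨
      coeff (e-expansion n (orientationCoefficient n) α) j ∎
      where
      open ≡-Reasoning
      F : List ℕ → Digraph n → ℚ
      F λs A = if does (gaps n (sinks A) ↭? map pred λs) then coeff (Defs.t^ ascₒ (cycle n) A) j else 0ℚ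
      select : ∀ {A} → IsAcyclicOrientation A →
        coeff (Defs.t^ ones (word A)) j ℚ.* e[ segments n (wordSinks (word A)) ] α ≡
        ∑ₗ (partitions n) (λ λs → e[ λs ] α ℚ.* F λs A)
      select {A} ac@(or , _) = sym (begin
        ∑ₗ (partitions n) (λ λs → e[ λs ] α ℚ.* F λs A)
          ≡⟨ ∑ₗ-single (λ λs → e[ λs ] α ℚ.* F λs A) (partitions-unique n) (∈-partitions⁺ n (partitionOf-⊢ {A} ac))
               (λ {μs} μ∈ μ≢ → trans (cong (e[ μs ] α ℚ.*_)
                   (if-false (gaps n (sinks A) ↭? map pred μs) (μ≢ ∘ gaps⇒partitionOf {A} ac (∈-partitions⁻ n μ∈))))
                 (ℚ.*-zeroʳ (e[ μs ] α))) ⟩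
        e[ partitionOf A ] α ℚ.* F (partitionOf A) A
          ≡⟨ cong₂ ℚ._*_
               (trans (e-↭ α (sort-↭ _)) (cong (λ ss → e[ segments n ss ] α) (sinks-word A or)))
               (trans (if-true (gaps n (sinks A) ↭? map pred (partitionOf A)) (partitionOf-gaps A))
                      (cong (λ i → coeff (Defs.t^ i) j) (ascₒ-word A))) ⟩
        e[ segments n (wordSinks (word A)) ] α ℚ.* coeff (Defs.t^ ones (word A)) j
          ≡⟨ ℚ.*-comm (e[ segments n (wordSinks (word A)) ] α) _ ⟩
        coeff (Defs.t^ ones (word A)) j ℚ.* e[ segments n (wordSinks (word A)) ] α ∎)

  private module ℕ+ = CSg ℕ.+-commutativeSemigroup

  -- W α = Σ i αᵢ. On the monomials of e[ λs ] it is at least W-min λs, with equality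
  -- only at conjugate N λs; this triangularity gives the independence of the e[ λs ].

  W : Monomial → ℕ
  W []      = 0
  W (a ∷ α) = sum α ℕ.+ W α

  -- 0 + 1 + ⋯ + (k - 1), the value of `W` at x₀ ⋯ xₖ₋₁.
  triangle : ℕ → ℕ
  triangle zero    = 0
  triangle (suc k) = k ℕ.+ triangle k

  W-min : List ℕ → ℕ
  W-min λs = sum (map triangle λs)

  column : ℕ → ℕ → Monomial
  column zero    k       = []
  column (suc N) zero    = 0 ∷ column N zero
  column (suc N) (suc k) = 1 ∷ column N k

  infixl 6 _⊕_
  _⊕_ : Monomial → Monomial → Monomial
  _⊕_ = zipWith ℕ._+_

  -- The exponents of the product of x₀ ⋯ xₖ₋₁ over the parts k. When no part exceeds N, this is the
  -- conjugate partition padded with zeros to N entries.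
  conjugate : ℕ → List ℕ → Monomial
  conjugate N []       = column N 0
  conjugate N (k ∷ λs) = column N k ⊕ conjugate N λs

  length-column : ∀ N k → length (column N k) ≡ N
  length-column zero    k       = refl
  length-column (suc N) zero    = cong suc (length-column N zero)
  length-column (suc N) (suc k) = cong suc (length-column N k)

  length-⊕ : ∀ {β γ N} → length β ≡ N → length γ ≡ N → length (β ⊕ γ) ≡ N
  length-⊕ {[]}    {[]}    p q = p
  length-⊕ {b ∷ β} {c ∷ γ} refl q = cong suc (length-⊕ {β} {γ} refl (ℕ.suc-injective q))
  length-⊕ {[]}    {c ∷ γ} refl ()
  length-⊕ {b ∷ β} {[]}    refl ()

  length-conjugate : ∀ N λs → length (conjugate N λs) ≡ N
  length-conjugate N []       = length-column N 0
  length-conjugate N (k ∷ λs) = length-⊕ {column N k} (length-column N k) (length-conjugate N λs)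

  sum-⊕ : ∀ β γ → length β ≡ length γ → sum (β ⊕ γ) ≡ sum β ℕ.+ sum γ
  sum-⊕ []      []      p = refl
  sum-⊕ (b ∷ β) (c ∷ γ) p =
    trans (cong (b ℕ.+ c ℕ.+_) (sum-⊕ β γ (ℕ.suc-injective p))) (ℕ+.interchange b c (sum β) (sum γ))

  W-⊕ : ∀ β γ → length β ≡ length γ → W (β ⊕ γ) ≡ W β ℕ.+ W γ
  W-⊕ []      []      p = refl
  W-⊕ (b ∷ β) (c ∷ γ) p = trans
    (cong₂ ℕ._+_ (sum-⊕ β γ (ℕ.suc-injective p)) (W-⊕ β γ (ℕ.suc-injective p)))
    (ℕ+.interchange (sum β) (sum γ) (W β) (W γ))

  sum-column : ∀ {N k} → k ≤ N → sum (column N k) ≡ k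
  sum-column {zero}  {zero}  p = refl
  sum-column {suc N} {zero}  p = sum-column {N} z≤n
  sum-column {suc N} {suc k} p = cong suc (sum-column (s≤s⁻¹ p))

  W-column : ∀ {N k} → k ≤ N → W (column N k) ≡ triangle k
  W-column {zero}  {zero}  p = refl
  W-column {suc N} {zero}  p = cong₂ ℕ._+_ (sum-column {N} z≤n) (W-column {N} z≤n)
  W-column {suc N} {suc k} p = cong₂ ℕ._+_ (sum-column (s≤s⁻¹ p)) (W-column (s≤s⁻¹ p))

  W-conjugate : ∀ {N λs} → All (_≤ N) λs → W (conjugate N λs) ≡ W-min λs
  W-conjugate {N} []                 = W-column {N} z≤n
  W-conjugate {N} {k ∷ λs} (p ∷ ps) = trans
    (W-⊕ (column N k) (conjugate N λs) (trans (length-column N k) (sym (length-conjugate N λs))))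
    (cong₂ ℕ._+_ (W-column p) (W-conjugate ps))

  column-≤1 : ∀ N k → All (_≤ 1) (column N k)
  column-≤1 zero    k       = []
  column-≤1 (suc N) zero    = z≤n ∷ column-≤1 N zero
  column-≤1 (suc N) (suc k) = s≤s z≤n ∷ column-≤1 N k

  tight-sum : ∀ {a b x y} → a ≤ x → b ≤ y → x ℕ.+ y ≡ a ℕ.+ b → x ≡ a × y ≡ b
  tight-sum {a} {b} {x} {y} p q eq = x≡a , ℕ.+-cancelˡ-≡ a y b (trans (cong (ℕ._+ y) (sym x≡a)) eq)
    where
    x≡a : x ≡ a
    x≡a = ℕ.≤-antisym (ℕ.+-cancelʳ-≤ b x a (ℕ.≤-trans (ℕ.+-monoʳ-≤ x q) (ℕ.≤-reflexive eq))) p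

  -- Among the squarefree monomials of degree k, x₀ ⋯ xₖ₋₁ alone minimizes W.
  squarefree-W : ∀ β {k} → All (_≤ 1) β → sum β ≡ k →
    triangle k ≤ W β × (W β ≡ triangle k → β ≡ column (length β) k)
  squarefree-W []      []       refl = z≤n , λ _ → refl
  squarefree-W (zero ∷ β) {k} (_ ∷ ps) eq with squarefree-W β ps eq
  ... | p , q = ℕ.≤-trans p (ℕ.m≤n+m (W β) (sum β)) , tight k eq p q
    where
    tight : ∀ k → sum β ≡ k → triangle k ≤ W β → (W β ≡ triangle k → β ≡ column (length β) k) →
      sum β ℕ.+ W β ≡ triangle k → 0 ∷ β ≡ column (suc (length β)) k
    -- Skipping x₀ moves all remaining variables up by one, at a cost of `sum β`. Equality leaves no
    -- room for this cost, so k = 0.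
    tight k eq p q h with tight-sum {0} {triangle k} z≤n p h
    ... | sum≡0 , W≡ with trans (sym eq) sum≡0
    ...   | refl = cong (0 ∷_) (q W≡)
  squarefree-W (suc zero ∷ β) {suc k} (_ ∷ ps) eq with squarefree-W β ps (ℕ.suc-injective eq)
  ... | p , q = subst (λ s → k ℕ.+ triangle k ≤ s ℕ.+ W β) (sym s≡k) (ℕ.+-monoʳ-≤ k p) ,
    λ h → cong (1 ∷_) (q (ℕ.+-cancelˡ-≡ k _ _ (subst (λ s → s ℕ.+ W β ≡ k ℕ.+ triangle k) s≡k h)))
    where s≡k = ℕ.suc-injective eq
  squarefree-W (suc (suc a) ∷ β) (s≤s () ∷ ps) eq

  ∈-factorizations⁻ : ∀ α {β γ} → (β , γ) ∈ factorizations α →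
    α ≡ β ⊕ γ × length β ≡ length α × length γ ≡ length α
  ∈-factorizations⁻ []      (here refl) = refl , refl , refl
  ∈-factorizations⁻ (a ∷ α) p
    with ∈-cartesianProductWith⁻ (λ i (β , γ) → (i ∷ β) , ((a ∸ i) ∷ γ)) (upTo (suc a)) (factorizations α) p
  ... | i , (β , γ) , i∈ , βγ∈ , refl with ∈-factorizations⁻ α βγ∈
  ...   | q , r , s = cong₂ _∷_ (sym (ℕ.m+[n∸m]≡n (s≤s⁻¹ (∈-upTo⁻ i∈)))) q , cong suc r , cong suc s

  ∈-factorizations⁺ : ∀ β γ → length β ≡ length γ → (β , γ) ∈ factorizations (β ⊕ γ)
  ∈-factorizations⁺ []      []      p = here refl
  ∈-factorizations⁺ (b ∷ β) (c ∷ γ) p = subst (λ d → (b ∷ β , d ∷ γ) ∈ factorizations (b ℕ.+ c ∷ β ⊕ γ))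
    (ℕ.m+n∸m≡n b c)
    (∈-cartesianProductWith⁺ (λ i (β , γ) → (i ∷ β) , ((b ℕ.+ c ∸ i) ∷ γ))
      (∈-upTo⁺ (s≤s (ℕ.m≤m+n b c))) (∈-factorizations⁺ β γ (ℕ.suc-injective p)))

  ∑ₗ-nonzero : ∀ {A : Set} (xs : List A) F → ∑ₗ xs F ≢ 0ℚ → ∃ λ x → x ∈ xs × F x ≢ 0ℚ
  ∑ₗ-nonzero []       F p = contradiction refl p
  ∑ₗ-nonzero (x ∷ xs) F p with F x ℚ.≟ 0ℚ
  ... | no q  = x , here refl , q
  ... | yes q with ∑ₗ-nonzero xs F (λ r → p (cong₂ ℚ._+_ q r))
  ...   | y , y∈ , r = y , there y∈ , r

  if-nonzero : ∀ {p} {P : Set p} (d : Dec P) → (if does d then 1ℚ else 0ℚ) ≢ 0ℚ → P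
  if-nonzero (yes p) _ = p
  if-nonzero (no _)  q = contradiction refl q

  all-zero : ∀ {α} → All (_≡ 0) α → W α ≡ 0 × α ≡ column (length α) 0 × sum α ≡ 0
  all-zero []          = refl , refl , refl
  all-zero (refl ∷ ps) with all-zero ps
  ... | p , q , r = cong₂ ℕ._+_ r p , cong (0 ∷_) q , r

  -- A nonzero coefficient comes from some factorization with nonzero factors. `W` is additive over
  -- it, so the two lower bounds add, and equality in total forces equality in each factor.
  e-support : ∀ λs α → e[ λs ] α ≢ 0ℚ →
    W-min λs ≤ W α × (W α ≡ W-min λs → α ≡ conjugate (length α) λs)
  e-support []       α p with all-zero (if-nonzero (All.all? (ℕ._≟ 0) α) p)
  ... | q , r , _ = z≤n , λ _ → r
  e-support (k ∷ λs) α p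
    with ∑ₗ-nonzero (factorizations α) (λ (β , γ) → Defs.e k β ℚ.* e[ λs ] γ)
           (p ∘ trans (sumℚ-map (factorizations α) (λ (β , γ) → Defs.e k β ℚ.* e[ λs ] γ)))
  ... | (β , γ) , βγ∈ , q with ∈-factorizations⁻ α βγ∈
  ...   | refl , lβ , lγ
    with if-nonzero (All.all? (ℕ._≤? 1) β ×-dec (sum β ℕ.≟ k)) (λ r → q (trans (cong (ℚ._* e[ λs ] γ) r) (ℚ.*-zeroˡ (e[ λs ] γ))))
       | e-support λs γ (λ r → q (trans (cong (Defs.e k β ℚ.*_) r) (ℚ.*-zeroʳ (Defs.e k β))))
  ...     | β≤1 , sumβ | γ-min , γ-tight with squarefree-W β β≤1 sumβ
  ...       | β-min , β-tight =
    subst (W-min (k ∷ λs) ≤_) (sym W≡) (ℕ.+-mono-≤ β-min γ-min) , tight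
    where
    W≡ = W-⊕ β γ (trans lβ (sym lγ))
    tight : W (β ⊕ γ) ≡ W-min (k ∷ λs) → β ⊕ γ ≡ conjugate (length (β ⊕ γ)) (k ∷ λs)
    tight h with tight-sum β-min γ-min (trans (sym W≡) h)
    ... | Wβ , Wγ = cong₂ _⊕_ (trans (β-tight Wβ) (cong (λ l → column l k) lβ))
                              (trans (γ-tight Wγ) (cong (λ l → conjugate l λs) lγ))

  ∑ₗ-nonNeg : ∀ {A : Set} (xs : List A) F → (∀ x → 0ℚ ℚ.≤ F x) → 0ℚ ℚ.≤ ∑ₗ xs F
  ∑ₗ-nonNeg []       F p = ℚ.≤-refl
  ∑ₗ-nonNeg (x ∷ xs) F p = ℚ.+-mono-≤ (p x) (∑ₗ-nonNeg xs F p)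

  ∑ₗ-positive : ∀ {A : Set} {xs : List A} {x} F → (∀ x → 0ℚ ℚ.≤ F x) → x ∈ xs → 0ℚ ℚ.< F x → 0ℚ ℚ.< ∑ₗ xs F
  ∑ₗ-positive {xs = x ∷ xs} F p (here refl) q = ℚ.+-mono-<-≤ q (∑ₗ-nonNeg xs F p)
  ∑ₗ-positive {xs = x ∷ xs} F p (there x∈)  q = ℚ.+-mono-≤-< (p x) (∑ₗ-positive F p x∈ q)

  0≤1 : 0ℚ ℚ.≤ 1ℚ
  0≤1 = ℚ.nonNegative⁻¹ 1ℚ

  0<1 : 0ℚ ℚ.< 1ℚ
  0<1 = ℚ.positive⁻¹ 1ℚ

  if-nonNeg : ∀ b → 0ℚ ℚ.≤ (if b then 1ℚ else 0ℚ)
  if-nonNeg false = ℚ.≤-refl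
  if-nonNeg true  = 0≤1

  *-nonNeg : ∀ {a b} → 0ℚ ℚ.≤ a → 0ℚ ℚ.≤ b → 0ℚ ℚ.≤ a ℚ.* b
  *-nonNeg {a} {b} p q = ℚ.nonNegative⁻¹ _ {{ℚ.nonNeg*nonNeg⇒nonNeg a {{ℚ.nonNegative p}} b {{ℚ.nonNegative q}}}}

  *-positive : ∀ {a b} → 0ℚ ℚ.< a → 0ℚ ℚ.< b → 0ℚ ℚ.< a ℚ.* b
  *-positive {a} {b} p q = ℚ.positive⁻¹ _ {{ℚ.pos*pos⇒pos a {{ℚ.positive p}} b {{ℚ.positive q}}}}

  e-nonNeg : ∀ λs α → 0ℚ ℚ.≤ e[ λs ] α
  e-nonNeg []       α = if-nonNeg (does (All.all? (ℕ._≟ 0) α))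
  e-nonNeg (k ∷ λs) α = subst (0ℚ ℚ.≤_) (sym (sumℚ-map (factorizations α) (λ (β , γ) → Defs.e k β ℚ.* e[ λs ] γ)))
    (∑ₗ-nonNeg (factorizations α) _ λ (β , γ) → *-nonNeg (if-nonNeg (does (All.all? (ℕ._≤? 1) β ×-dec (sum β ℕ.≟ k)))) (e-nonNeg λs γ))

  column-zero : ∀ N → All (_≡ 0) (column N 0)
  column-zero zero    = []
  column-zero (suc N) = refl ∷ column-zero N

  -- Nothing cancels, since all terms are nonnegative; the factorization into the first column and
  -- the rest makes the sum positive. The exact value is never computed.
  e-conjugate : ∀ {N} λs → All (_≤ N) λs → 0ℚ ℚ.< e[ λs ] (conjugate N λs)
  e-conjugate {N} []       []       = subst (0ℚ ℚ.<_) (sym (if-true (All.all? (ℕ._≟ 0) (column N 0)) (column-zero N))) 0<1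
  e-conjugate {N} (k ∷ λs) (p ∷ ps) = subst (0ℚ ℚ.<_) (sym (sumℚ-map (factorizations α) F))
    (∑ₗ-positive F (λ (β , γ) → *-nonNeg (if-nonNeg (does (All.all? (ℕ._≤? 1) β ×-dec (sum β ℕ.≟ k)))) (e-nonNeg λs γ))
      (∈-factorizations⁺ (column N k) (conjugate N λs) (trans (length-column N k) (sym (length-conjugate N λs))))
      (*-positive
        (subst (0ℚ ℚ.<_) (sym (if-true (All.all? (ℕ._≤? 1) (column N k) ×-dec (sum (column N k) ℕ.≟ k))
          (column-≤1 N k , sum-column p))) 0<1)
        (e-conjugate λs ps)))
    where
    α = conjugate N (k ∷ λs)
    F : Monomial × Monomial → ℚ
    F (β , γ) = Defs.e k β ℚ.* e[ λs ] γ

  support : Monomial → ℕ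
  support []          = 0
  support (zero ∷ α)  = support α
  support (suc _ ∷ α) = suc (support α)

  ZeroFrom : ℕ → Monomial → Set
  ZeroFrom k       []      = ⊤
  ZeroFrom zero    (a ∷ α) = a ≡ 0 × ZeroFrom zero α
  ZeroFrom (suc k) (a ∷ α) = ZeroFrom k α

  column-zeroFrom : ∀ {k l} N → l ≤ k → ZeroFrom k (column N l)
  column-zeroFrom {k}     {l}     zero    p = tt
  column-zeroFrom {zero}  {zero}  (suc N) p = refl , column-zeroFrom N z≤n
  column-zeroFrom {suc k} {zero}  (suc N) p = column-zeroFrom N z≤n
  column-zeroFrom {suc k} {suc l} (suc N) p = column-zeroFrom N (s≤s⁻¹ p)

  ⊕-zeroFrom : ∀ k β γ → ZeroFrom k β → ZeroFrom k γ → ZeroFrom k (β ⊕ γ)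
  ⊕-zeroFrom k       []      γ       p q = tt
  ⊕-zeroFrom k       (b ∷ β) []      p q = tt
  ⊕-zeroFrom zero    (b ∷ β) (c ∷ γ) (refl , p) (refl , q) = refl , ⊕-zeroFrom zero β γ p q
  ⊕-zeroFrom (suc k) (b ∷ β) (c ∷ γ) p q = ⊕-zeroFrom k β γ p q

  conjugate-zeroFrom : ∀ {k} N {λs} → All (_≤ k) λs → ZeroFrom k (conjugate N λs)
  conjugate-zeroFrom N []                  = column-zeroFrom N z≤n
  conjugate-zeroFrom N {l ∷ λs} (p ∷ ps) =
    ⊕-zeroFrom _ (column N l) (conjugate N λs) (column-zeroFrom N p) (conjugate-zeroFrom N ps)

  -- The column makes the first k entries positive, and by assumption γ adds nothing beyond them.
  support-column-⊕ : ∀ {N k} γ → length γ ≡ N → k ≤ N → ZeroFrom k γ → support (column N k ⊕ γ) ≡ k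
  support-column-⊕ {zero}  {zero}  []      l p z = refl
  support-column-⊕ {suc N} {zero}  (c ∷ γ) l p (refl , z) = support-column-⊕ γ (ℕ.suc-injective l) z≤n z
  support-column-⊕ {suc N} {suc k} (c ∷ γ) l p z =
    cong suc (support-column-⊕ γ (ℕ.suc-injective l) (s≤s⁻¹ p) z)

  ⊕-cancelˡ : ∀ β {γ δ} → length γ ≡ length β → length δ ≡ length β → β ⊕ γ ≡ β ⊕ δ → γ ≡ δ
  ⊕-cancelˡ []      {[]}    {[]}    p q eq = refl
  ⊕-cancelˡ (b ∷ β) {c ∷ γ} {d ∷ δ} p q eq =
    cong₂ _∷_ (ℕ.+-cancelˡ-≡ b c d (List.∷-injectiveˡ eq))
              (⊕-cancelˡ β (ℕ.suc-injective p) (ℕ.suc-injective q) (List.∷-injectiveʳ eq))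

  support-column-zero : ∀ N → support (column N 0) ≡ 0
  support-column-zero zero    = refl
  support-column-zero (suc N) = support-column-zero N

  support-conjugate : ∀ {N k λs} → Linked _≥_ (k ∷ λs) → k ≤ N → support (conjugate N (k ∷ λs)) ≡ k
  support-conjugate {N} {k} {λs} dec k≤N = support-column-⊕ (conjugate N λs) (length-conjugate N λs) k≤N
    (conjugate-zeroFrom N (AllPairs.head (Linked⇒AllPairs (λ p q → ℕ.≤-trans q p) dec)))

  -- The largest part is recovered as the number of nonzero exponents; its column is cancelled and
  -- the remaining parts follow by recursion.
  conjugate-injective : ∀ {N λs μs} → All (0 <_) λs → All (0 <_) μs → Linked _≥_ λs → Linked _≥_ μs →
    All (_≤ N) λs → All (_≤ N) μs → conjugate N λs ≡ conjugate N μs → λs ≡ μs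
  conjugate-injective {N} {[]}     {[]}     _ _ _ _ _ _ eq = refl
  conjugate-injective {N} {[]}     {l ∷ μs} _ (q ∷ _) _ decμ _ (l≤N ∷ _) eq = contradiction
    (trans (sym (support-column-zero N)) (trans (cong support eq) (support-conjugate decμ l≤N))) (ℕ.<⇒≢ q)
  conjugate-injective {N} {k ∷ λs} {[]}     (p ∷ _) _ decλ _ (k≤N ∷ _) _ eq = contradiction
    (trans (sym (support-column-zero N)) (trans (cong support (sym eq)) (support-conjugate decλ k≤N))) (ℕ.<⇒≢ p)
  conjugate-injective {N} {k ∷ λs} {l ∷ μs} (_ ∷ ps) (_ ∷ qs) decλ decμ (k≤N ∷ λ≤N) (l≤N ∷ μ≤N) eq
    with trans (sym (support-conjugate decλ k≤N)) (trans (cong support eq) (support-conjugate decμ l≤N))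
  ... | refl = cong (k ∷_) (conjugate-injective ps qs (Linked.tail decλ) (Linked.tail decμ) λ≤N μ≤N
    (⊕-cancelˡ (column N k) (trans (length-conjugate N λs) (sym (length-column N k)))
      (trans (length-conjugate N μs) (sym (length-column N k))) eq))

  *-zero-cancel : ∀ {a b} → 0ℚ ℚ.< a → a ℚ.* b ≡ 0ℚ → b ≡ 0ℚ
  *-zero-cancel {a} {b} p eq = ℚ.≤-antisym
    (ℚ.*-cancelˡ-≤-pos a {{ℚ.positive p}} (ℚ.≤-reflexive (trans eq (sym (ℚ.*-zeroʳ a)))))
    (ℚ.*-cancelˡ-≤-pos a {{ℚ.positive p}} (ℚ.≤-reflexive (trans (ℚ.*-zeroʳ a) (sym eq))))

  ⊢⇒≤ : ∀ {n λs} → λs ⊢ n → All (_≤ n) λs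
  ⊢⇒≤ {λs = λs} (_ , _ , refl) = part≤sum λs

  -- The relation is evaluated at the conjugate of `λs`. Any other e_μ that is nonzero there has a
  -- smaller `W-min`, so its coefficient vanishes by induction, and what remains is a positive
  -- multiple of `d λs`.
  e-independent : ∀ n (d : List ℕ → ℚ) → (∀ α → ∑ₗ (partitions n) (λ λs → e[ λs ] α ℚ.* d λs) ≡ 0ℚ) →
    ∀ λs → λs ⊢ n → d λs ≡ 0ℚ
  e-independent n d vanish λs λ⊢n = <-rec (λ w → ∀ λs → W-min λs ≡ w → λs ⊢ n → d λs ≡ 0ℚ) go (W-min λs) λs refl λ⊢n
    where
    go : ∀ w → (∀ {v} → v < w → ∀ λs → W-min λs ≡ v → λs ⊢ n → d λs ≡ 0ℚ) →
      ∀ λs → W-min λs ≡ w → λs ⊢ n → d λs ≡ 0ℚ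
    go w ih λs refl λ⊢n@(posλ , decλ , _) = *-zero-cancel (e-conjugate λs (⊢⇒≤ λ⊢n))
      (trans (sym (∑ₗ-single (λ μs → e[ μs ] α ℚ.* d μs) (partitions-unique n) (∈-partitions⁺ n λ⊢n) others)) (vanish α))
      where
      α = conjugate n λs
      others : ∀ {μs} → μs ∈ partitions n → μs ≢ λs → e[ μs ] α ℚ.* d μs ≡ 0ℚ
      others {μs} μ∈ μ≢λ with e[ μs ] α ℚ.≟ 0ℚ
      ... | yes z = trans (cong (ℚ._* d μs) z) (ℚ.*-zeroˡ (d μs))
      ... | no nz with ∈-partitions⁻ n μ∈ | e-support μs α nz
      ...   | μ⊢n@(posμ , decμ , _) | μ-min , μ-tight with ℕ.m≤n⇒m<n∨m≡n (subst (W-min μs ≤_) (W-conjugate (⊢⇒≤ λ⊢n)) μ-min)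
      ...     | inj₁ less = trans (cong (e[ μs ] α ℚ.*_) (ih less μs refl μ⊢n)) (ℚ.*-zeroʳ (e[ μs ] α))
      ...     | inj₂ same = contradiction (sym (conjugate-injective posλ posμ decλ decμ (⊢⇒≤ λ⊢n) (⊢⇒≤ μ⊢n)
        (trans (μ-tight (trans (W-conjugate (⊢⇒≤ λ⊢n)) (sym same))) (cong (λ l → conjugate l μs) (length-conjugate n λs))))) μ≢λ

  -- Each power of t gives a separate rational relation among the e_λ, satisfied by the differences
  -- of the coefficients.
  expansion-unique : ∀ n c c′ → e-expansion n c ≈ₛ e-expansion n c′ → ∀ λs → λs ⊢ n → c λs ≈ c′ λs
  expansion-unique n c c′ eq λs λ⊢n j = x∙y⁻¹≈ε⇒x≈y _ _
    (e-independent n (λ μs → coeff (c μs) j ℚ.- coeff (c′ μs) j) vanish λs λ⊢n)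
    where
    open import Algebra.Properties.Group ℚ.+-0-group using (x∙y⁻¹≈ε⇒x≈y)
    vanish : ∀ α → ∑ₗ (partitions n) (λ μs → e[ μs ] α ℚ.* (coeff (c μs) j ℚ.- coeff (c′ μs) j)) ≡ 0ℚ
    vanish α = begin
      ∑ₗ (partitions n) (λ μs → e[ μs ] α ℚ.* (coeff (c μs) j ℚ.- coeff (c′ μs) j))
        ≡⟨ ∑ₗ-cong (partitions n) (λ μs → trans (ℚ.*-distribˡ-+ (e[ μs ] α) _ _)
             (cong (e[ μs ] α ℚ.* coeff (c μs) j ℚ.+_) (negate (e[ μs ] α) (coeff (c′ μs) j)))) ⟩
      ∑ₗ (partitions n) (λ μs → F c μs ℚ.+ ℚ.- 1ℚ ℚ.* F c′ μs)
        ≡⟨ trans (∑ₗ-+ (partitions n) (F c) (λ μs → ℚ.- 1ℚ ℚ.* F c′ μs))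
             (cong (∑ₗ (partitions n) (F c) ℚ.+_) (∑ₗ-* (partitions n) (ℚ.- 1ℚ) (F c′))) ⟩
      ∑ₗ (partitions n) (F c) ℚ.+ ℚ.- 1ℚ ℚ.* ∑ₗ (partitions n) (F c′)
        ≡⟨ cong₂ (λ a b → a ℚ.+ ℚ.- 1ℚ ℚ.* b) (sym (expansion-coeff n c α j)) (sym (expansion-coeff n c′ α j)) ⟩
      coeff (e-expansion n c α) j ℚ.+ ℚ.- 1ℚ ℚ.* coeff (e-expansion n c′ α) j
        ≡⟨ cong₂ ℚ._+_ (eq α j) (-1*x≈-x (coeff (e-expansion n c′ α) j)) ⟩
      coeff (e-expansion n c′ α) j ℚ.- coeff (e-expansion n c′ α) j
        ≡⟨ ℚ.+-inverseʳ (coeff (e-expansion n c′ α) j) ⟩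
      0ℚ ∎
      where
      open ≡-Reasoning
      open import Algebra.Properties.Ring ℚ.+-*-ring using (-1*x≈-x)
      F : (List ℕ → ℚ[t]) → List ℕ → ℚ
      F c μs = e[ μs ] α ℚ.* coeff (c μs) j
      negate : ∀ a b → a ℚ.* ℚ.- b ≡ ℚ.- 1ℚ ℚ.* (a ℚ.* b)
      negate a b = trans (sym (ℚ.neg-distribʳ-* a b)) (sym (-1*x≈-x (a ℚ.* b)))

open import Defs
open import Data.List.Base using (List; map)
open import Data.Nat.Base using (ℕ; _≤_)
open import Data.Product.Base using (_×_; ∃-syntax)
open ElementaryExpansion using (orientationCoefficient; existence; expansion-unique)

proposition13 : ∀ n → 2 ≤ n →
    (∃[ c ] X (cycle n) ≈ₛ e-expansion n c) ×
    (∀ (c : List ℕ → ℚ[t]) → X (cycle n) ≈ₛ e-expansion n c →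
    ∀ λs → λs ⊢ n → c λs ≈ sumₚ (map (λ A → t^ (ascₒ (cycle n) A)) (AO n λs)))
proposition13 (suc k) _ = (orientationCoefficient (suc k) , existence k) ,
  λ c eq → expansion-unique (suc k) c (orientationCoefficient (suc k))
    (λ α j → ≡.trans (≡.sym (eq α j)) (existence k α j))
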